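{- For every bipartite graph $H$ with $\gamma(H) > 1$, every $H$-free graph $G$ has a minor $J$ with $$\mathrm{d}(J) \geq (\mathrm{d}(G))^{\frac{\gamma(H)}{2(\gamma(H)-1)}-o_{\mathrm{d}(G)}(1)}.$$
   Context: All graphs are finite and simple; $\mathrm{d}(G)=|E(G)|/|V(G)|$ is the density. $G$ is $H$-free if no subgraph of $G$ is isomorphic to $H$. The Turán number $\operatorname{ex}(n,H)$ is the maximum number of edges in an $H$-free graph on $n$ vertices, and the Turán exponent is $\gamma(H)=\limsup_{n\to\infty}\frac{\log \operatorname{ex}(n,H)}{\log n}$. The term $o_{\mathrm{d}(G)}(1)$ tends to $0$ as $\mathrm{d}(G)\to\infty$ (with $H$ fixed). -}

module Defs where

open import Data.Nat using (ℕ; zero; suc; _+_; _*_; _<ᵇ_; _≤_; _<_)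
open import Data.Bool using (Bool; true; false; _∧_; if_then_else_)
open import Data.Fin using (Fin; toℕ)
open import Data.List using (List; []; _∷_; map; concatMap; allFin)
open import Data.Maybe using (Maybe; just)
open import Data.Product using (Σ; ∃; _×_; _,_)
open import Relation.Binary.PropositionalEquality using (_≡_; _≢_)
open import Function.Definitions using (Injective)

record Graph (n : ℕ) : Set where
  field
    adj    : Fin n → Fin n → Bool
    sym    : ∀ i j → adj i j ≡ adj j i
    irrefl : ∀ i → adj i i ≡ false
open Graph public

count : {A : Set} → (A → Bool) → List A → ℕ
count p []       = 0
count p (x ∷ xs) = if p x then suc (count p xs) else count p xs

pairs : (n : ℕ) → List (Fin n × Fin n)
pairs n = concatMap (λ i → map (λ j → (i , j)) (allFin n)) (allFin n)

edges : {n : ℕ} → Graph n → ℕ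
edges {n} G = count (λ { (i , j) → (toℕ i <ᵇ toℕ j) ∧ adj G i j }) (pairs n)

SubgraphOf : {k n : ℕ} → Graph k → Graph n → Set
SubgraphOf {k} {n} H G =
  Σ (Fin k → Fin n) λ f → Injective _≡_ _≡_ f ×
    (∀ i j → adj H i j ≡ true → adj G (f i) (f j) ≡ true)

Free : {k n : ℕ} → Graph k → Graph n → Set
Free H G = SubgraphOf H G → ⊥'
  where open import Data.Empty renaming (⊥ to ⊥')

Bipartite : {k : ℕ} → Graph k → Set
Bipartite {k} H = Σ (Fin k → Bool) λ c → ∀ i j → adj H i j ≡ true → c i ≢ c j

data WalkIn {n : ℕ} (G : Graph n) (P : Fin n → Set) : Fin n → Fin n → Set where
  here : ∀ {u} → P u → WalkIn G P u u
  step : ∀ {u w v} → P u → adj G u w ≡ true → WalkIn G P w v → WalkIn G P u v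

-- J is a minor of G (branch-set definition): a partial map β from V(G) to V(J)
-- whose fibres (branch sets) are nonempty, pairwise disjoint (automatic),
-- connected in G, and every edge xy of J is realised by an edge of G between
-- the branch sets of x and y.
MinorOf : {m n : ℕ} → Graph m → Graph n → Set
MinorOf {m} {n} J G =
  Σ (Fin n → Maybe (Fin m)) λ β →
    (∀ x → ∃ λ u → β u ≡ just x) ×
    (∀ x u v → β u ≡ just x → β v ≡ just x → WalkIn G (λ w → β w ≡ just x) u v) ×
    (∀ x y → adj J x y ≡ true →
       ∃ λ u → ∃ λ v → β u ≡ just x × β v ≡ just y × adj G u v ≡ true)

-- ex(n,H)^v ≥ n^u  (i.e. some H-free graph on n vertices has e edges, e^v ≥ n^u)
ExPowAtLeast : {k : ℕ} → Graph k → ℕ → ℕ → ℕ → Set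
ExPowAtLeast H n u v = Σ (Graph n) λ G → Free H G × n ^ u ≤ edges G ^ v
  where open import Data.Nat using (_^_)

-- ex(n,H)^v ≤ n^u  (every H-free graph on n vertices has e edges, e^v ≤ n^u)
ExPowAtMost : {k : ℕ} → Graph k → ℕ → ℕ → ℕ → Set
ExPowAtMost H n u v = (G : Graph n) → Free H G → edges G ^ v ≤ n ^ u
  where open import Data.Nat using (_^_)

-- p/q < γ(H), γ(H) = limsup log ex(n,H) / log n :
-- there is a rational u/v > p/q with ex(n,H) ≥ n^(u/v) for infinitely many n.
GammaAbove : {k : ℕ} → Graph k → ℕ → ℕ → Set
GammaAbove H p q =
  Σ ℕ λ u → Σ ℕ λ v → 0 < v × p * v < u * q ×
    (∀ N → Σ ℕ λ n → N ≤ n × ExPowAtLeast H n u v)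

-- γ(H) < p/q : there is a rational u/v < p/q with ex(n,H) ≤ n^(u/v) for all large n.
GammaBelow : {k : ℕ} → Graph k → ℕ → ℕ → Set
GammaBelow H p q =
  Σ ℕ λ u → Σ ℕ λ v → 0 < v × u * q < p * v ×
    (Σ ℕ λ N → ∀ n → N ≤ n → ExPowAtMost H n u v)

{-# OPTIONS --safe #-}

-- Write γ = p/q for an exponent such that H-free graphs on n vertices have at most n^γ edges. If the branch sets of a
-- minor of an almost regular graph of degree d have about w vertices each and contracting any edge of the minor would
-- lose a constant proportion of the degree d w, then the neighbourhood of a vertex of the minor lifts to about d w²
-- vertices of G spanning (d w)² edges, which contradicts H-freeness as long as d w < d^(γ/(2(γ−1))). So branch sets can
-- be merged with little loss until the density reaches that value. To keep the sizes of the branch sets comparable,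
-- this is done in a bounded number of rounds, each multiplying the sizes by a small power of d. Each round first merges
-- branch sets up to a size cap and then lets the big branch sets absorb the small ones.
--
-- Almost regularity is arranged beforehand. If most edges meet vertices whose degree is a huge power of d, these hubs
-- absorb neighbours to form a dense minor directly, or there is a subgraph with boundedly many (in terms of d) vertices
-- and the same density. Once the degrees are at most a power of d, the vertices of large degree are repeatedly split off
-- and balanced against a thinned-out set of vertices of small degree; each repetition divides the maximum degree by a
-- small power of d and the density by a constant.
module Submission where

open import Defs
open import Data.Nat using (ℕ; zero; suc; pred; _+_; _*_; _∸_; _^_; _≤_; _<_; z≤n; s≤s; _≤?_; _<?_; _<ᵇ_; _/_; _%_; NonZero; >-nonZero)
open import Data.Nat.Properties hiding (_≟_; suc-injective)
open import Data.Nat.DivMod using (m≡m%n+[m/n]*n; m%n<n; m/n*n≤m; m*n/n≡m; /-monoˡ-≤)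
open import Data.Nat.Induction using (<-wellFounded)
open import Data.Nat.Tactic.RingSolver using (solve-∀)
open import Data.Bool using (Bool; true; false; _∧_; _∨_; not; if_then_else_)
open import Data.Fin using (Fin; zero; suc; toℕ)
open import Data.Fin.Properties using (_≟_; any?; toℕ-injective; suc-injective)
open import Data.List using (List; []; _∷_; _++_; map; concatMap; allFin; tabulate)
open import Data.Maybe as Maybe using (Maybe; just; nothing)
open import Data.Maybe.Properties using (just-injective)
open import Data.Product using (Σ; ∃; _×_; _,_; proj₁; proj₂)
open import Data.Sum using (_⊎_; inj₁; inj₂)
open import Data.Empty using (⊥-elim)
open import Function using (_∘_; case_of_)
open import Induction.WellFounded using (Acc; acc)
open import Relation.Nullary using (¬_; Dec; yes; no; does)
open import Relation.Nullary.Decidable using (dec-true; dec-false; _×-dec_; ¬?)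
open import Relation.Binary.Definitions using (tri<; tri≈; tri>)
open import Relation.Binary.PropositionalEquality as Eq using (_≡_; _≢_; refl; trans; cong; cong₂; subst)
open import Algebra.Properties.Semiring.Sum +-*-semiring using (sum; sum-cong-≗; ∑-distrib-+; ∑-comm; *-distribˡ-sum; sum-replicate-zero)

-- A dense spot is measured with the largest branch set, the density gained with the average one. So
-- a round must keep the largest within a small power of d of the average, which merging every cheap
-- pair would not do. Under a size cap, merging may stop with many small branch sets that see only
-- large ones, and deleting those could destroy most edges. Letting the large sets absorb them, up
-- to a second, larger cap, settles this: a set that reaches the larger cap uses up so many vertices
-- that there are few such sets, and any other large set has few small neighbours left, since many
-- of them would form a dense spot. What is then deleted carries only a small part of the edges. A
-- round may still halve the number of edges, which is harmless because the number N of rounds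
-- depends only on the exponents: 2^N is a constant, and constants are beaten by a factor R, a small
-- fixed power of the density of G. Real exponents never occur: densities are compared through
-- natural powers with the denominators cleared, and edges are counted as ordered pairs.

infixr 7 _⊗_
infixl 6 _⊕_

_⊕_ : ∀ {a b c d} → a ≤ b → c ≤ d → a + c ≤ b + d
_⊕_ = +-mono-≤

_⊗_ : ∀ k {a b} → a ≤ b → k * a ≤ k * b
k ⊗ a≤b = *-monoʳ-≤ k a≤b

-- Linear arithmetic: L ≤ R follows from A ≤ B once (k+1)(R − L) = (B − A) + s.
linear : ∀ k s {A B L R} → A ≤ B → suc k * L + B + s ≡ suc k * R + A → L ≤ R
linear k s {A} {B} {L} {R} A≤B eq = *-cancelˡ-≤ (suc k) (+-cancelʳ-≤ A _ _ (begin
  suc k * L + A     ≤⟨ +-monoʳ-≤ (suc k * L) A≤B ⟩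
  suc k * L + B     ≤⟨ m≤m+n _ s ⟩
  suc k * L + B + s ≡⟨ eq ⟩
  suc k * R + A     ∎))
  where open ≤-Reasoning

-- Truth values as numbers, and finite sums

⟦_⟧ : Bool → ℕ
⟦ true ⟧  = 1
⟦ false ⟧ = 0

∧-intro : ∀ {a b} → a ≡ true → b ≡ true → a ∧ b ≡ true
∧-intro refl refl = refl

∧-elim : ∀ {a b} → a ∧ b ≡ true → a ≡ true × b ≡ true
∧-elim {true} {true} refl = refl , refl

∨-elim : ∀ {a b} → a ∨ b ≡ true → a ≡ true ⊎ b ≡ true
∨-elim {true}  _ = inj₁ refl
∨-elim {false} p = inj₂ p

∨-introˡ : ∀ {a b} → a ≡ true → a ∨ b ≡ true
∨-introˡ refl = refl

∨-introʳ : ∀ {a b} → b ≡ true → a ∨ b ≡ true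
∨-introʳ {true}  _ = refl
∨-introʳ {false} p = p

not-elim : ∀ {a} → not a ≡ true → a ≢ true
not-elim {false} _ ()

not-intro : ∀ {a} → a ≢ true → not a ≡ true
not-intro {true}  a≢ = ⊥-elim (a≢ refl)
not-intro {false} _  = refl

≢true⇒false : ∀ {a} → a ≢ true → a ≡ false
≢true⇒false {true}  a≢ = ⊥-elim (a≢ refl)
≢true⇒false {false} _  = refl

≡-by-⇔ : ∀ {a b} → (a ≡ true → b ≡ true) → (b ≡ true → a ≡ true) → a ≡ b
≡-by-⇔ {true}  {b}     f g = Eq.sym (f refl)
≡-by-⇔ {false} {true}  f g = g refl
≡-by-⇔ {false} {false} f g = refl

does-elim : ∀ {A : Set} (A? : Dec A) → does A? ≡ true → A
does-elim (yes a) _ = a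

true? : (b : Bool) → Dec (b ≡ true)
true? true  = yes refl
true? false = no λ ()

⟦⟧-true : ∀ {b} → b ≡ true → ⟦ b ⟧ ≡ 1
⟦⟧-true refl = refl

⟦⟧*-≤ : ∀ {b} {m k} → (b ≡ true → m ≤ k) → ⟦ b ⟧ * m ≤ k
⟦⟧*-≤ {true}  {m} h = ≤-trans (≤-reflexive (*-identityˡ m)) (h refl)
⟦⟧*-≤ {false} h = z≤n

⟦⟧-≤ : ∀ {b} {k} → (b ≡ true → 1 ≤ k) → ⟦ b ⟧ ≤ k
⟦⟧-≤ {true}  h = h refl
⟦⟧-≤ {false} h = z≤n

⟦⟧-mono : ∀ {a b} → (a ≡ true → b ≡ true) → ⟦ a ⟧ ≤ ⟦ b ⟧
⟦⟧-mono h = ⟦⟧-≤ λ p → ≤-reflexive (Eq.sym (⟦⟧-true (h p)))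

⟦⟧-∧ : ∀ a b → ⟦ a ∧ b ⟧ ≡ ⟦ a ⟧ * ⟦ b ⟧
⟦⟧-∧ true  b = Eq.sym (*-identityˡ ⟦ b ⟧)
⟦⟧-∧ false b = refl

sum-mono : ∀ {n} {f g : Fin n → ℕ} → (∀ i → f i ≤ g i) → sum f ≤ sum g
sum-mono {zero}  f≤g = z≤n
sum-mono {suc n} f≤g = f≤g zero ⊕ sum-mono (f≤g ∘ suc)

term≤sum : ∀ {n} (f : Fin n → ℕ) i → f i ≤ sum f
term≤sum f zero    = m≤m+n _ _
term≤sum f (suc i) = ≤-trans (term≤sum (f ∘ suc) i) (m≤n+m _ (f zero))

sum-zero : ∀ {n} {f : Fin n → ℕ} → (∀ i → f i ≡ 0) → sum f ≡ 0
sum-zero {n} f≡0 = trans (sum-cong-≗ f≡0) (sum-replicate-zero n)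

sum-δ : ∀ {n} (z : Fin n) (f : Fin n → ℕ) → sum (λ x → ⟦ does (z ≟ x) ⟧ * f x) ≡ f z
sum-δ {suc n} zero f = trans (cong₂ _+_ (*-identityˡ (f zero)) (sum-zero {n} (λ x → refl))) (+-identityʳ _)
sum-δ (suc z) f = trans (sum-cong-≗ lemma) (sum-δ z (f ∘ suc))
  where
  lemma : ∀ x → ⟦ does (suc z ≟ suc x) ⟧ * f (suc x) ≡ ⟦ does (z ≟ x) ⟧ * f (suc x)
  lemma x with z ≟ x
  ... | yes _ = refl
  ... | no _  = refl

sum-bound : ∀ {n} {P : Fin n → Bool} {f : Fin n → ℕ} {k} →
            (∀ i → P i ≡ true → f i ≤ k) → sum (λ i → ⟦ P i ⟧ * f i) ≤ k * sum (λ i → ⟦ P i ⟧)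
sum-bound {P = P} {f} {k} h = ≤-trans (sum-mono pointwise) (≤-reflexive (Eq.sym (*-distribˡ-sum k (λ i → ⟦ P i ⟧))))
  where
  pointwise : ∀ i → ⟦ P i ⟧ * f i ≤ k * ⟦ P i ⟧
  pointwise i with P i | h i
  ... | true  | hi = ≤-trans (≤-reflexive (*-identityˡ _)) (≤-trans (hi refl) (≤-reflexive (Eq.sym (*-identityʳ k))))
  ... | false | _  = z≤n

sum-positive : ∀ {n} (f : Fin n → ℕ) → 0 < sum f → ∃ λ i → 0 < f i
sum-positive {suc n} f 0<s with f zero in eq
... | suc _ = zero , subst (0 <_) (Eq.sym eq) (s≤s z≤n)
... | zero with sum-positive (f ∘ suc) 0<s
...   | i , 0<fi = suc i , 0<fi

∃ᵇ : ∀ {n} → (Fin n → Bool) → Bool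
∃ᵇ p = does (any? (λ i → true? (p i)))

∃ᵇ-intro : ∀ {n} (p : Fin n → Bool) i → p i ≡ true → ∃ᵇ p ≡ true
∃ᵇ-intro p i pi = dec-true (any? (λ i → true? (p i))) (i , pi)

∃ᵇ-elim : ∀ {n} (p : Fin n → Bool) → ∃ᵇ p ≡ true → ∃ λ i → p i ≡ true
∃ᵇ-elim p = does-elim (any? (λ i → true? (p i)))

-- Subsets and relations on a finite vertex set

Subset Relation : ℕ → Set
Subset n   = Fin n → Bool
Relation n = Fin n → Fin n → Bool

card : ∀ {n} → Subset n → ℕ
card P = sum (λ i → ⟦ P i ⟧)

degree : ∀ {n} → Relation n → Fin n → ℕ
degree F i = card (F i)

-- For a symmetric irreflexive relation this is twice the number of edges.
volume : ∀ {n} → Relation n → ℕ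
volume F = sum (degree F)

cut : ∀ {n} → Relation n → Subset n → Subset n → ℕ
cut F P Q = sum (λ i → sum (λ j → ⟦ P i ∧ Q j ∧ F i j ⟧))

card-mono : ∀ {n} {P Q : Subset n} → (∀ i → P i ≡ true → Q i ≡ true) → card P ≤ card Q
card-mono h = sum-mono (λ i → ⟦⟧-mono (h i))

card-positive : ∀ {n} (P : Subset n) i → P i ≡ true → 0 < card P
card-positive P i Pi = ≤-trans (≤-reflexive (Eq.sym (⟦⟧-true Pi))) (term≤sum (λ i → ⟦ P i ⟧) i)

card-inhabited : ∀ {n} (P : Subset n) → 0 < card P → ∃ λ i → P i ≡ true
card-inhabited P 0<P with sum-positive _ 0<P
... | i , 0<⟦Pi⟧ = i , helper (P i) 0<⟦Pi⟧
  where
  helper : ∀ b → 0 < ⟦ b ⟧ → b ≡ true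
  helper true _ = refl

card-∨ : ∀ {n} (P Q : Subset n) → card (λ i → P i ∨ Q i) ≤ card P + card Q
card-∨ P Q = ≤-trans (sum-mono pointwise) (≤-reflexive (∑-distrib-+ (λ i → ⟦ P i ⟧) (λ i → ⟦ Q i ⟧)))
  where
  pointwise : ∀ i → ⟦ P i ∨ Q i ⟧ ≤ ⟦ P i ⟧ + ⟦ Q i ⟧
  pointwise i with P i
  ... | true  = s≤s z≤n
  ... | false = ≤-refl

sum-⟦∧⟧ : ∀ {n} a (P : Subset n) → sum (λ i → ⟦ a ∧ P i ⟧) ≡ ⟦ a ⟧ * card P
sum-⟦∧⟧ true  P = Eq.sym (*-identityˡ _)
sum-⟦∧⟧ {n} false P = sum-zero {n} (λ _ → refl)

sum₂-+ : ∀ {m n} (f g : Fin m → Fin n → ℕ) →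
         sum (λ i → sum (λ j → f i j + g i j)) ≡ sum (λ i → sum (f i)) + sum (λ i → sum (g i))
sum₂-+ f g = trans (sum-cong-≗ (λ i → ∑-distrib-+ (f i) (g i))) (∑-distrib-+ (λ i → sum (f i)) (λ i → sum (g i)))

sum₂-mono : ∀ {m n} {f g : Fin m → Fin n → ℕ} → (∀ i j → f i j ≤ g i j) →
            sum (λ i → sum (f i)) ≤ sum (λ i → sum (g i))
sum₂-mono h = sum-mono (λ i → sum-mono (h i))

term≤sum₂ : ∀ {m n} (f : Fin m → Fin n → ℕ) i j → f i j ≤ sum (λ i → sum (f i))
term≤sum₂ f i j = ≤-trans (term≤sum (f i) j) (term≤sum (λ i → sum (f i)) i)

sum-≤-*card : ∀ {n} (P : Subset n) (f : Fin n → ℕ) k → (∀ i → P i ≡ true → k ≤ f i) →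
              k * card P ≤ sum (λ i → ⟦ P i ⟧ * f i)
sum-≤-*card P f k h = ≤-trans (≤-reflexive (*-distribˡ-sum k (λ i → ⟦ P i ⟧))) (sum-mono pointwise)
  where
  pointwise : ∀ i → k * ⟦ P i ⟧ ≤ ⟦ P i ⟧ * f i
  pointwise i with P i | h i
  ... | true  | hi = ≤-trans (≤-reflexive (*-identityʳ k)) (≤-trans (hi refl) (≤-reflexive (Eq.sym (*-identityˡ _))))
  ... | false | _  = ≤-reflexive (*-zeroʳ k)

-- Branch sets and quotients

-- A labelling β : Fin n → Maybe (Fin n) describes a minor: its vertices are the labels in use,
-- the branch set of a label is its fibre, and unlabelled vertices are deleted.

is : ∀ {n} → Maybe (Fin n) → Fin n → Bool
is (just z) x = does (z ≟ x)
is nothing  x = false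

is-elim : ∀ {n} (b : Maybe (Fin n)) {x} → is b x ≡ true → b ≡ just x
is-elim (just z) {x} p = cong just (does-elim (z ≟ x) p)

is-intro : ∀ {n} {b : Maybe (Fin n)} {x} → b ≡ just x → is b x ≡ true
is-intro {x = x} refl = dec-true (x ≟ x) refl

sum-is : ∀ {n} (b : Maybe (Fin n)) (f : Fin n → ℕ) {k} → (∀ x → b ≡ just x → f x ≤ k) →
         sum (λ x → ⟦ is b x ⟧ * f x) ≤ k
sum-is (just z) f h = ≤-trans (≤-reflexive (sum-δ z f)) (h z refl)
sum-is {n} nothing  f h = ≤-trans (≤-reflexive (sum-zero {n} (λ _ → refl))) z≤n

card-is : ∀ {n} (b : Maybe (Fin n)) → card (is b) ≤ 1
card-is b = ≤-trans (sum-mono (λ x → ≤-reflexive (Eq.sym (*-identityʳ ⟦ is b x ⟧)))) (sum-is b (λ _ → 1) (λ _ _ → ≤-refl))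

Labelling : ℕ → Set
Labelling n = Fin n → Maybe (Fin n)

fibre : ∀ {n} → Labelling n → Fin n → Subset n
fibre β x u = is (β u) x

size : ∀ {n} → Labelling n → Fin n → ℕ
size β x = card (fibre β x)

label : ∀ {n} → Labelling n → Subset n
label β x = ∃ᵇ (fibre β x)

label-intro : ∀ {n} (β : Labelling n) {u x} → β u ≡ just x → label β x ≡ true
label-intro β {u} {x} βu = ∃ᵇ-intro (fibre β x) u (is-intro βu)

label-elim : ∀ {n} (β : Labelling n) {x} → label β x ≡ true → ∃ λ u → β u ≡ just x
label-elim β {x} p with ∃ᵇ-elim (fibre β x) p
... | u , q = u , is-elim (β u) q

abstract
  quotient : ∀ {n} → Relation n → Labelling n → Relation n
  quotient F β x y = not (does (x ≟ y)) ∧ ∃ᵇ (λ u → ∃ᵇ (λ v → is (β u) x ∧ is (β v) y ∧ F u v))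

  quotient-intro : ∀ {n} (F : Relation n) (β : Labelling n) {x y u v} → x ≢ y →
                   β u ≡ just x → β v ≡ just y → F u v ≡ true → quotient F β x y ≡ true
  quotient-intro F β {x} {y} {u} {v} x≢y βu βv Fuv =
    ∧-intro (not-intro (x≢y ∘ does-elim (x ≟ y)))
      (∃ᵇ-intro (λ u → ∃ᵇ (λ v → is (β u) x ∧ is (β v) y ∧ F u v)) u
        (∃ᵇ-intro (λ v → is (β u) x ∧ is (β v) y ∧ F u v) v
          (∧-intro (is-intro βu) (∧-intro (is-intro βv) Fuv))))

  quotient-elim : ∀ {n} (F : Relation n) (β : Labelling n) {x y} → quotient F β x y ≡ true →
                  x ≢ y × ∃ λ u → ∃ λ v → β u ≡ just x × β v ≡ just y × F u v ≡ true
  quotient-elim F β {x} {y} p with ∧-elim {not (does (x ≟ y))} p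
  ... | p₁ , p₂ with ∃ᵇ-elim (λ u → ∃ᵇ (λ v → is (β u) x ∧ is (β v) y ∧ F u v)) p₂
  ... | u , p₃ with ∃ᵇ-elim (λ v → is (β u) x ∧ is (β v) y ∧ F u v) p₃
  ... | v , p₄ with ∧-elim {is (β u) x} p₄
  ... | p₅ , p₆ with ∧-elim {is (β v) y} p₆
  ... | p₇ , p₈ = (λ x≡y → not-elim p₁ (dec-true (x ≟ y) x≡y)) , u , v , is-elim (β u) p₅ , is-elim (β v) p₇ , p₈

quotient-labelˡ : ∀ {n} (F : Relation n) (β : Labelling n) {x y} → quotient F β x y ≡ true → label β x ≡ true
quotient-labelˡ F β p with quotient-elim F β p
... | _ , _ , _ , βu , _ = label-intro β βu

Symmetric : ∀ {n} → Relation n → Set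
Symmetric F = ∀ i j → F i j ≡ true → F j i ≡ true

quotient-sym : ∀ {n} (F : Relation n) (β : Labelling n) → Symmetric F → Symmetric (quotient F β)
quotient-sym F β F-sym x y p with quotient-elim F β p
... | x≢y , u , v , βu , βv , Fuv = quotient-intro F β (x≢y ∘ Eq.sym) βv βu (F-sym u v Fuv)

quotient-≤ : ∀ {n} (F : Relation n) (β : Labelling n) x y →
             ⟦ quotient F β x y ⟧ ≤ sum (λ u → sum (λ v → ⟦ (is (β u) x ∧ F u v) ∧ is (β v) y ⟧))
quotient-≤ F β x y = ⟦⟧-≤ λ p → let (_ , u , v , βu , βv , Fuv) = quotient-elim F β p in
  ≤-trans (≤-reflexive (Eq.sym (⟦⟧-true (∧-intro (∧-intro (is-intro βu) Fuv) (is-intro βv)))))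
          (term≤sum₂ (λ u v → ⟦ (is (β u) x ∧ F u v) ∧ is (β v) y ⟧) u v)

sum-⟦∧is⟧ : ∀ {n} a (b : Maybe (Fin n)) → sum (λ y → ⟦ a ∧ is b y ⟧) ≤ ⟦ a ⟧
sum-⟦∧is⟧ a b = ≤-trans (≤-reflexive (sum-⟦∧⟧ a (is b)))
                  (≤-trans (⟦ a ⟧ ⊗ card-is b) (≤-reflexive (*-identityʳ ⟦ a ⟧)))

-- Every neighbour of `x` is reached by an edge leaving the branch set of `x`, and the far end of an
-- edge carries at most one label.
degree-quotient : ∀ {n} (F : Relation n) (β : Labelling n) Δ → (∀ i → degree F i ≤ Δ) →
                  ∀ x → degree (quotient F β) x ≤ Δ * size β x
degree-quotient {n} F β Δ F≤Δ x = begin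
  sum (λ y → ⟦ quotient F β x y ⟧)                           ≤⟨ sum-mono (quotient-≤ F β x) ⟩
  sum (λ y → sum (λ u → sum (λ v → t u v y)))                ≡⟨ ∑-comm (λ y u → sum (λ v → t u v y)) ⟩
  sum (λ u → sum (λ y → sum (λ v → t u v y)))                ≡⟨ sum-cong-≗ (λ u → ∑-comm (λ y v → t u v y)) ⟩
  sum (λ u → sum (λ v → sum (λ y → t u v y)))                ≤⟨ sum₂-mono (λ u v → sum-⟦∧is⟧ (is (β u) x ∧ F u v) (β v)) ⟩
  sum (λ u → sum (λ v → ⟦ is (β u) x ∧ F u v ⟧))             ≡⟨ sum-cong-≗ (λ u → sum-⟦∧⟧ (is (β u) x) (F u)) ⟩
  sum (λ u → ⟦ is (β u) x ⟧ * degree F u)                    ≤⟨ sum-bound (λ u _ → F≤Δ u) ⟩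
  Δ * size β x                                               ∎
  where
  open ≤-Reasoning
  t : Fin n → Fin n → Fin n → ℕ
  t u v y = ⟦ (is (β u) x ∧ F u v) ∧ is (β v) y ⟧

sum-size : ∀ {n} (β : Labelling n) (V : Subset n) → (∀ u x → β u ≡ just x → V u ≡ true) →
           sum (size β) ≤ card V
sum-size {n} β V inside = ≤-trans (≤-reflexive (∑-comm (λ x u → ⟦ is (β u) x ⟧))) (sum-mono pointwise)
  where
  pointwise : ∀ u → card (is (β u)) ≤ ⟦ V u ⟧
  pointwise u with β u | inside u
  ... | just z  | h = ≤-trans (card-is (just z)) (≤-reflexive (Eq.sym (⟦⟧-true (h z refl))))
  ... | nothing | _ = ≤-trans (≤-reflexive (sum-zero {n} (λ _ → refl))) z≤n

-- Dense spots

codegree : ∀ {n} → Relation n → Fin n → Fin n → ℕ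
codegree R x y = card (λ z → R x z ∧ R y z)

inner : ∀ {n} → Relation n → Subset n → Relation n
inner F X u v = X u ∧ X v ∧ F u v

-- X is the union of the branch sets adjacent to v; distinct edges among them in the quotient lift to distinct edges.
dense-spot : ∀ {n} (F : Relation n) (β : Labelling n) Δ → (∀ i → degree F i ≤ Δ) →
             ∀ S → (∀ x → size β x ≤ S) → ∀ λ₀ v (A : Subset n) →
             (∀ ℓ → A ℓ ≡ true → quotient F β v ℓ ≡ true × λ₀ ≤ codegree (quotient F β) ℓ v) →
             λ₀ ≤ card A →
             Σ (Subset n) λ X → card X ≤ Δ * (S * S) × λ₀ * λ₀ ≤ volume (inner F X)
dense-spot {n} F β Δ F≤Δ S β≤S λ₀ v A A-dense λ₀≤A = X , X-small , X-dense
  where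
  open ≤-Reasoning
  q = quotient F β

  X : Subset n
  X u = ∃ᵇ (λ y → is (β u) y ∧ q v y)

  X-intro : ∀ u y → β u ≡ just y → q v y ≡ true → X u ≡ true
  X-intro u y βu qvy = ∃ᵇ-intro (λ y → is (β u) y ∧ q v y) y (∧-intro (is-intro βu) qvy)

  X-≤ : ∀ u → ⟦ X u ⟧ ≤ sum (λ y → ⟦ q v y ∧ is (β u) y ⟧)
  X-≤ u = ⟦⟧-≤ λ p → let (y , r) = ∃ᵇ-elim (λ y → is (β u) y ∧ q v y) p
                         (r₁ , r₂) = ∧-elim {is (β u) y} r in
    ≤-trans (≤-reflexive (Eq.sym (⟦⟧-true (∧-intro r₂ r₁)))) (term≤sum (λ y → ⟦ q v y ∧ is (β u) y ⟧) y)

  -- `v` has at most `Δ * S` neighbours in the quotient, each with at most `S` vertices.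
  X-small : card X ≤ Δ * (S * S)
  X-small = begin
    card X                                           ≤⟨ sum-mono X-≤ ⟩
    sum (λ u → sum (λ y → ⟦ q v y ∧ is (β u) y ⟧))   ≡⟨ ∑-comm (λ u y → ⟦ q v y ∧ is (β u) y ⟧) ⟩
    sum (λ y → sum (λ u → ⟦ q v y ∧ is (β u) y ⟧))   ≡⟨ sum-cong-≗ (λ y → sum-⟦∧⟧ (q v y) (fibre β y)) ⟩
    sum (λ y → ⟦ q v y ⟧ * size β y)                 ≤⟨ sum-bound (λ y _ → β≤S y) ⟩
    S * degree q v                                   ≤⟨ S ⊗ degree-quotient F β Δ F≤Δ v ⟩
    S * (Δ * size β v)                               ≤⟨ S ⊗ Δ ⊗ β≤S v ⟩
    S * (Δ * S)                                      ≡⟨ rearrange S Δ ⟩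
    Δ * (S * S)                                      ∎
    where
    rearrange : ∀ S Δ → S * (Δ * S) ≡ Δ * (S * S)
    rearrange = solve-∀

  t : Fin n → Fin n → Fin n → Fin n → ℕ
  t u u′ ℓ z = ⟦ (inner F X u u′ ∧ is (β u) ℓ) ∧ is (β u′) z ⟧

  triangle : ∀ ℓ z → ⟦ A ℓ ⟧ * ⟦ q ℓ z ∧ q v z ⟧ ≤ sum (λ u → sum (λ u′ → t u u′ ℓ z))
  triangle ℓ z = ⟦⟧*-≤ λ Aℓ → ⟦⟧-≤ λ p →
    let (qℓz , qvz) = ∧-elim {q ℓ z} p
        (_ , u , u′ , βu , βu′ , Fuu′) = quotient-elim F β qℓz
        Xu  = X-intro u ℓ βu (proj₁ (A-dense ℓ Aℓ))
        Xu′ = X-intro u′ z βu′ qvz in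
    ≤-trans (≤-reflexive (Eq.sym (⟦⟧-true (∧-intro (∧-intro (∧-intro Xu (∧-intro Xu′ Fuu′)) (is-intro βu)) (is-intro βu′)))))
            (term≤sum₂ (λ u u′ → t u u′ ℓ z) u u′)

  X-dense : λ₀ * λ₀ ≤ volume (inner F X)
  X-dense = begin
    λ₀ * λ₀                                                          ≤⟨ λ₀ ⊗ λ₀≤A ⟩
    λ₀ * card A                                                      ≤⟨ sum-≤-*card A (λ ℓ → codegree q ℓ v) λ₀ (λ ℓ Aℓ → proj₂ (A-dense ℓ Aℓ)) ⟩
    sum (λ ℓ → ⟦ A ℓ ⟧ * codegree q ℓ v)                             ≡⟨ sum-cong-≗ (λ ℓ → *-distribˡ-sum ⟦ A ℓ ⟧ (λ z → ⟦ q ℓ z ∧ q v z ⟧)) ⟩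
    sum (λ ℓ → sum (λ z → ⟦ A ℓ ⟧ * ⟦ q ℓ z ∧ q v z ⟧))              ≤⟨ sum₂-mono triangle ⟩
    sum (λ ℓ → sum (λ z → sum (λ u → sum (λ u′ → t u u′ ℓ z))))      ≡⟨ sum-cong-≗ (λ ℓ → trans (∑-comm (λ z u → sum (λ u′ → t u u′ ℓ z))) (sum-cong-≗ (λ u → ∑-comm (λ z u′ → t u u′ ℓ z)))) ⟩
    -- The labels of `u′` and `u` determine `z` and `ℓ`, so an edge inside `X` is charged at most
    -- once.
    sum (λ ℓ → sum (λ u → sum (λ u′ → sum (λ z → t u u′ ℓ z))))      ≤⟨ sum₂-mono (λ ℓ u → sum-mono (λ u′ → sum-⟦∧is⟧ (inner F X u u′ ∧ is (β u) ℓ) (β u′))) ⟩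
    sum (λ ℓ → sum (λ u → sum (λ u′ → ⟦ inner F X u u′ ∧ is (β u) ℓ ⟧)))  ≡⟨ trans (∑-comm (λ ℓ u → sum (λ u′ → ⟦ inner F X u u′ ∧ is (β u) ℓ ⟧))) (sum-cong-≗ (λ u → ∑-comm (λ ℓ u′ → ⟦ inner F X u u′ ∧ is (β u) ℓ ⟧))) ⟩
    sum (λ u → sum (λ u′ → sum (λ ℓ → ⟦ inner F X u u′ ∧ is (β u) ℓ ⟧)))  ≤⟨ sum₂-mono (λ u u′ → sum-⟦∧is⟧ (inner F X u u′) (β u)) ⟩
    volume (inner F X)                                               ∎

-- Merging adjacent branch sets

Model : ∀ {n} → Graph n → Labelling n → Set
Model G β = ∀ x u v → β u ≡ just x → β v ≡ just x → WalkIn G (λ w → β w ≡ just x) u v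

walk-map : ∀ {n} {G : Graph n} {P Q : Fin n → Set} → (∀ w → P w → Q w) →
           ∀ {u v} → WalkIn G P u v → WalkIn G Q u v
walk-map f (here p)       = here (f _ p)
walk-map f (step p a w)   = step (f _ p) a (walk-map f w)

walk-++ : ∀ {n} {G : Graph n} {P : Fin n → Set} {u v w} →
          WalkIn G P u v → adj G v w ≡ true → ∀ {z} → WalkIn G P w z → WalkIn G P u z
walk-++ (here p)     e w′ = step p e w′
walk-++ (step p a w) e w′ = step p a (walk-++ w e w′)

relabel : ∀ {n} → Fin n → Fin n → Fin n → Fin n
relabel x y z = if does (z ≟ x) then y else z

relabel-≡ : ∀ {n} (x y : Fin n) → relabel x y x ≡ y
relabel-≡ x y rewrite dec-true (x ≟ x) refl = refl

relabel-≢ : ∀ {n} (x y : Fin n) {z} → z ≢ x → relabel x y z ≡ z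
relabel-≢ x y {z} z≢x rewrite dec-false (z ≟ x) z≢x = refl

merge : ∀ {n} → Fin n → Fin n → Labelling n → Labelling n
merge x y β u = Maybe.map (relabel x y) (β u)

merge-≡ : ∀ {n} (x y : Fin n) β {u} → β u ≡ just x → merge x y β u ≡ just y
merge-≡ x y β βu rewrite βu = cong just (relabel-≡ x y)

merge-≢ : ∀ {n} (x y : Fin n) β {u z} → z ≢ x → β u ≡ just z → merge x y β u ≡ just z
merge-≢ x y β z≢x βu rewrite βu = cong just (relabel-≢ x y z≢x)

merge-elim : ∀ {n} (x y : Fin n) β {u z} → merge x y β u ≡ just z →
             (β u ≡ just x × z ≡ y) ⊎ (β u ≡ just z × z ≢ x)
merge-elim x y β {u} p with β u
... | just w with w ≟ x
...   | yes refl = inj₁ (refl , Eq.sym (just-injective p))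
...   | no w≢x   = inj₂ (p , λ z≡x → w≢x (trans (just-injective p) z≡x))

merge-model : ∀ {n} (G : Graph n) (F : Relation n) → (∀ i j → F i j ≡ true → adj G i j ≡ true) → Symmetric F →
              ∀ β x y → quotient F β x y ≡ true → Model G β → Model G (merge x y β)
merge-model G F F⊆G F-sym β x y qxy model z u v p q with quotient-elim F β qxy
... | x≢y , s , t , βs , βt , Fst = go (merge-elim x y β p) (merge-elim x y β q)
  where
  βᵐ = merge x y β
  x⇒y : ∀ w → β w ≡ just x → βᵐ w ≡ just y
  x⇒y w = merge-≡ x y β
  y⇒y : ∀ w → β w ≡ just y → βᵐ w ≡ just y
  y⇒y w = merge-≢ x y β (x≢y ∘ Eq.sym)
  go : (β u ≡ just x × z ≡ y) ⊎ (β u ≡ just z × z ≢ x) → (β v ≡ just x × z ≡ y) ⊎ (β v ≡ just z × z ≢ x) →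
       WalkIn G (λ w → βᵐ w ≡ just z) u v
  go (inj₁ (βu , refl)) (inj₁ (βv , _)) = walk-map x⇒y (model x u v βu βv)
  go (inj₁ (βu , refl)) (inj₂ (βv , _)) =
    walk-++ (walk-map x⇒y (model x u s βu βs)) (F⊆G s t Fst) (walk-map y⇒y (model y t v βt βv))
  go (inj₂ (βu , _)) (inj₁ (βv , refl)) =
    walk-++ (walk-map y⇒y (model y u t βu βt)) (F⊆G t s (F-sym s t Fst)) (walk-map x⇒y (model x s v βs βv))
  go (inj₂ (βu , z≢x)) (inj₂ (βv , _)) = walk-map (λ w → merge-≢ x y β z≢x) (model z u v βu βv)

merge-size : ∀ {n} (x y : Fin n) β z → size (merge x y β) z ≤ size β z + ⟦ does (y ≟ z) ⟧ * size β x
merge-size {n} x y β z = begin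
  size (merge x y β) z                                                         ≤⟨ sum-mono pointwise ⟩
  sum (λ u → ⟦ is (β u) z ⟧ + ⟦ does (y ≟ z) ⟧ * ⟦ is (β u) x ⟧)               ≡⟨ ∑-distrib-+ (λ u → ⟦ is (β u) z ⟧) (λ u → ⟦ does (y ≟ z) ⟧ * ⟦ is (β u) x ⟧) ⟩
  size β z + sum (λ u → ⟦ does (y ≟ z) ⟧ * ⟦ is (β u) x ⟧)                     ≡⟨ cong (size β z +_) (Eq.sym (*-distribˡ-sum ⟦ does (y ≟ z) ⟧ (λ u → ⟦ is (β u) x ⟧))) ⟩
  size β z + ⟦ does (y ≟ z) ⟧ * size β x                                       ∎
  where
  open ≤-Reasoning
  pointwise : ∀ u → ⟦ is (merge x y β u) z ⟧ ≤ ⟦ is (β u) z ⟧ + ⟦ does (y ≟ z) ⟧ * ⟦ is (β u) x ⟧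
  pointwise u = ⟦⟧-≤ λ p → case merge-elim x y β (is-elim (merge x y β u) p) of λ where
    (inj₁ (βu , refl)) → ≤-trans (≤-reflexive (Eq.sym (trans (cong₂ _*_ (⟦⟧-true (dec-true (y ≟ y) refl)) (⟦⟧-true (is-intro βu))) refl))) (m≤n+m _ _)
    (inj₂ (βu , _))    → ≤-trans (≤-reflexive (Eq.sym (⟦⟧-true (is-intro βu)))) (m≤m+n _ _)

merge-label : ∀ {n} (x y : Fin n) β → x ≢ y → label β x ≡ true → label β y ≡ true →
              suc (card (label (merge x y β))) ≤ card (label β)
merge-label {n} x y β x≢y lx ly = begin
  suc (card (label (merge x y β)))                                     ≡⟨ +-comm 1 _ ⟩
  card (label (merge x y β)) + 1                                       ≡⟨ cong (card (label (merge x y β)) +_) (Eq.sym (sum-δ x (λ _ → 1))) ⟩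
  card (label (merge x y β)) + sum (λ a → ⟦ does (x ≟ a) ⟧ * 1)        ≡⟨ Eq.sym (∑-distrib-+ (λ a → ⟦ label (merge x y β) a ⟧) (λ a → ⟦ does (x ≟ a) ⟧ * 1)) ⟩
  sum (λ a → ⟦ label (merge x y β) a ⟧ + ⟦ does (x ≟ a) ⟧ * 1)         ≤⟨ sum-mono pointwise ⟩
  card (label β)                                                       ∎
  where
  open ≤-Reasoning
  old : ∀ a → label (merge x y β) a ≡ true → label β a ≡ true × a ≢ x
  old a p with label-elim (merge x y β) p
  ... | u , q with merge-elim x y β q
  ...   | inj₁ (_ , refl) = ly , x≢y ∘ Eq.sym
  ...   | inj₂ (βu , a≢x) = label-intro β βu , a≢x
  pointwise : ∀ a → ⟦ label (merge x y β) a ⟧ + ⟦ does (x ≟ a) ⟧ * 1 ≤ ⟦ label β a ⟧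
  pointwise a with x ≟ a
  ... | no _     = ≤-trans (≤-reflexive (+-identityʳ _)) (⟦⟧-mono (proj₁ ∘ old a))
  ... | yes refl rewrite ≢true⇒false (λ p → proj₂ (old x p) refl) | lx = ≤-refl

sum-rows : ∀ {n} (z : Fin n) (g : Fin n → ℕ) → sum (λ a → sum (λ b → ⟦ does (z ≟ a) ⟧ * g b)) ≡ sum g
sum-rows z g = trans (sum-cong-≗ (λ a → Eq.sym (*-distribˡ-sum ⟦ does (z ≟ a) ⟧ g))) (sum-δ z (λ _ → sum g))

sum-columns : ∀ {n} (z : Fin n) (g : Fin n → ℕ) → sum (λ a → sum (λ b → ⟦ does (z ≟ b) ⟧ * g a)) ≡ sum g
sum-columns z g = sum-cong-≗ (λ a → sum-δ z (λ _ → g a))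

-- A merge destroys the edge `xy` and, for each common neighbour, one of its two edges to `x` and
-- `y`; each of these counts twice in the volume.
merge-volume : ∀ {n} (F : Relation n) → Symmetric F → ∀ (x y : Fin n) β → x ≢ y →
               volume (quotient F β) ≤
               volume (quotient F (merge x y β)) + 2 * suc (codegree (quotient F β) x y)
merge-volume {n} F F-sym x y β x≢y =
  linear 0 0 (split ⊕ rest ⊕ 2 ⊗ row-x) (algebra (volume q) (volume q′) K (sum (λ b → ⟦ q x b ⟧)) (sum u) (codegree q x y))
  where
  open ≤-Reasoning
  q  = quotient F β
  q′ = quotient F (merge x y β)
  kept : Fin n → Fin n → Bool
  kept a b = not (does (x ≟ a)) ∧ not (does (x ≟ b)) ∧ q a b
  K = sum (λ a → sum (λ b → ⟦ kept a b ⟧))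
  -- The neighbours counted by `u` are handed over from `x` to `y`; those counted by `c` were
  -- neighbours of `y` already.
  u c : Fin n → ℕ
  u b = ⟦ not (does (y ≟ b)) ∧ q x b ⟧
  c b = ⟦ q x b ∧ q y b ⟧

  q-irrefl : ∀ a → q a a ≡ false
  q-irrefl a = ≢true⇒false λ p → proj₁ (quotient-elim F β p) refl

  algebra : ∀ v v′ k r s c →
            1 * v + (k + (r + r) + (v′ + (c + c)) + 2 * (s + 1)) + 0 ≡
            1 * (v′ + 2 * suc c) + (v + (k + (s + s)) + 2 * r)
  algebra = solve-∀

  split : volume q ≤ K + (sum (λ b → ⟦ q x b ⟧) + sum (λ b → ⟦ q x b ⟧))
  split = begin
    volume q ≤⟨ sum₂-mono pointwise ⟩
    sum (λ a → sum (λ b → ⟦ kept a b ⟧ + (⟦ does (x ≟ a) ⟧ * ⟦ q x b ⟧ + ⟦ does (x ≟ b) ⟧ * ⟦ q x a ⟧))) ≡⟨ sum₂-+ (λ a b → ⟦ kept a b ⟧) (λ a b → ⟦ does (x ≟ a) ⟧ * ⟦ q x b ⟧ + ⟦ does (x ≟ b) ⟧ * ⟦ q x a ⟧) ⟩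
    K + sum (λ a → sum (λ b → ⟦ does (x ≟ a) ⟧ * ⟦ q x b ⟧ + ⟦ does (x ≟ b) ⟧ * ⟦ q x a ⟧)) ≡⟨ cong (K +_) (trans (sum₂-+ (λ a b → ⟦ does (x ≟ a) ⟧ * ⟦ q x b ⟧) (λ a b → ⟦ does (x ≟ b) ⟧ * ⟦ q x a ⟧)) (cong₂ _+_ (sum-rows x (λ b → ⟦ q x b ⟧)) (sum-columns x (λ a → ⟦ q x a ⟧)))) ⟩
    K + (sum (λ b → ⟦ q x b ⟧) + sum (λ b → ⟦ q x b ⟧)) ∎
    where
    pointwise : ∀ a b → ⟦ q a b ⟧ ≤ ⟦ kept a b ⟧ + (⟦ does (x ≟ a) ⟧ * ⟦ q x b ⟧ + ⟦ does (x ≟ b) ⟧ * ⟦ q x a ⟧)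
    pointwise a b with x ≟ a | x ≟ b
    ... | yes refl | _        = ≤-trans (≤-reflexive (Eq.sym (+-identityʳ _))) (m≤m+n _ _)
    ... | no _     | yes refl = ≤-trans (⟦⟧-mono (quotient-sym F β F-sym a x)) (≤-reflexive (Eq.sym (+-identityʳ _)))
    ... | no _     | no _     = m≤m+n _ _

  row-x : sum (λ b → ⟦ q x b ⟧) ≤ sum u + 1
  row-x = begin
    sum (λ b → ⟦ q x b ⟧)                    ≤⟨ sum-mono pointwise ⟩
    sum (λ b → u b + ⟦ does (y ≟ b) ⟧ * 1)   ≡⟨ ∑-distrib-+ u (λ b → ⟦ does (y ≟ b) ⟧ * 1) ⟩
    sum u + sum (λ b → ⟦ does (y ≟ b) ⟧ * 1) ≡⟨ cong (sum u +_) (sum-δ y (λ _ → 1)) ⟩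
    sum u + 1                                ∎
    where
    pointwise : ∀ b → ⟦ q x b ⟧ ≤ u b + ⟦ does (y ≟ b) ⟧ * 1
    pointwise b with y ≟ b
    ... | yes _ = ⟦⟧-≤ λ _ → ≤-refl
    ... | no _  = m≤m+n _ _

  from-x : ∀ {b} → b ≢ y → q x b ≡ true → q′ y b ≡ true
  from-x b≢y p with quotient-elim F β p
  ... | x≢b , s , t , βs , βt , Fst =
    quotient-intro F (merge x y β) (b≢y ∘ Eq.sym) (merge-≡ x y β βs) (merge-≢ x y β (x≢b ∘ Eq.sym) βt) Fst

  from-other : ∀ {a b} → a ≢ x → b ≢ x → q a b ≡ true → q′ a b ≡ true
  from-other a≢x b≢x p with quotient-elim F β p
  ... | a≢b , s , t , βs , βt , Fst =
    quotient-intro F (merge x y β) a≢b (merge-≢ x y β a≢x βs) (merge-≢ x y β b≢x βt) Fst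

  kept-elim : ∀ {a b} → kept a b ≡ true → a ≢ x × b ≢ x × q a b ≡ true
  kept-elim {a} {b} p with ∧-elim {not (does (x ≟ a))} p
  ... | p₁ , p₂ with ∧-elim {not (does (x ≟ b))} p₂
  ... | p₃ , p₄ = (λ a≡x → not-elim p₁ (dec-true (x ≟ a) (Eq.sym a≡x))) , (λ b≡x → not-elim p₃ (dec-true (x ≟ b) (Eq.sym b≡x))) , p₄

  kept-mono : ∀ {a b} → ⟦ kept a b ⟧ ≤ ⟦ q′ a b ⟧
  kept-mono = ⟦⟧-mono λ p → let (a≢x , b≢x , r) = kept-elim p in from-other a≢x b≢x r

  rest : K + (sum u + sum u) ≤ volume q′ + (codegree q x y + codegree q x y)
  rest = begin
    K + (sum u + sum u) ≡⟨ cong (K +_) (Eq.sym (trans (sum₂-+ (λ a b → ⟦ does (y ≟ a) ⟧ * u b) (λ a b → ⟦ does (y ≟ b) ⟧ * u a)) (cong₂ _+_ (sum-rows y u) (sum-columns y u)))) ⟩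
    K + sum (λ a → sum (λ b → ⟦ does (y ≟ a) ⟧ * u b + ⟦ does (y ≟ b) ⟧ * u a)) ≡⟨ Eq.sym (sum₂-+ (λ a b → ⟦ kept a b ⟧) (λ a b → ⟦ does (y ≟ a) ⟧ * u b + ⟦ does (y ≟ b) ⟧ * u a)) ⟩
    sum (λ a → sum (λ b → ⟦ kept a b ⟧ + (⟦ does (y ≟ a) ⟧ * u b + ⟦ does (y ≟ b) ⟧ * u a))) ≤⟨ sum₂-mono pointwise ⟩
    sum (λ a → sum (λ b → ⟦ q′ a b ⟧ + (⟦ does (y ≟ a) ⟧ * c b + ⟦ does (y ≟ b) ⟧ * c a))) ≡⟨ sum₂-+ (λ a b → ⟦ q′ a b ⟧) (λ a b → ⟦ does (y ≟ a) ⟧ * c b + ⟦ does (y ≟ b) ⟧ * c a) ⟩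
    volume q′ + sum (λ a → sum (λ b → ⟦ does (y ≟ a) ⟧ * c b + ⟦ does (y ≟ b) ⟧ * c a)) ≡⟨ cong (volume q′ +_) (trans (sum₂-+ (λ a b → ⟦ does (y ≟ a) ⟧ * c b) (λ a b → ⟦ does (y ≟ b) ⟧ * c a)) (cong₂ _+_ (sum-rows y c) (sum-columns y c))) ⟩
    volume q′ + (codegree q x y + codegree q x y) ∎
    where
    both : ∀ {e f g} → (e ≡ true → g ≡ true) → (f ≡ true → g ≡ true) → ⟦ e ⟧ + ⟦ f ⟧ ≤ ⟦ g ⟧ + ⟦ f ∧ e ⟧
    both {true}  {true}  h₁ h₂ rewrite h₁ refl = ≤-refl
    both {true}  {false} h₁ h₂ rewrite h₁ refl = ≤-refl
    both {false} {true}  h₁ h₂ rewrite h₂ refl = ≤-refl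
    both {false} {false} h₁ h₂ = z≤n
    row : ∀ b → y ≢ b → ⟦ kept y b ⟧ + ⟦ q x b ⟧ ≤ ⟦ q′ y b ⟧ + c b
    row b y≢b with x ≟ b
    ... | yes refl rewrite q-irrefl x | dec-false (x ≟ y) x≢y = z≤n
    ... | no x≢b rewrite dec-false (x ≟ y) x≢y =
      both {q y b} {q x b} (from-other (x≢y ∘ Eq.sym) (x≢b ∘ Eq.sym)) (from-x (y≢b ∘ Eq.sym))
    kept-sym : ∀ a b → ⟦ kept a b ⟧ ≤ ⟦ kept b a ⟧
    kept-sym a b = ⟦⟧-mono λ p → let (a≢x , b≢x , r) = kept-elim p in
      ∧-intro (not-intro (b≢x ∘ Eq.sym ∘ does-elim (x ≟ b))) (∧-intro (not-intro (a≢x ∘ Eq.sym ∘ does-elim (x ≟ a))) (quotient-sym F β F-sym a b r))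
    pointwise : ∀ a b → ⟦ kept a b ⟧ + (⟦ does (y ≟ a) ⟧ * u b + ⟦ does (y ≟ b) ⟧ * u a) ≤
                        ⟦ q′ a b ⟧ + (⟦ does (y ≟ a) ⟧ * c b + ⟦ does (y ≟ b) ⟧ * c a)
    pointwise a b with y ≟ a | y ≟ b
    ... | yes refl | yes refl = kept-mono {y} {y} ⊕ z≤n
    ... | yes refl | no y≢b = Eq.subst₂ _≤_ (cong (⟦ kept y b ⟧ +_) (pad ⟦ q x b ⟧)) (cong (⟦ q′ y b ⟧ +_) (pad (c b))) (row b y≢b)
      where
      pad : ∀ k → k ≡ k + 0 + 0
      pad = solve-∀
    ... | no y≢a | yes refl = Eq.subst₂ _≤_ (cong (⟦ kept a y ⟧ +_) (pad ⟦ q x a ⟧)) (cong (⟦ q′ a y ⟧ +_) (pad (c a)))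
          (≤-trans (kept-sym a y ⊕ ≤-refl) (≤-trans (row a y≢a) (⟦⟧-mono (quotient-sym F (merge x y β) F-sym y a) ⊕ ≤-refl)))
      where
      pad : ∀ k → k ≡ k + 0
      pad k = Eq.sym (+-identityʳ k)
    ... | no _ | no _ = kept-mono {a} {b} ⊕ z≤n

-- Each merge uses up one label and costs at most `2 * λ₀` of volume, so the labels are the budget
-- that pays for the loss; the bound is written additively to avoid subtraction. The process stops
-- when every permitted pair is too expensive to merge.
merge-exhaustively :
  ∀ {n} (F : Relation n) → Symmetric F → (λ₀ : ℕ) (I : Labelling n → Set) (permitted : Labelling n → Relation n) →
  (∀ β x y → I β → permitted β x y ≡ true → quotient F β x y ≡ true) →
  (∀ β x y → I β → permitted β x y ≡ true → I (merge x y β)) →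
  ∀ β → I β → Σ (Labelling n) λ β′ → I β′ ×
    volume (quotient F β) + 2 * λ₀ * card (label β′) ≤ volume (quotient F β′) + 2 * λ₀ * card (label β) ×
    card (label β′) ≤ card (label β) ×
    (∀ x y → permitted β′ x y ≡ true → λ₀ ≤ codegree (quotient F β′) x y)
merge-exhaustively {n} F F-sym λ₀ I permitted adjacent preserve β Iβ = go (card (label β)) β Iβ ≤-refl
  where
  go : ∀ k β → I β → card (label β) ≤ k → Σ (Labelling n) λ β′ → I β′ ×
    volume (quotient F β) + 2 * λ₀ * card (label β′) ≤ volume (quotient F β′) + 2 * λ₀ * card (label β) ×
    card (label β′) ≤ card (label β) ×
    (∀ x y → permitted β′ x y ≡ true → λ₀ ≤ codegree (quotient F β′) x y)
  go k β Iβ β≤k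
    with any? (λ x → any? (λ y → true? (permitted β x y) ×-dec (codegree (quotient F β) x y <? λ₀)))
  ... | no stuck = β , Iβ , ≤-refl , ≤-refl , λ x y p → ≮⇒≥ λ small → stuck (x , y , p , small)
  go zero β Iβ β≤0 | yes (x , y , p , _) =
    ⊥-elim (<⇒≱ (card-positive (label β) x (quotient-labelˡ F β (adjacent β x y Iβ p))) β≤0)
  go (suc k) β Iβ β≤k | yes (x , y , p , small) =
    let qxy = adjacent β x y Iβ p
        x≢y = proj₁ (quotient-elim F β qxy)
        lab = merge-label x y β x≢y (quotient-labelˡ F β qxy) (quotient-labelˡ F β (quotient-sym F β F-sym x y qxy))
        (β′ , Iβ′ , loss , fewer , stuck) = go k (merge x y β) (preserve β x y Iβ p) (≤-pred (≤-trans lab β≤k))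
        vol = ≤-trans (merge-volume F F-sym x y β x≢y) (≤-refl {volume (quotient F (merge x y β))} ⊕ 2 ⊗ small)
    in β′ , Iβ′ ,
       linear 0 0 (loss ⊕ vol ⊕ (2 * λ₀) ⊗ lab)
         (algebra (volume (quotient F β)) (volume (quotient F (merge x y β))) (volume (quotient F β′)) λ₀
            (card (label β)) (card (label (merge x y β))) (card (label β′))) ,
       ≤-trans fewer (<⇒≤ lab) ,
       stuck
    where
    algebra : ∀ v v₁ v′ l c c₁ c′ →
      1 * (v + 2 * l * c′) + (v′ + 2 * l * c₁ + (v₁ + 2 * l) + 2 * l * c) + 0 ≡
      1 * (v′ + 2 * l * c) + (v₁ + 2 * l * c′ + v + 2 * l * suc c₁)
    algebra = solve-∀

-- Subgraphs and branch sets inside them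

record Subgraph {n : ℕ} (G : Graph n) : Set where
  field
    V     : Subset n
    F     : Relation n
    F⊆G   : ∀ i j → F i j ≡ true → adj G i j ≡ true
    F-sym : Symmetric F
    F⊆V   : ∀ i j → F i j ≡ true → V i ≡ true

BranchSets : ∀ {n} {G : Graph n} → Subgraph G → Labelling n → Set
BranchSets {G = G} S β = Model G β × (∀ u x → β u ≡ just x → Subgraph.V S u ≡ true)

-- One round of contractions

-- Sizes are at most `cap` before the round and `suc K * cap` after it; `λ₀` is the codegree from
-- which a merge is too expensive. `sparse` forbids the set that `dense-spot` would produce at any
-- moment of the round.
module Round {n : ℕ} (G : Graph n) (S : Subgraph G) (Δ : ℕ) (F≤Δ : ∀ i → degree (Subgraph.F S) i ≤ Δ)
             (cap K λ₀ : ℕ)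
             (sparse : ∀ X → card X ≤ Δ * (suc K * cap * (suc K * cap)) → volume (inner (Subgraph.F S) X) < λ₀ * λ₀)
  where
  open Subgraph S

  merge-branchSets : ∀ β x y → quotient F β x y ≡ true → BranchSets S β → BranchSets S (merge x y β)
  merge-branchSets β x y qxy (model , inside) =
    merge-model G F F⊆G F-sym β x y qxy model ,
    λ u z p → case merge-elim x y β p of λ where
      (inj₁ (βu , _)) → inside u x βu
      (inj₂ (βu , _)) → inside u z βu

  no-dense-spot : ∀ β → (∀ x → size β x ≤ suc K * cap) → ∀ v (A : Subset n) →
                  (∀ ℓ → A ℓ ≡ true → quotient F β v ℓ ≡ true × λ₀ ≤ codegree (quotient F β) ℓ v) → card A < λ₀
  no-dense-spot β β≤ v A A-dense = ≰⇒> λ λ₀≤A →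
    let (X , X≤ , ≤X) = dense-spot F β Δ F≤Δ (suc K * cap) β≤ λ₀ v A A-dense λ₀≤A in
    <⇒≱ (sparse X X≤) ≤X

  cap≤ : cap ≤ suc K * cap
  cap≤ = m≤m+n cap (K * cap)

  module Phase₁ where
    I : Labelling n → Set
    I β = BranchSets S β × (∀ x → size β x ≤ cap)

    permitted : Labelling n → Relation n
    permitted β x y = quotient F β x y ∧ does (size β x + size β y ≤? cap)

    adjacent : ∀ β x y → I β → permitted β x y ≡ true → quotient F β x y ≡ true
    adjacent β x y _ p = proj₁ (∧-elim p)

    preserve : ∀ β x y → I β → permitted β x y ≡ true → I (merge x y β)
    preserve β x y (branch , β≤) p = merge-branchSets β x y (proj₁ (∧-elim p)) branch , λ z → ≤-trans (merge-size x y β z) (small z)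
      where
      small : ∀ z → size β z + ⟦ does (y ≟ z) ⟧ * size β x ≤ cap
      small z with y ≟ z
      ... | yes refl = ≤-trans (≤-reflexive (trans (cong (size β y +_) (*-identityˡ _)) (+-comm (size β y) _))) (does-elim (_ ≤? cap) (proj₂ (∧-elim {quotient F β x y} p)))
      ... | no _     = ≤-trans (≤-reflexive (+-identityʳ _)) (β≤ z)

  module Phase₂ (β₁ : Labelling n) (I₁ : Phase₁.I β₁)
                (stuck₁ : ∀ x y → Phase₁.permitted β₁ x y ≡ true → λ₀ ≤ codegree (quotient F β₁) x y) where
    q₁ = quotient F β₁

    -- The heavy labels, above half of the cap. Two light labels always fit under the cap together,
    -- so if they are adjacent, only a large codegree can have kept them apart.
    T : Subset n
    T a = does (cap <? 2 * size β₁ a)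

    small : ∀ {a} → T a ≢ true → 2 * size β₁ a ≤ cap
    small {a} ¬Ta = ≮⇒≥ λ big → ¬Ta (dec-true (cap <? 2 * size β₁ a) big)

    -- f sends each light label (outside T) either to itself or to the heavy label (in T) that has absorbed it.
    Absorbed : Labelling n → Set
    Absorbed β = Σ (Fin n → Fin n) λ f → (∀ u → β u ≡ Maybe.map f (β₁ u)) ×
                   (∀ t → T t ≡ true → f t ≡ t) × (∀ ℓ → f ℓ ≡ ℓ ⊎ T (f ℓ) ≡ true)

    I : Labelling n → Set
    I β = BranchSets S β × (∀ x → size β x ≤ suc K * cap) × Absorbed β

    unabsorbed : ∀ β ((f , _) : Absorbed β) {u x} → T x ≢ true → β u ≡ just x → β₁ u ≡ just x × f x ≡ x
    unabsorbed β (f , β≡ , _ , fix) {u} {x} ¬Tx βu with β₁ u | trans (Eq.sym (β≡ u)) βu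
    ... | just z | fz with fix z
    ...   | inj₁ fz≡z rewrite fz≡z | just-injective fz = refl , fz≡z
    ...   | inj₂ Tfz  = ⊥-elim (¬Tx (subst (λ w → T w ≡ true) (just-injective fz) Tfz))

    image : ∀ β ((f , _) : Absorbed β) {u x} → β u ≡ just x → ∃ λ z → β₁ u ≡ just z × f z ≡ x
    image β (f , β≡ , _) {u} βu with β₁ u | trans (Eq.sym (β≡ u)) βu
    ... | just z | fz = z , refl , just-injective fz

    -- `label β x` says that `x` is not yet absorbed. The limit on `y` is `K * cap`, leaving room
    -- for one more light branch set below `suc K * cap`.
    permitted : Labelling n → Relation n
    permitted β x y = (not (T x) ∧ label β x) ∧ T y ∧ q₁ x y ∧ does (size β y ≤? K * cap)

    permitted-elim : ∀ β {x y} → permitted β x y ≡ true →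
                     T x ≢ true × label β x ≡ true × T y ≡ true × q₁ x y ≡ true × size β y ≤ K * cap
    permitted-elim β {x} {y} p with ∧-elim {not (T x) ∧ label β x} p
    ... | p₁ , p₂ with ∧-elim {not (T x)} p₁ | ∧-elim {T y} p₂
    ... | a , b | c , p₃ with ∧-elim {q₁ x y} p₃
    ... | d , e = not-elim a , b , c , d , does-elim (size β y ≤? K * cap) e

    adjacent : ∀ β x y → I β → permitted β x y ≡ true → quotient F β x y ≡ true
    adjacent β x y (_ , _ , absorbed@(f , β≡ , fixT , _)) p with permitted-elim β p
    ... | ¬Tx , lx , Ty , q₁xy , _ with quotient-elim F β₁ q₁xy | label-elim β lx
    ... | x≢y , u , v , β₁u , β₁v , Fuv | w , βw =
      quotient-intro F β x≢y
        (trans (β≡ u) (trans (cong (Maybe.map f) β₁u) (cong just (proj₂ (unabsorbed β absorbed ¬Tx βw)))))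
        (trans (β≡ v) (trans (cong (Maybe.map f) β₁v) (cong just (fixT y Ty)))) Fuv

    preserve : ∀ β x y → I β → permitted β x y ≡ true → I (merge x y β)
    preserve β x y Iβ@(branch , β≤ , absorbed@(f , β≡ , fixT , fix)) p with permitted-elim β p
    ... | ¬Tx , _ , Ty , _ , y≤ =
      merge-branchSets β x y (adjacent β x y Iβ p) branch ,
      (λ z → ≤-trans (merge-size x y β z) (bounded z)) ,
      relabel x y ∘ f , agrees , fixes , fixes′
      where
      x≤ : size β x ≤ cap
      x≤ = ≤-trans (card-mono (λ u βu → is-intro (proj₁ (unabsorbed β absorbed ¬Tx (is-elim (β u) βu)))))
             (≤-trans (m≤m+n _ _) (small ¬Tx))
      bounded : ∀ z → size β z + ⟦ does (y ≟ z) ⟧ * size β x ≤ suc K * cap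
      bounded z with y ≟ z
      ... | yes refl = ≤-trans (y≤ ⊕ ≤-trans (≤-reflexive (*-identityˡ _)) x≤) (≤-reflexive (+-comm (K * cap) cap))
      ... | no _     = ≤-trans (≤-reflexive (+-identityʳ _)) (β≤ z)
      agrees : ∀ u → merge x y β u ≡ Maybe.map (relabel x y ∘ f) (β₁ u)
      agrees u with β u | β₁ u | β≡ u
      ... | _ | just z  | refl = refl
      ... | _ | nothing | refl = refl
      T≢x : ∀ {t} → T t ≡ true → t ≢ x
      T≢x Tt refl = ¬Tx Tt
      fixes : ∀ t → T t ≡ true → relabel x y (f t) ≡ t
      fixes t Tt = trans (cong (relabel x y) (fixT t Tt)) (relabel-≢ x y (T≢x Tt))
      fixes′ : ∀ ℓ → relabel x y (f ℓ) ≡ ℓ ⊎ T (relabel x y (f ℓ)) ≡ true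
      fixes′ ℓ with f ℓ ≟ x
      ... | yes _ = inj₂ Ty
      ... | no _  = fix ℓ

    module Count (β₂ : Labelling n) (I₂ : I β₂)
                 (stuck₂ : ∀ x y → permitted β₂ x y ≡ true → λ₀ ≤ codegree (quotient F β₂) x y) where
      open ≤-Reasoning
      q₂ = quotient F β₂
      absorbed = proj₂ (proj₂ I₂)
      ν  = card V
      m₁ = card (label β₁)

      L L′ sat : Subset n
      L  ℓ = not (T ℓ)
      L′ ℓ = L ℓ ∧ label β₂ ℓ
      sat t = does (K * cap <? size β₂ t)

      -- All light neighbours of a light `ℓ` have codegree at least `λ₀` with it, so `λ₀` of them
      -- would make a dense spot around `ℓ`.
      light-light : ∀ ℓ → sum (λ z → ⟦ L ℓ ∧ L z ∧ q₁ ℓ z ⟧) ≤ λ₀ * ⟦ label β₁ ℓ ⟧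
      light-light ℓ with true? (label β₁ ℓ)
      ... | no ¬lℓ = ≤-trans (≤-reflexive (sum-zero (λ z → cong ⟦_⟧ (≢true⇒false λ p →
                       ¬lℓ (quotient-labelˡ F β₁ (proj₂ (∧-elim {L z} (proj₂ (∧-elim {L ℓ} p))))))))) z≤n
      ... | yes lℓ = begin
        sum (λ z → ⟦ L ℓ ∧ L z ∧ q₁ ℓ z ⟧)   ≡⟨ sum-⟦∧⟧ (L ℓ) (λ z → L z ∧ q₁ ℓ z) ⟩
        ⟦ L ℓ ⟧ * card (λ z → L z ∧ q₁ ℓ z)   ≤⟨ ⟦⟧*-≤ (λ Lℓ → <⇒≤ (no-dense-spot β₁ (λ x → ≤-trans (proj₂ I₁ x) cap≤) ℓ _ (dense (not-elim Lℓ)))) ⟩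
        λ₀                                   ≡⟨ Eq.sym (*-identityʳ λ₀) ⟩
        λ₀ * 1                               ≡⟨ cong (λ₀ *_) (Eq.sym (⟦⟧-true lℓ)) ⟩
        λ₀ * ⟦ label β₁ ℓ ⟧                  ∎
        where
        dense : T ℓ ≢ true → ∀ z → L z ∧ q₁ ℓ z ≡ true → q₁ ℓ z ≡ true × λ₀ ≤ codegree q₁ z ℓ
        dense ¬Tℓ z p with ∧-elim {L z} p
        ... | Lz , qℓz = qℓz , stuck₁ z ℓ (∧-intro (quotient-sym F β₁ F-sym ℓ z qℓz) (dec-true (size β₁ z + size β₁ ℓ ≤? cap)
          (linear 1 0 (small (not-elim Lz) ⊕ small ¬Tℓ) (algebra (size β₁ z) (size β₁ ℓ) cap))))
          where
          algebra : ∀ a b c → 2 * (a + b) + (c + c) + 0 ≡ 2 * c + (2 * a + 2 * b)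
          algebra = solve-∀

      -- An unsaturated heavy `t` could still absorb any surviving light neighbour, so each has
      -- large codegree with it in `q₂`, and `λ₀` of them would make a dense spot. A saturated `t`
      -- is charged its whole degree in `q₁`.
      heavy-light : ∀ t → sum (λ ℓ → ⟦ T t ∧ L′ ℓ ∧ q₁ ℓ t ⟧) ≤ λ₀ * ⟦ label β₁ t ⟧ + Δ * cap * ⟦ sat t ⟧
      heavy-light t with true? (label β₁ t)
      ... | no ¬lt = ≤-trans (≤-reflexive (sum-zero (λ z → cong ⟦_⟧ (≢true⇒false λ p →
                       ¬lt (quotient-labelˡ F β₁ (quotient-sym F β₁ F-sym z t (proj₂ (∧-elim {L′ z} (proj₂ (∧-elim {T t} p)))))))))) z≤n
      ... | yes lt with true? (sat t)
      ...   | yes st = begin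
        sum (λ ℓ → ⟦ T t ∧ L′ ℓ ∧ q₁ ℓ t ⟧)              ≤⟨ sum-mono (λ ℓ → ⟦⟧-mono (λ p → quotient-sym F β₁ F-sym ℓ t (proj₂ (∧-elim {L′ ℓ} (proj₂ (∧-elim {T t} p)))))) ⟩
        degree q₁ t                                      ≤⟨ degree-quotient F β₁ Δ F≤Δ t ⟩
        Δ * size β₁ t                                    ≤⟨ Δ ⊗ proj₂ I₁ t ⟩
        Δ * cap                                          ≡⟨ Eq.sym (*-identityʳ (Δ * cap)) ⟩
        Δ * cap * 1                                      ≡⟨ cong (Δ * cap *_) (Eq.sym (⟦⟧-true st)) ⟩
        Δ * cap * ⟦ sat t ⟧                              ≤⟨ m≤n+m _ _ ⟩
        λ₀ * ⟦ label β₁ t ⟧ + Δ * cap * ⟦ sat t ⟧        ∎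
      ...   | no ¬st = begin
        sum (λ ℓ → ⟦ T t ∧ L′ ℓ ∧ q₁ ℓ t ⟧)   ≡⟨ sum-⟦∧⟧ (T t) (λ ℓ → L′ ℓ ∧ q₁ ℓ t) ⟩
        ⟦ T t ⟧ * card (λ ℓ → L′ ℓ ∧ q₁ ℓ t)   ≤⟨ ⟦⟧*-≤ (λ Tt → <⇒≤ (no-dense-spot β₂ (proj₁ (proj₂ I₂)) t _ (dense Tt))) ⟩
        λ₀                                   ≡⟨ Eq.sym (*-identityʳ λ₀) ⟩
        λ₀ * 1                               ≡⟨ cong (λ₀ *_) (Eq.sym (⟦⟧-true lt)) ⟩
        λ₀ * ⟦ label β₁ t ⟧                  ≤⟨ m≤m+n _ _ ⟩
        λ₀ * ⟦ label β₁ t ⟧ + Δ * cap * ⟦ sat t ⟧        ∎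
        where
        unsaturated : size β₂ t ≤ K * cap
        unsaturated = ≮⇒≥ λ big → ¬st (dec-true (K * cap <? size β₂ t) big)
        dense : T t ≡ true → ∀ ℓ → L′ ℓ ∧ q₁ ℓ t ≡ true → q₂ t ℓ ≡ true × λ₀ ≤ codegree q₂ ℓ t
        dense Tt ℓ p with ∧-elim {L′ ℓ} p
        ... | L′ℓ , qℓt = quotient-sym F β₂ F-sym ℓ t (adjacent β₂ ℓ t I₂ perm) , stuck₂ ℓ t perm
          where perm = ∧-intro L′ℓ (∧-intro Tt (∧-intro qℓt (dec-true (size β₂ t ≤? K * cap) unsaturated)))

      -- Saturated branch sets are disjoint subsets of `V` with more than `K * cap` vertices each.
      saturated : K * cap * card sat ≤ ν
      saturated = begin
        K * cap * card sat                    ≤⟨ sum-≤-*card sat (size β₂) (K * cap) (λ t st → <⇒≤ (does-elim (K * cap <? size β₂ t) st)) ⟩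
        sum (λ t → ⟦ sat t ⟧ * size β₂ t)     ≤⟨ sum-mono (λ t → ⟦⟧*-≤ {sat t} (λ _ → ≤-refl)) ⟩
        sum (size β₂)                         ≤⟨ sum-size β₂ V (proj₂ (proj₁ I₂)) ⟩
        ν                                     ∎

      -- An unabsorbed light label keeps its branch set, and `f` maps some of its neighbours in `q₁`
      -- onto all its neighbours in `q₂`.
      degree-decreases : ∀ ℓ → T ℓ ≢ true → degree q₂ ℓ ≤ degree q₁ ℓ
      degree-decreases ℓ ¬Tℓ = begin
        sum (λ y → ⟦ q₂ ℓ y ⟧)                               ≤⟨ sum-mono pointwise ⟩
        sum (λ y → sum (λ z → ⟦ q₁ ℓ z ∧ is (just (f z)) y ⟧)) ≡⟨ ∑-comm (λ y z → ⟦ q₁ ℓ z ∧ is (just (f z)) y ⟧) ⟩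
        sum (λ z → sum (λ y → ⟦ q₁ ℓ z ∧ is (just (f z)) y ⟧)) ≤⟨ sum-mono (λ z → sum-⟦∧is⟧ (q₁ ℓ z) (just (f z))) ⟩
        degree q₁ ℓ                                          ∎
        where
        f = proj₁ absorbed
        pointwise : ∀ y → ⟦ q₂ ℓ y ⟧ ≤ sum (λ z → ⟦ q₁ ℓ z ∧ is (just (f z)) y ⟧)
        pointwise y = ⟦⟧-≤ λ p →
          let (ℓ≢y , u , v , βu , βv , Fuv) = quotient-elim F β₂ p
              (β₁u , fℓ≡ℓ) = unabsorbed β₂ absorbed ¬Tℓ βu
              (z , β₁v , fz≡y) = image β₂ absorbed βv
              ℓ≢z = λ ℓ≡z → ℓ≢y (trans (Eq.sym fℓ≡ℓ) (trans (cong f ℓ≡z) fz≡y))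
          in ≤-trans (≤-reflexive (Eq.sym (⟦⟧-true (∧-intro (quotient-intro F β₁ ℓ≢z β₁u β₁v Fuv) (is-intro (cong just fz≡y))))))
                     (term≤sum (λ z → ⟦ q₁ ℓ z ∧ is (just (f z)) y ⟧) z)

      light-total : sum (λ ℓ → ⟦ L ℓ ⟧ * degree q₂ ℓ) ≤ λ₀ * m₁ + (λ₀ * m₁ + Δ * cap * card sat)
      light-total = begin
        sum (λ ℓ → ⟦ L ℓ ⟧ * degree q₂ ℓ) ≤⟨ sum-mono old ⟩
        sum (λ ℓ → sum (λ z → ⟦ L′ ℓ ∧ q₁ ℓ z ⟧)) ≤⟨ sum₂-mono split ⟩
        sum (λ ℓ → sum (λ z → ⟦ L ℓ ∧ L z ∧ q₁ ℓ z ⟧ + ⟦ T z ∧ L′ ℓ ∧ q₁ ℓ z ⟧)) ≡⟨ sum₂-+ (λ ℓ z → ⟦ L ℓ ∧ L z ∧ q₁ ℓ z ⟧) (λ ℓ z → ⟦ T z ∧ L′ ℓ ∧ q₁ ℓ z ⟧) ⟩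
        sum (λ ℓ → sum (λ z → ⟦ L ℓ ∧ L z ∧ q₁ ℓ z ⟧)) + sum (λ ℓ → sum (λ z → ⟦ T z ∧ L′ ℓ ∧ q₁ ℓ z ⟧)) ≡⟨ cong (sum (λ ℓ → sum (λ z → ⟦ L ℓ ∧ L z ∧ q₁ ℓ z ⟧)) +_) (∑-comm (λ ℓ z → ⟦ T z ∧ L′ ℓ ∧ q₁ ℓ z ⟧)) ⟩
        sum (λ ℓ → sum (λ z → ⟦ L ℓ ∧ L z ∧ q₁ ℓ z ⟧)) + sum (λ z → sum (λ ℓ → ⟦ T z ∧ L′ ℓ ∧ q₁ ℓ z ⟧)) ≤⟨ sum-mono light-light ⊕ sum-mono heavy-light ⟩
        sum (λ ℓ → λ₀ * ⟦ label β₁ ℓ ⟧) + sum (λ t → λ₀ * ⟦ label β₁ t ⟧ + Δ * cap * ⟦ sat t ⟧) ≡⟨ cong₂ _+_ (Eq.sym (*-distribˡ-sum λ₀ (λ ℓ → ⟦ label β₁ ℓ ⟧))) (trans (∑-distrib-+ (λ t → λ₀ * ⟦ label β₁ t ⟧) (λ t → Δ * cap * ⟦ sat t ⟧)) (cong₂ _+_ (Eq.sym (*-distribˡ-sum λ₀ (λ ℓ → ⟦ label β₁ ℓ ⟧))) (Eq.sym (*-distribˡ-sum (Δ * cap) (λ t → ⟦ sat t ⟧))))) ⟩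
        λ₀ * m₁ + (λ₀ * m₁ + Δ * cap * card sat) ∎
        where
        old : ∀ ℓ → ⟦ L ℓ ⟧ * degree q₂ ℓ ≤ sum (λ z → ⟦ L′ ℓ ∧ q₁ ℓ z ⟧)
        old ℓ = ⟦⟧*-≤ {L ℓ} λ Lℓ → ≤-trans (rows Lℓ) (≤-reflexive (Eq.sym (sum-⟦∧⟧ (L′ ℓ) (q₁ ℓ))))
          where
          rows : L ℓ ≡ true → degree q₂ ℓ ≤ ⟦ L′ ℓ ⟧ * degree q₁ ℓ
          rows Lℓ with true? (label β₂ ℓ)
          ... | yes lℓ = ≤-trans (degree-decreases ℓ (not-elim Lℓ)) (≤-trans (≤-reflexive (Eq.sym (*-identityˡ _)))
                           (≤-reflexive (cong (_* degree q₁ ℓ) (Eq.sym (⟦⟧-true (∧-intro Lℓ lℓ))))))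
          ... | no ¬lℓ = ≤-trans (≤-reflexive (sum-zero {f = λ z → ⟦ q₂ ℓ z ⟧} (λ z → cong ⟦_⟧ (≢true⇒false λ p → ¬lℓ (quotient-labelˡ F β₂ p))))) z≤n
        split : ∀ ℓ z → ⟦ L′ ℓ ∧ q₁ ℓ z ⟧ ≤ ⟦ L ℓ ∧ L z ∧ q₁ ℓ z ⟧ + ⟦ T z ∧ L′ ℓ ∧ q₁ ℓ z ⟧
        split ℓ z with T z
        ... | true  = m≤n+m _ _
        ... | false = ≤-trans (⟦⟧-mono (λ p → let (a , b) = ∧-elim {L′ ℓ} p in ∧-intro (proj₁ (∧-elim {L ℓ} a)) b)) (m≤m+n _ _)

      -- The surviving light labels may be very numerous but carry few edges by `light-total`, so
      -- they are deleted.
      keep : Maybe (Fin n) → Maybe (Fin n)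
      keep (just z) = if T z then just z else nothing
      keep nothing  = nothing

      β₃ : Labelling n
      β₃ u = keep (β₂ u)

      β₃-elim : ∀ {u x} → β₃ u ≡ just x → β₂ u ≡ just x × T x ≡ true
      β₃-elim {u} p with β₂ u
      ... | just z with T z in Tz
      ...   | true = p , subst (λ w → T w ≡ true) (just-injective p) Tz

      β₃-intro : ∀ {u x} → T x ≡ true → β₂ u ≡ just x → β₃ u ≡ just x
      β₃-intro Tx βu rewrite βu | Tx = refl

      branch₃ : BranchSets S β₃
      branch₃ = (λ x u v p q → walk-map (λ w → β₃-intro (proj₂ (β₃-elim p)))
                    (proj₁ (proj₁ I₂) x u v (proj₁ (β₃-elim p)) (proj₁ (β₃-elim q)))) ,
                (λ u x p → proj₂ (proj₁ I₂) u x (proj₁ (β₃-elim p)))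

      size₃ : ∀ x → size β₃ x ≤ suc K * cap
      size₃ x = ≤-trans (card-mono (λ u p → is-intro (proj₁ (β₃-elim (is-elim (β₃ u) p))))) (proj₁ (proj₂ I₂) x)

      -- The remaining labels are heavy, so already their disjoint branch sets in `β₁` exceed half
      -- of the cap.
      labels₃ : card (label β₃) * cap ≤ 2 * ν
      labels₃ = begin
        card (label β₃) * cap                       ≡⟨ *-comm (card (label β₃)) cap ⟩
        cap * card (label β₃)                       ≤⟨ sum-≤-*card (label β₃) (λ t → 2 * size β₁ t) cap (λ t lt → let (u , p) = label-elim β₃ lt in <⇒≤ (does-elim (cap <? 2 * size β₁ t) (proj₂ (β₃-elim p)))) ⟩
        sum (λ t → ⟦ label β₃ t ⟧ * (2 * size β₁ t)) ≤⟨ sum-mono (λ t → ⟦⟧*-≤ {label β₃ t} (λ _ → ≤-refl)) ⟩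
        sum (λ t → 2 * size β₁ t)                   ≡⟨ Eq.sym (*-distribˡ-sum 2 (size β₁)) ⟩
        2 * sum (size β₁)                           ≤⟨ 2 ⊗ sum-size β₁ V (proj₂ (proj₁ I₁)) ⟩
        2 * ν                                       ∎

      volume₃ : volume q₂ ≤ volume (quotient F β₃) + 2 * sum (λ ℓ → ⟦ L ℓ ⟧ * degree q₂ ℓ)
      volume₃ = begin
        volume q₂ ≤⟨ sum₂-mono pointwise ⟩
        sum (λ a → sum (λ b → ⟦ quotient F β₃ a b ⟧ + (⟦ L a ⟧ * ⟦ q₂ a b ⟧ + ⟦ L b ⟧ * ⟦ q₂ b a ⟧))) ≡⟨ sum₂-+ (λ a b → ⟦ quotient F β₃ a b ⟧) (λ a b → ⟦ L a ⟧ * ⟦ q₂ a b ⟧ + ⟦ L b ⟧ * ⟦ q₂ b a ⟧) ⟩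
        volume (quotient F β₃) + sum (λ a → sum (λ b → ⟦ L a ⟧ * ⟦ q₂ a b ⟧ + ⟦ L b ⟧ * ⟦ q₂ b a ⟧)) ≡⟨ cong (volume (quotient F β₃) +_) (trans (sum₂-+ (λ a b → ⟦ L a ⟧ * ⟦ q₂ a b ⟧) (λ a b → ⟦ L b ⟧ * ⟦ q₂ b a ⟧)) (cong₂ _+_ rows (trans (∑-comm (λ a b → ⟦ L b ⟧ * ⟦ q₂ b a ⟧)) rows))) ⟩
        volume (quotient F β₃) + (P + P) ≡⟨ cong (λ w → volume (quotient F β₃) + (P + w)) (Eq.sym (+-identityʳ P)) ⟩
        volume (quotient F β₃) + 2 * P ∎
        where
        P = sum (λ ℓ → ⟦ L ℓ ⟧ * degree q₂ ℓ)
        rows : sum (λ a → sum (λ b → ⟦ L a ⟧ * ⟦ q₂ a b ⟧)) ≡ P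
        rows = sum-cong-≗ (λ a → Eq.sym (*-distribˡ-sum ⟦ L a ⟧ (λ b → ⟦ q₂ a b ⟧)))
        kept : ∀ {a b} → T a ≡ true → T b ≡ true → q₂ a b ≡ true → quotient F β₃ a b ≡ true
        kept Ta Tb p with quotient-elim F β₂ p
        ... | a≢b , u , v , βu , βv , Fuv = quotient-intro F β₃ a≢b (β₃-intro Ta βu) (β₃-intro Tb βv) Fuv
        pointwise : ∀ a b → ⟦ q₂ a b ⟧ ≤ ⟦ quotient F β₃ a b ⟧ + (⟦ L a ⟧ * ⟦ q₂ a b ⟧ + ⟦ L b ⟧ * ⟦ q₂ b a ⟧)
        pointwise a b with true? (T a) | true? (T b)
        ... | yes Ta | yes Tb = ≤-trans (⟦⟧-mono (kept Ta Tb)) (m≤m+n _ _)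
        ... | no ¬Ta | _ rewrite ≢true⇒false ¬Ta = ≤-trans (≤-reflexive (Eq.sym (+-identityʳ _))) (≤-trans (m≤m+n (⟦ q₂ a b ⟧ + 0) (⟦ L b ⟧ * ⟦ q₂ b a ⟧)) (m≤n+m _ ⟦ quotient F β₃ a b ⟧))
        ... | yes _ | no ¬Tb rewrite ≢true⇒false ¬Tb = ≤-trans (⟦⟧-mono (quotient-sym F β₂ F-sym a b)) (≤-trans (≤-reflexive (Eq.sym (+-identityʳ _))) (≤-trans (m≤n+m (⟦ q₂ b a ⟧ + 0) (⟦ L a ⟧ * ⟦ q₂ a b ⟧)) (m≤n+m _ ⟦ quotient F β₃ a b ⟧)))

  -- With m labels at the start and σ = `Δ * cap * card sat`, each merging phase loses at most 2λ₀m
  -- of volume and the deletion of light labels at most 2(2λ₀m + σ). The constants 32 and 8 make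
  -- 8λ₀m and 2σ at most a quarter of the initial volume each.
  round : 0 < K → ∀ β → BranchSets S β → (∀ x → size β x ≤ cap) →
          32 * (λ₀ * card (label β)) ≤ volume (quotient F β) →
          8 * (card V * Δ) ≤ K * volume (quotient F β) →
          Σ (Labelling n) λ β′ → BranchSets S β′ × (∀ x → size β′ x ≤ suc K * cap) ×
            card (label β′) * cap ≤ 2 * card V × volume (quotient F β) ≤ 2 * volume (quotient F β′)
  round 0<K β branch β≤ few-labels few-saturated
    with merge-exhaustively F F-sym λ₀ Phase₁.I Phase₁.permitted Phase₁.adjacent Phase₁.preserve β (branch , β≤)
  ... | β₁ , I₁ , loss₁ , fewer , stuck₁
    with merge-exhaustively F F-sym λ₀ (Phase₂.I β₁ I₁ stuck₁) (Phase₂.permitted β₁ I₁ stuck₁)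
           (Phase₂.adjacent β₁ I₁ stuck₁) (Phase₂.preserve β₁ I₁ stuck₁) β₁
           (proj₁ I₁ , (λ x → ≤-trans (proj₂ I₁ x) cap≤) , (λ x → x) , (λ u → identity (β₁ u)) , (λ _ _ → refl) , (λ _ → inj₁ refl))
    where
    identity : ∀ (b : Maybe (Fin n)) → b ≡ Maybe.map (λ x → x) b
    identity (just _) = refl
    identity nothing  = refl
  ...   | β₂ , I₂ , loss₂ , _ , stuck₂ = β₃ , branch₃ , size₃ , labels₃ ,
    linear 1 (8 * (λ₀ * card (label β₂)) + 8 * (λ₀ * card (label β)))
      (4 ⊗ (loss₁ ⊕ loss₂ ⊕ volume₃ ⊕ 2 ⊗ light-total ⊕ 4 ⊗ λ₀ ⊗ fewer) ⊕ sat-bound ⊕ few-labels)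
      (algebra (volume (quotient F β)) (volume (quotient F β₁)) (volume q₂) (volume (quotient F β₃))
        (sum (λ ℓ → ⟦ L ℓ ⟧ * degree q₂ ℓ)) λ₀ (card (label β)) m₁ (card (label β₂)) (Δ * cap * card sat))
    where
    open Phase₂.Count β₁ I₁ stuck₁ β₂ I₂ stuck₂
    open ≤-Reasoning
    sat-bound : 8 * (Δ * cap * card sat) ≤ volume (quotient F β)
    sat-bound = *-cancelˡ-≤ K {{>-nonZero 0<K}} (begin
      K * (8 * (Δ * cap * card sat)) ≡⟨ rearrange K Δ cap (card sat) ⟩
      8 * (K * cap * card sat * Δ)   ≤⟨ 8 ⊗ *-monoˡ-≤ Δ saturated ⟩
      8 * (card V * Δ)               ≤⟨ few-saturated ⟩
      K * volume (quotient F β)      ∎)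
      where
      rearrange : ∀ K Δ c s → K * (8 * (Δ * c * s)) ≡ 8 * (K * c * s * Δ)
      rearrange = solve-∀
    algebra : ∀ E E₁ E₂ E₃ P l m m₁ m₂ σ →
      2 * E + (4 * (E₁ + 2 * l * m + (E₂ + 2 * l * m₁) + (E₃ + 2 * P) + 2 * (l * m₁ + (l * m₁ + σ)) + 4 * (l * m)) + E + E)
        + (8 * (l * m₂) + 8 * (l * m)) ≡
      2 * (2 * E₃) + (4 * (E + 2 * l * m₁ + (E₁ + 2 * l * m₂) + E₂ + 2 * P + 4 * (l * m₁)) + 8 * σ + 32 * (l * m))
    algebra = solve-∀

-- The labelling by single vertices

identity-on : ∀ {n} → Subset n → Labelling n
identity-on V u = if V u then just u else nothing

identity-elim : ∀ {n} (V : Subset n) {u x} → identity-on V u ≡ just x → u ≡ x × V u ≡ true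
identity-elim V {u} p with V u
... | true = just-injective p , refl

identity-intro : ∀ {n} (V : Subset n) {u} → V u ≡ true → identity-on V u ≡ just u
identity-intro V Vu rewrite Vu = refl

identity-branchSets : ∀ {n} {G : Graph n} (S : Subgraph G) → BranchSets S (identity-on (Subgraph.V S))
identity-branchSets {G = G} S = model , λ u x p → proj₂ (identity-elim V p)
  where
  open Subgraph S
  model : Model G (identity-on V)
  model x u v p q with identity-elim V p | identity-elim V q
  ... | refl , _ | refl , _ = here p

identity-size : ∀ {n} (V : Subset n) x → size (identity-on V) x ≤ 1
identity-size V x = ≤-trans (sum-mono pointwise) (≤-reflexive (sum-δ x (λ _ → 1)))
  where
  pointwise : ∀ u → ⟦ is (identity-on V u) x ⟧ ≤ ⟦ does (x ≟ u) ⟧ * 1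
  pointwise u = ⟦⟧-≤ λ p → ≤-reflexive (Eq.sym (trans (*-identityʳ _)
    (⟦⟧-true (dec-true (x ≟ u) (Eq.sym (proj₁ (identity-elim V (is-elim (identity-on V u) p))))))))

identity-labels : ∀ {n} (V : Subset n) → card (label (identity-on V)) ≤ card V
identity-labels V = card-mono {P = label (identity-on V)} {V} λ x lx →
  let (u , p) = label-elim (identity-on V) lx
      (u≡x , Vu) = identity-elim V p
  in subst (λ w → V w ≡ true) u≡x Vu

identity-volume : ∀ {n} {G : Graph n} (S : Subgraph G) →
                  volume (Subgraph.F S) ≤ volume (quotient (Subgraph.F S) (identity-on (Subgraph.V S)))
identity-volume {G = G} S = sum₂-mono (λ i j → ⟦⟧-mono (edge i j))
  where
  open Subgraph S
  edge : ∀ i j → F i j ≡ true → quotient F (identity-on V) i j ≡ true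
  edge i j Fij = quotient-intro F (identity-on V) i≢j (identity-intro V (F⊆V i j Fij)) (identity-intro V (F⊆V j i (F-sym i j Fij))) Fij
    where
    i≢j : i ≢ j
    i≢j refl = case trans (Eq.sym (F⊆G i i Fij)) (irrefl G i) of λ ()

label-inhabited : ∀ {n} (F : Relation n) (β : Labelling n) → 0 < volume (quotient F β) → 0 < card (label β)
label-inhabited F β 0<E with sum-positive (degree (quotient F β)) 0<E
... | x , 0<deg with card-inhabited (quotient F β x) 0<deg
...   | y , qxy = card-positive (label β) x (quotient-labelˡ F β qxy)

-- Iterated rounds

-- `A` bounds the average degree from below and `δ` is a constant fraction of it. The factors
-- `2 ^ N` pay for `N` rounds, each of which may halve the volume.
module Rounds {n : ℕ} (G : Graph n) (S : Subgraph G) (Δ : ℕ) (F≤Δ : ∀ i → degree (Subgraph.F S) i ≤ Δ)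
              (K N δ A : ℕ) (0<K : 0 < K) (δ-small : 32 * 2 ^ N * δ * 2 ≤ A) (Δ-small : 8 * Δ * 2 ^ N ≤ K * A)
              (sparse : ∀ r → r < N → ∀ X → card X ≤ Δ * (suc K * suc K ^ suc r * (suc K * suc K ^ suc r)) →
                        volume (inner (Subgraph.F S) X) < suc K ^ r * δ * (suc K ^ r * δ))
              (dense : card (Subgraph.V S) * A ≤ volume (Subgraph.F S))
  where
  open Subgraph S
  open ≤-Reasoning

  ρ = suc K
  ν = card V

  -- The maximal size has exponent `suc r`, while there are at least ρ^r / 2 vertices of `V` per
  -- label. With `ρ ^ suc r` as the cap, a round turns both bounds into those for `suc r`.
  State : ℕ → Labelling n → Set
  State r β = BranchSets S β × (∀ x → size β x ≤ ρ ^ suc r) × card (label β) * ρ ^ r ≤ 2 * ν ×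
              ν * A ≤ 2 ^ r * volume (quotient F β)

  initial-state : State 0 (identity-on V)
  initial-state = identity-branchSets S , (λ x → ≤-trans (identity-size V x) (s≤s z≤n)) ,
    ≤-trans (≤-reflexive (*-identityʳ _)) (≤-trans (identity-labels V) (m≤m+n ν _)) ,
    ≤-trans dense (≤-trans (identity-volume S) (≤-reflexive (Eq.sym (*-identityˡ _))))

  advance : ∀ r → r < N → Σ (Labelling n) (State r) → Σ (Labelling n) (State (suc r))
  advance r r<N (β , branch , small , few , many) =
    let (β′ , branch′ , small′ , few′ , half) =
          -- The threshold `ρ ^ r * δ` grows with the sizes just as the average degree of the minor
          -- does, and stays a constant factor below it.
          Round.round G S Δ F≤Δ (ρ ^ suc r) K (ρ ^ r * δ) (sparse r r<N) 0<K β branch small few-labels few-saturated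
    in β′ , branch′ , small′ , few′ , progress β′ half
    where
    E = volume (quotient F β)
    2^r≤2^N : 2 ^ r ≤ 2 ^ N
    2^r≤2^N = ^-monoʳ-≤ 2 (<⇒≤ r<N)
    few-labels : 32 * (ρ ^ r * δ * card (label β)) ≤ E
    few-labels = *-cancelˡ-≤ (2 ^ r) {{>-nonZero (m^n>0 2 r)}} (begin
      2 ^ r * (32 * (ρ ^ r * δ * card (label β)))     ≤⟨ *-monoˡ-≤ _ 2^r≤2^N ⟩
      2 ^ N * (32 * (ρ ^ r * δ * card (label β)))     ≡⟨ rearrange 32 (2 ^ N) (ρ ^ r) δ (card (label β)) ⟩
      32 * 2 ^ N * δ * (card (label β) * ρ ^ r)       ≤⟨ (32 * 2 ^ N * δ) ⊗ few ⟩
      32 * 2 ^ N * δ * (2 * ν)                        ≡⟨ rearrange₂ (32 * 2 ^ N * δ) 2 ν ⟩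
      ν * (32 * 2 ^ N * δ * 2)                        ≤⟨ ν ⊗ δ-small ⟩
      ν * A                            ≤⟨ many ⟩
      2 ^ r * E                                       ∎)
      where
      rearrange : ∀ k t w δ c → t * (k * (w * δ * c)) ≡ k * t * δ * (c * w)
      rearrange = solve-∀
      rearrange₂ : ∀ t k ν → t * (k * ν) ≡ ν * (t * k)
      rearrange₂ = solve-∀
    few-saturated : 8 * (ν * Δ) ≤ K * E
    few-saturated = *-cancelˡ-≤ (2 ^ r) {{>-nonZero (m^n>0 2 r)}} (begin
      2 ^ r * (8 * (ν * Δ))      ≤⟨ *-monoˡ-≤ _ 2^r≤2^N ⟩
      2 ^ N * (8 * (ν * Δ))      ≡⟨ rearrange 8 (2 ^ N) ν Δ ⟩
      ν * (8 * Δ * 2 ^ N)        ≤⟨ ν ⊗ Δ-small ⟩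
      ν * (K * A) ≡⟨ rearrange₂ ν K A ⟩
      K * (ν * A) ≤⟨ K ⊗ many ⟩
      K * (2 ^ r * E)            ≡⟨ rearrange₂ K (2 ^ r) E ⟩
      2 ^ r * (K * E)            ∎)
      where
      rearrange : ∀ k t ν Δ → t * (k * (ν * Δ)) ≡ ν * (k * Δ * t)
      rearrange = solve-∀
      rearrange₂ : ∀ a b c → a * (b * c) ≡ b * (a * c)
      rearrange₂ = solve-∀
    progress : ∀ β′ → E ≤ 2 * volume (quotient F β′) → ν * A ≤ 2 ^ suc r * volume (quotient F β′)
    progress β′ half = begin
      ν * A                                        ≤⟨ many ⟩
      2 ^ r * E                                    ≤⟨ 2 ^ r ⊗ half ⟩
      2 ^ r * (2 * volume (quotient F β′))         ≡⟨ rearrange (2 ^ r) (volume (quotient F β′)) ⟩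
      2 ^ suc r * volume (quotient F β′)           ∎
      where
      rearrange : ∀ t v → t * (2 * v) ≡ 2 * t * v
      rearrange = solve-∀

  iterate : ∀ r → r ≤ N → Σ (Labelling n) (State r)
  iterate zero    _   = identity-on V , initial-state
  iterate (suc r) r<N = advance r r<N (iterate r (<⇒≤ r<N))

  dense-minor : 0 < ν → 0 < δ → Σ (Labelling n) λ β → Model G β × 0 < card (label β) ×
                δ * ρ ^ N * card (label β) ≤ volume (quotient F β)
  dense-minor 0<ν 0<δ with iterate N ≤-refl
  ... | β , (model , _) , _ , few , many = β , model , label-inhabited F β 0<E , bound
    where
    E = volume (quotient F β)
    2^Nδ*2≤A : 2 ^ N * δ * 2 ≤ A
    2^Nδ*2≤A = ≤-trans (*-monoˡ-≤ 2 (*-monoˡ-≤ δ (m≤n*m (2 ^ N) 32))) δ-small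
    0<A : 0 < A
    0<A = ≤-trans (*-mono-≤ (*-mono-≤ (m^n>0 2 N) 0<δ) (s≤s {0} {1} z≤n)) 2^Nδ*2≤A
    0<2^N*E : 0 < 2 ^ N * E
    0<2^N*E = ≤-trans (*-mono-≤ 0<ν 0<A) many
    0<E : 0 < E
    0<E = n≢0⇒n>0 λ E≡0 → <⇒≱ 0<2^N*E (≤-reflexive (trans (cong (2 ^ N *_) E≡0) (*-zeroʳ (2 ^ N))))
    bound : δ * ρ ^ N * card (label β) ≤ E
    bound = *-cancelˡ-≤ (2 ^ N) {{>-nonZero (m^n>0 2 N)}} (begin
      2 ^ N * (δ * ρ ^ N * card (label β))                ≡⟨ rearrange (2 ^ N) δ (ρ ^ N) (card (label β)) ⟩
      2 ^ N * δ * (card (label β) * ρ ^ N)                ≤⟨ (2 ^ N * δ) ⊗ few ⟩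
      2 ^ N * δ * (2 * ν)                                 ≡⟨ rearrange₂ (2 ^ N * δ) 2 ν ⟩
      ν * (2 ^ N * δ * 2)                                 ≤⟨ ν ⊗ 2^Nδ*2≤A ⟩
      ν * A                                               ≤⟨ many ⟩
      2 ^ N * E                                           ∎)
      where
      rearrange : ∀ t δ w c → t * (δ * w * c) ≡ t * δ * (c * w)
      rearrange = solve-∀
      rearrange₂ : ∀ t k ν → t * (k * ν) ≡ ν * (t * k)
      rearrange₂ = solve-∀

-- Local search, and changing a subset by one element

search : {A : Set} (μ : A → ℕ) (Stuck : A → Set) →
         (∀ s → (Σ A λ s′ → μ s′ < μ s) ⊎ Stuck s) → A → Σ A Stuck
search {A} μ Stuck improve s = go s (<-wellFounded (μ s))
  where
  go : ∀ s → Acc _<_ (μ s) → Σ A Stuck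
  go s (acc rec) with improve s
  ... | inj₁ (s′ , less) = go s′ (rec less)
  ... | inj₂ stuck       = s , stuck

insert : ∀ {n} → Subset n → Fin n → Subset n
insert P a i = P i ∨ does (a ≟ i)

insert-new : ∀ {n} (P : Subset n) a → insert P a a ≡ true
insert-new P a = ∨-introʳ {P a} (dec-true (a ≟ a) refl)

insert-elim : ∀ {n} (P : Subset n) a {i} → insert P a i ≡ true → P i ≡ true ⊎ a ≡ i
insert-elim P a {i} p with ∨-elim {P i} p
... | inj₁ Pi = inj₁ Pi
... | inj₂ q  = inj₂ (does-elim (a ≟ i) q)

card-insert : ∀ {n} (P : Subset n) a → card (insert P a) ≤ suc (card P)
card-insert P a = begin
  card (insert P a)                             ≤⟨ card-∨ P (λ i → does (a ≟ i)) ⟩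
  card P + card (λ i → does (a ≟ i))            ≡⟨ cong (card P +_) (trans (sum-cong-≗ (λ i → Eq.sym (*-identityʳ ⟦ does (a ≟ i) ⟧))) (sum-δ a (λ _ → 1))) ⟩
  card P + 1                                    ≡⟨ +-comm (card P) 1 ⟩
  suc (card P)                                  ∎
  where open ≤-Reasoning

complement : ∀ {n} → Subset n → Subset n
complement P i = not (P i)

remove : ∀ {n} → Subset n → Fin n → Subset n
remove P a i = P i ∧ not (does (a ≟ i))

remove-elim : ∀ {n} (P : Subset n) a {i} → remove P a i ≡ true → P i ≡ true
remove-elim P a p = proj₁ (∧-elim p)

card-remove : ∀ {n} (P : Subset n) a → P a ≡ true → suc (card (remove P a)) ≡ card P
card-remove P a Pa = begin
  suc (card (remove P a))                                            ≡⟨ +-comm 1 _ ⟩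
  card (remove P a) + 1                                              ≡⟨ cong (card (remove P a) +_) (Eq.sym (sum-δ a (λ _ → 1))) ⟩
  card (remove P a) + sum (λ i → ⟦ does (a ≟ i) ⟧ * 1)               ≡⟨ Eq.sym (∑-distrib-+ (λ i → ⟦ remove P a i ⟧) (λ i → ⟦ does (a ≟ i) ⟧ * 1)) ⟩
  sum (λ i → ⟦ remove P a i ⟧ + ⟦ does (a ≟ i) ⟧ * 1)                ≡⟨ sum-cong-≗ pointwise ⟩
  card P                                                             ∎
  where
  open Eq.≡-Reasoning
  pointwise : ∀ i → ⟦ remove P a i ⟧ + ⟦ does (a ≟ i) ⟧ * 1 ≡ ⟦ P i ⟧
  pointwise i with a ≟ i
  ... | yes refl rewrite Pa = refl
  ... | no _ with P i
  ...   | true  = refl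
  ...   | false = refl

complement-insert : ∀ {n} (P : Subset n) a → P a ≢ true →
                    card (complement (insert P a)) < card (complement P)
complement-insert P a ¬Pa = ≤-trans (s≤s (card-mono {P = complement (insert P a)} {remove (complement P) a} outside))
                              (≤-reflexive (card-remove (complement P) a (not-intro ¬Pa)))
  where
  outside : ∀ i → complement (insert P a) i ≡ true → remove (complement P) a i ≡ true
  outside i p = ∧-intro (not-intro (not-elim p ∘ ∨-introˡ)) (not-intro (not-elim p ∘ ∨-introʳ {P i}))

inner-elim : ∀ {n} (F : Relation n) X {i j} → inner F X i j ≡ true → X i ≡ true × X j ≡ true × F i j ≡ true
inner-elim F X {i} {j} p with ∧-elim {X i} p
... | Xi , q with ∧-elim {X j} q
... | Xj , Fij = Xi , Xj , Fij

inner-inhabited : ∀ {n} (F : Relation n) X → 0 < volume (inner F X) → 0 < card X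
inner-inhabited F X 0<v with sum-positive (degree (inner F X)) 0<v
... | i , 0<deg with card-inhabited (inner F X i) 0<deg
...   | j , p = card-positive X i (proj₁ (inner-elim F X {i} {j} p))

restrict : ∀ {n} {G : Graph n} → Subgraph G → Subset n → Subgraph G
restrict S X = record
  { V = X
  ; F = inner F X
  ; F⊆G = λ i j p → F⊆G i j (proj₂ (proj₂ (inner-elim F X p)))
  ; F-sym = λ i j p → let (Xi , Xj , Fij) = inner-elim F X p in ∧-intro Xj (∧-intro Xi (F-sym i j Fij))
  ; F⊆V = λ i j p → proj₁ (inner-elim F X p)
  }
  where open Subgraph S

degree-inner : ∀ {n} (F : Relation n) X i → degree (inner F X) i ≤ ⟦ X i ⟧ * degree F i
degree-inner F X i = ≤-trans (≤-reflexive (sum-⟦∧⟧ (X i) (λ j → X j ∧ F i j)))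
                       (⟦ X i ⟧ ⊗ card-mono {P = λ j → X j ∧ F i j} {F i} (λ j p → proj₂ (∧-elim {X j} p)))

-- Splitting off the vertices of large degree

large-part : ∀ E A B C → E ≤ A + B + (C + C) → E ≤ 4 * A ⊎ E ≤ 4 * B ⊎ E ≤ 4 * C
large-part E A B C h with E ≤? 4 * A | E ≤? 4 * B | E ≤? 4 * C
... | yes p | _     | _     = inj₁ p
... | no _  | yes p | _     = inj₂ (inj₁ p)
... | no _  | no _  | yes p = inj₂ (inj₂ p)
... | no p  | no q  | no r  = ⊥-elim (1+n≰n {E} (linear 0 3 (4 ⊗ h ⊕ ≰⇒> p ⊕ ≰⇒> q ⊕ 2 ⊗ ≰⇒> r) (algebra E A B C)))
  where
  algebra : ∀ E A B C → 1 * suc E + (4 * (A + B + (C + C)) + E + E + 2 * E) + 3 ≡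
                        1 * E + (4 * E + suc (4 * A) + suc (4 * B) + 2 * suc (4 * C))
  algebra = solve-∀

positive-part : ∀ {E k} → 0 < E → E ≤ 4 * k → 0 < k
positive-part {k = zero}  0<E E≤0 = ⊥-elim (<⇒≱ 0<E E≤0)
positive-part {k = suc _} _   _   = s≤s z≤n

module Split {n : ℕ} {G : Graph n} (S : Subgraph G) (Θ : ℕ) where
  open Subgraph S
  open ≤-Reasoning

  high low : Subset n
  high i = does (Θ ≤? degree F i)
  low i  = V i ∧ not (high i)

  high-degree : ∀ i → high i ≡ true → Θ ≤ degree F i
  high-degree i = does-elim (Θ ≤? degree F i)

  low-degree : ∀ i → low i ≡ true → degree F i < Θ
  low-degree i p = ≰⇒> λ h → not-elim (proj₂ (∧-elim {V i} p)) (dec-true (Θ ≤? degree F i) h)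

  low-degree-inner : ∀ i → degree (inner F low) i ≤ Θ
  low-degree-inner i = ≤-trans (degree-inner F low i) (⟦⟧*-≤ λ p → <⇒≤ (low-degree i p))

  low-high : ∀ i → low i ≡ true → high i ≢ true
  low-high i p = not-elim (proj₂ (∧-elim {V i} p))

  low≤V : card low ≤ card V
  low≤V = card-mono {P = low} {V} (λ i p → proj₁ (∧-elim p))

  high-few : Θ * card high ≤ volume F
  high-few = ≤-trans (sum-≤-*card high (degree F) Θ high-degree) (sum-mono (λ i → ⟦⟧*-≤ {high i} (λ _ → ≤-refl)))

  -- An edge between the two sides is seen once by `cut` but twice by `volume`.
  volume-split : volume F ≤ volume (inner F low) + volume (inner F high) + (cut F low high + cut F low high)
  volume-split = begin
    volume F ≤⟨ sum₂-mono pointwise ⟩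
    sum (λ i → sum (λ j → (⟦ inner F low i j ⟧ + ⟦ inner F high i j ⟧) + (c i j + c j i))) ≡⟨ sum₂-+ (λ i j → ⟦ inner F low i j ⟧ + ⟦ inner F high i j ⟧) (λ i j → c i j + c j i) ⟩
    sum (λ i → sum (λ j → ⟦ inner F low i j ⟧ + ⟦ inner F high i j ⟧)) + sum (λ i → sum (λ j → c i j + c j i)) ≡⟨ cong₂ _+_ (sum₂-+ (λ i j → ⟦ inner F low i j ⟧) (λ i j → ⟦ inner F high i j ⟧)) (trans (sum₂-+ c (λ i j → c j i)) (cong (cut F low high +_) (∑-comm (λ i j → c j i)))) ⟩
    volume (inner F low) + volume (inner F high) + (cut F low high + cut F low high) ∎
    where
    c : Fin n → Fin n → ℕ
    c i j = ⟦ low i ∧ high j ∧ F i j ⟧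
    ones : ∀ a b c d {e f g h} → e ∨ f ∨ g ∨ h ≡ true →
           (e ≡ true → a ≡ true) → (f ≡ true → b ≡ true) → (g ≡ true → c ≡ true) → (h ≡ true → d ≡ true) →
           1 ≤ (⟦ a ⟧ + ⟦ b ⟧) + (⟦ c ⟧ + ⟦ d ⟧)
    ones a b c d {e} {f} {g} p ea fb gc hd with ∨-elim {e} p
    ... | inj₁ q rewrite ea q = s≤s z≤n
    ... | inj₂ p with ∨-elim {f} p
    ...   | inj₁ q rewrite fb q = ≤-trans (m≤n+m 1 ⟦ a ⟧) (m≤m+n _ _)
    ...   | inj₂ p with ∨-elim {g} p
    ...     | inj₁ q rewrite gc q = ≤-trans (s≤s z≤n) (m≤n+m _ (⟦ a ⟧ + ⟦ b ⟧))
    ...     | inj₂ q rewrite hd q = ≤-trans (m≤n+m 1 ⟦ c ⟧) (m≤n+m _ (⟦ a ⟧ + ⟦ b ⟧))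
    cases : ∀ x y → (not x ∧ not y) ∨ (x ∧ y) ∨ (not x ∧ y) ∨ (not y ∧ x) ≡ true
    cases true  true  = refl
    cases true  false = refl
    cases false true  = refl
    cases false false = refl
    pointwise : ∀ i j → ⟦ F i j ⟧ ≤ (⟦ inner F low i j ⟧ + ⟦ inner F high i j ⟧) + (c i j + c j i)
    pointwise i j = ⟦⟧-≤ λ Fij →
      let Fji = F-sym i j Fij ; Vi = F⊆V i j Fij ; Vj = F⊆V j i Fji in
      ones (inner F low i j) (inner F high i j) (low i ∧ high j ∧ F i j) (low j ∧ high i ∧ F j i) (cases (high i) (high j))
        (λ p → let (a , b) = ∧-elim {not (high i)} p in ∧-intro (∧-intro Vi a) (∧-intro (∧-intro Vj b) Fij))
        (λ p → let (a , b) = ∧-elim {high i} p in ∧-intro a (∧-intro b Fij))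
        (λ p → let (a , b) = ∧-elim {not (high i)} p in ∧-intro (∧-intro Vi a) (∧-intro b Fij))
        (λ p → let (a , b) = ∧-elim {not (high j)} p in ∧-intro (∧-intro Vj a) (∧-intro b Fji))

  trichotomy : volume F ≤ 4 * volume (inner F low) ⊎ volume F ≤ 4 * volume (inner F high) ⊎ volume F ≤ 4 * cut F low high
  trichotomy = large-part (volume F) (volume (inner F low)) (volume (inner F high)) (cut F low high) volume-split

-- Thinning out the low side of a bipartite graph

-- Degrees in `A` are at most `Θ`, those in `B` may be `R` times larger. Vertices of `A` are chosen
-- greedily, a vertex only if it brings at least `λ₀` new edges to vertices of `B` that have not yet
-- received `Θ` of them. `M` is the set of edges so received.
module Balance {n : ℕ} {G : Graph n} (S : Subgraph G) (A B : Subset n) (disjoint : ∀ i → A i ≡ true → B i ≢ true)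
               (Θ R λ₀ : ℕ) where
  open Subgraph S
  open ≤-Reasoning

  indegree : Relation n → Fin n → ℕ
  indegree M b = card (λ a → M a b)

  available : Relation n → Fin n → Subset n
  available M a b = B b ∧ F a b ∧ does (indegree M b <? Θ)

  available-elim : ∀ M {a b} → available M a b ≡ true → B b ≡ true × F a b ≡ true × indegree M b < Θ
  available-elim M {a} {b} p with ∧-elim {B b} p
  ... | Bb , q with ∧-elim {F a b} q
  ... | Fab , r = Bb , Fab , does-elim (indegree M b <? Θ) r

  record State : Set where
    field
      chosen     : Subset n
      M          : Relation n
      chosen⊆A   : ∀ a → chosen a ≡ true → A a ≡ true
      M⊆         : ∀ a b → M a b ≡ true → chosen a ≡ true × B b ≡ true × F a b ≡ true
      indegree≤  : ∀ b → indegree M b ≤ Θ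
      saturated  : ∀ a b → chosen a ≡ true → B b ≡ true → F a b ≡ true → M a b ≡ true ⊎ Θ ≤ indegree M b
      efficient  : λ₀ * card chosen ≤ sum (indegree M)
  open State

  Stuck : State → Set
  Stuck s = ∀ a → A a ≡ true → chosen s a ≢ true → card (available (M s) a) < λ₀

  add : ∀ s a → A a ≡ true → chosen s a ≢ true → λ₀ ≤ card (available (M s) a) → State
  add s a Aa new many = record
    { chosen    = insert (chosen s) a
    ; M         = M′
    ; chosen⊆A  = λ i p → case insert-elim (chosen s) a p of λ where
        (inj₁ q)    → chosen⊆A s i q
        (inj₂ refl) → Aa
    ; M⊆        = λ i b p → case ∨-elim {M s i b} p of λ where
        (inj₁ q) → let (c , Bb , Fib) = M⊆ s i b q in ∨-introˡ c , Bb , Fib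
        (inj₂ q) → let (a≡i , av) = ∧-elim {does (a ≟ i)} q
                       (Bb , Fab , _) = available-elim (M s) av
                   in ∨-introʳ {chosen s i} a≡i , Bb , subst (λ w → F w b ≡ true) (does-elim (a ≟ i) a≡i) Fab
    ; indegree≤ = λ b → ≤-trans (≤-reflexive (indegree-add b)) (bounded b)
    ; saturated = λ i b p Bb Fib → case insert-elim (chosen s) a p of λ where
        (inj₁ q)    → case saturated s i b q Bb Fib of λ where
          (inj₁ Mib)  → inj₁ (∨-introˡ Mib)
          (inj₂ full) → inj₂ (≤-trans full (grows b))
        (inj₂ refl) → case indegree (M s) b <? Θ of λ where
          (yes free) → inj₁ (∨-introʳ {M s a b} (∧-intro (dec-true (a ≟ a) refl)
                         (∧-intro Bb (∧-intro Fib (dec-true (indegree (M s) b <? Θ) free)))))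
          (no full)  → inj₂ (≤-trans (≮⇒≥ full) (grows b))
    ; efficient = begin
        λ₀ * card (insert (chosen s) a)                          ≤⟨ λ₀ ⊗ card-insert (chosen s) a ⟩
        λ₀ * suc (card (chosen s))                               ≡⟨ *-suc λ₀ _ ⟩
        λ₀ + λ₀ * card (chosen s)                                ≤⟨ many ⊕ efficient s ⟩
        card (available (M s) a) + sum (indegree (M s))          ≡⟨ +-comm (card (available (M s) a)) _ ⟩
        sum (indegree (M s)) + card (available (M s) a)          ≡⟨ Eq.sym (∑-distrib-+ (indegree (M s)) (λ b → ⟦ available (M s) a b ⟧)) ⟩
        sum (λ b → indegree (M s) b + ⟦ available (M s) a b ⟧)   ≡⟨ sum-cong-≗ (λ b → Eq.sym (indegree-add b)) ⟩
        sum (indegree M′)                                        ∎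
    }
    where
    M′ : Relation n
    M′ i b = M s i b ∨ (does (a ≟ i) ∧ available (M s) a b)
    indegree-add : ∀ b → indegree M′ b ≡ indegree (M s) b + ⟦ available (M s) a b ⟧
    indegree-add b = trans (sum-cong-≗ pointwise)
      (trans (∑-distrib-+ (λ i → ⟦ M s i b ⟧) (λ i → ⟦ does (a ≟ i) ⟧ * ⟦ available (M s) a b ⟧))
             (cong (indegree (M s) b +_) (sum-δ a (λ _ → ⟦ available (M s) a b ⟧))))
      where
      pointwise : ∀ i → ⟦ M′ i b ⟧ ≡ ⟦ M s i b ⟧ + ⟦ does (a ≟ i) ⟧ * ⟦ available (M s) a b ⟧
      pointwise i with a ≟ i
      ... | yes refl rewrite ≢true⇒false (λ p → new (proj₁ (M⊆ s a b p))) = Eq.sym (+-identityʳ _)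
      ... | no _ with M s i b
      ...   | true  = refl
      ...   | false = refl
    grows : ∀ b → indegree (M s) b ≤ indegree M′ b
    grows b = ≤-trans (m≤m+n _ _) (≤-reflexive (Eq.sym (indegree-add b)))
    bounded : ∀ b → indegree (M s) b + ⟦ available (M s) a b ⟧ ≤ Θ
    bounded b with true? (available (M s) a b)
    ... | yes av rewrite av = ≤-trans (≤-reflexive (+-comm _ 1)) (proj₂ (proj₂ (available-elim (M s) av)))
    ... | no ¬av rewrite ≢true⇒false ¬av = ≤-trans (≤-reflexive (+-identityʳ _)) (indegree≤ s b)

  empty : State
  empty = record
    { chosen    = λ _ → false
    ; M         = λ _ _ → false
    ; chosen⊆A  = λ _ ()
    ; M⊆        = λ _ _ ()
    ; indegree≤ = λ b → ≤-trans (≤-reflexive (sum-zero {n} (λ _ → refl))) z≤n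
    ; saturated = λ _ _ ()
    ; efficient = ≤-trans (≤-reflexive (trans (cong (λ₀ *_) (sum-zero {n} (λ _ → refl))) (*-zeroʳ λ₀))) z≤n
    }

  improve : ∀ s → (Σ State λ s′ → card (complement (chosen s′)) < card (complement (chosen s))) ⊎ Stuck s
  improve s with any? (λ a → true? (A a) ×-dec ¬? (true? (chosen s a)) ×-dec (λ₀ ≤? card (available (M s) a)))
  ... | yes (a , Aa , new , many) = inj₁ (add s a Aa new many , complement-insert (chosen s) a new)
  ... | no none = inj₂ λ a Aa new → ≰⇒> λ many → none (a , Aa , new , many)

  module Final (A-low : ∀ i → A i ≡ true → degree F i ≤ Θ) (F≤RΘ : ∀ i → degree F i ≤ R * Θ) (0<R : 0 < R)
               (s : State) (stuck : Stuck s) where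
    t = sum (indegree (M s))

    rejected : Subset n
    rejected a = A a ∧ not (chosen s a)

    -- If `b` is full, `M` retains at least a fraction 1/R of its edges. Otherwise `M` misses only
    -- edges from rejected vertices, to which `b` was available; each rejected vertex has fewer than
    -- `λ₀` such edges.
    column : ∀ b → sum (λ a → ⟦ A a ∧ B b ∧ F a b ⟧) ≤
                   R * indegree (M s) b + sum (λ a → ⟦ rejected a ∧ available (M s) a b ⟧)
    column b with Θ ≤? indegree (M s) b
    ... | yes full = begin
      sum (λ a → ⟦ A a ∧ B b ∧ F a b ⟧) ≤⟨ sum-mono (λ a → ⟦⟧-mono {A a ∧ B b ∧ F a b} {F b a} (λ p → F-sym a b (proj₂ (∧-elim {B b} (proj₂ (∧-elim {A a} p)))))) ⟩
      degree F b                        ≤⟨ F≤RΘ b ⟩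
      R * Θ                             ≤⟨ R ⊗ full ⟩
      R * indegree (M s) b              ≤⟨ m≤m+n _ _ ⟩
      R * indegree (M s) b + sum (λ a → ⟦ rejected a ∧ available (M s) a b ⟧) ∎
    ... | no free = begin
      sum (λ a → ⟦ A a ∧ B b ∧ F a b ⟧) ≤⟨ sum-mono pointwise ⟩
      sum (λ a → ⟦ M s a b ⟧ + ⟦ rejected a ∧ available (M s) a b ⟧) ≡⟨ ∑-distrib-+ (λ a → ⟦ M s a b ⟧) (λ a → ⟦ rejected a ∧ available (M s) a b ⟧) ⟩
      indegree (M s) b + sum (λ a → ⟦ rejected a ∧ available (M s) a b ⟧) ≤⟨ +-monoˡ-≤ _ (m≤n*m (indegree (M s) b) R {{>-nonZero 0<R}}) ⟩
      R * indegree (M s) b + sum (λ a → ⟦ rejected a ∧ available (M s) a b ⟧) ∎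
      where
      pointwise : ∀ a → ⟦ A a ∧ B b ∧ F a b ⟧ ≤ ⟦ M s a b ⟧ + ⟦ rejected a ∧ available (M s) a b ⟧
      pointwise a = ⟦⟧-≤ λ p →
        let (Aa , q) = ∧-elim {A a} p
            (Bb , Fab) = ∧-elim {B b} q
        in case true? (chosen s a) of λ where
          (yes c) → case saturated s a b c Bb Fab of λ where
            (inj₁ Mab)  → ≤-trans (≤-reflexive (Eq.sym (⟦⟧-true Mab))) (m≤m+n _ _)
            (inj₂ full) → ⊥-elim (free full)
          (no ¬c) → ≤-trans (≤-reflexive (Eq.sym (⟦⟧-true (∧-intro (∧-intro Aa (not-intro ¬c))
                      (∧-intro Bb (∧-intro Fab (dec-true (indegree (M s) b <? Θ) (≰⇒> free)))))))) (m≤n+m _ ⟦ M s a b ⟧)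

    cut-bound : cut F A B ≤ R * t + λ₀ * card A
    cut-bound = begin
      cut F A B ≡⟨ ∑-comm (λ a b → ⟦ A a ∧ B b ∧ F a b ⟧) ⟩
      sum (λ b → sum (λ a → ⟦ A a ∧ B b ∧ F a b ⟧)) ≤⟨ sum-mono column ⟩
      sum (λ b → R * indegree (M s) b + sum (λ a → ⟦ rejected a ∧ available (M s) a b ⟧)) ≡⟨ ∑-distrib-+ (λ b → R * indegree (M s) b) (λ b → sum (λ a → ⟦ rejected a ∧ available (M s) a b ⟧)) ⟩
      sum (λ b → R * indegree (M s) b) + sum (λ b → sum (λ a → ⟦ rejected a ∧ available (M s) a b ⟧)) ≡⟨ cong₂ _+_ (Eq.sym (*-distribˡ-sum R (indegree (M s)))) (∑-comm (λ b a → ⟦ rejected a ∧ available (M s) a b ⟧)) ⟩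
      R * t + sum (λ a → sum (λ b → ⟦ rejected a ∧ available (M s) a b ⟧)) ≡⟨ cong (R * t +_) (sum-cong-≗ (λ a → sum-⟦∧⟧ (rejected a) (available (M s) a))) ⟩
      R * t + sum (λ a → ⟦ rejected a ⟧ * card (available (M s) a)) ≤⟨ +-monoʳ-≤ (R * t) (sum-bound (λ a p → let (Aa , ¬c) = ∧-elim {A a} p in <⇒≤ (stuck a Aa (not-elim ¬c)))) ⟩
      R * t + λ₀ * card rejected ≤⟨ +-monoʳ-≤ (R * t) (λ₀ ⊗ card-mono {P = rejected} {A} (λ a p → proj₁ (∧-elim p))) ⟩
      R * t + λ₀ * card A ∎

    S′ : Subgraph G
    S′ = record
      { V     = λ i → chosen s i ∨ B i
      ; F     = F′
      ; F⊆G   = λ i j p → case ∨-elim {M s i j} p of λ where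
          (inj₁ q) → F⊆G i j (proj₂ (proj₂ (M⊆ s i j q)))
          (inj₂ q) → F⊆G i j (F-sym j i (proj₂ (proj₂ (M⊆ s j i q))))
      ; F-sym = λ i j p → case ∨-elim {M s i j} p of λ where
          (inj₁ q) → ∨-introʳ {M s j i} q
          (inj₂ q) → ∨-introˡ q
      ; F⊆V   = λ i j p → case ∨-elim {M s i j} p of λ where
          (inj₁ q) → ∨-introˡ (proj₁ (M⊆ s i j q))
          (inj₂ q) → ∨-introʳ {chosen s i} (proj₁ (proj₂ (M⊆ s j i q)))
      }
      where
      F′ : Relation n
      F′ i j = M s i j ∨ M s j i

    degree′ : ∀ i → degree (Subgraph.F S′) i ≤ Θ
    degree′ i with true? (A i)
    ... | yes Ai = ≤-trans (card-mono {P = Subgraph.F S′ i} {F i} (λ j p → case ∨-elim {M s i j} p of λ where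
                     (inj₁ q) → proj₂ (proj₂ (M⊆ s i j q))
                     (inj₂ q) → F-sym j i (proj₂ (proj₂ (M⊆ s j i q))))) (A-low i Ai)
    ... | no ¬Ai = ≤-trans (card-mono {P = Subgraph.F S′ i} {λ j → M s j i} (λ j p → case ∨-elim {M s i j} p of λ where
                     (inj₁ q) → ⊥-elim (¬Ai (chosen⊆A s i (proj₁ (M⊆ s i j q))))
                     (inj₂ q) → q)) (indegree≤ s i)

    volume′ : t + t ≤ volume (Subgraph.F S′)
    volume′ = begin
      t + t ≡⟨ cong (_+ t) (∑-comm (λ b a → ⟦ M s a b ⟧)) ⟩
      volume (M s) + sum (λ i → sum (λ j → ⟦ M s j i ⟧)) ≡⟨ Eq.sym (sum₂-+ (λ i j → ⟦ M s i j ⟧) (λ i j → ⟦ M s j i ⟧)) ⟩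
      sum (λ i → sum (λ j → ⟦ M s i j ⟧ + ⟦ M s j i ⟧)) ≤⟨ sum₂-mono pointwise ⟩
      volume (Subgraph.F S′) ∎
      where
      exclusive : ∀ i j → M s i j ≡ true → M s j i ≢ true
      exclusive i j p q = disjoint j (chosen⊆A s j (proj₁ (M⊆ s j i q))) (proj₁ (proj₂ (M⊆ s i j p)))
      pointwise : ∀ i j → ⟦ M s i j ⟧ + ⟦ M s j i ⟧ ≤ ⟦ M s i j ∨ M s j i ⟧
      pointwise i j with true? (M s i j)
      ... | yes p rewrite p | ≢true⇒false (exclusive i j p) = ≤-refl
      ... | no ¬p rewrite ≢true⇒false ¬p = ≤-refl

  -- `cut-bound` loses at most half of the cut to rejected vertices, so `M` has at least cut/(2R)
  -- edges, which pays for `B`. The chosen vertices are paid for by the greedy rule.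
  balance : (∀ i → A i ≡ true → degree F i ≤ Θ) → (∀ i → degree F i ≤ R * Θ) → 0 < R →
            2 * (λ₀ * card A) ≤ cut F A B → 2 * R * (λ₀ * card B) ≤ cut F A B → 0 < cut F A B →
            Σ (Subgraph G) λ S′ → (∀ i → degree (Subgraph.F S′) i ≤ Θ) × 0 < card (Subgraph.V S′) ×
              λ₀ * card (Subgraph.V S′) ≤ volume (Subgraph.F S′)
  balance A-low F≤RΘ 0<R A-few B-few 0<cut =
    let (s , stuck) = search (λ s → card (complement (chosen s))) Stuck improve empty
        open Final A-low F≤RΘ 0<R s stuck
    in S′ , degree′ , inhabited s , (begin
      λ₀ * card (Subgraph.V S′)                    ≤⟨ λ₀ ⊗ card-∨ (chosen s) B ⟩
      λ₀ * (card (chosen s) + card B)              ≡⟨ *-distribˡ-+ λ₀ (card (chosen s)) (card B) ⟩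
      λ₀ * card (chosen s) + λ₀ * card B           ≤⟨ efficient s ⊕ B≤ (cut F A B) t cut-bound A-few B-few ⟩
      t + t                                        ≤⟨ volume′ ⟩
      volume (Subgraph.F S′)                       ∎)
    where
    inhabited : ∀ s → 0 < card (λ i → chosen s i ∨ B i)
    inhabited s with sum-positive (λ i → sum (λ j → ⟦ A i ∧ B j ∧ F i j ⟧)) 0<cut
    ... | i , 0<row with card-inhabited (λ j → A i ∧ B j ∧ F i j) 0<row
    ...   | j , p = card-positive (λ i → chosen s i ∨ B i) j (∨-introʳ {chosen s j} (proj₁ (∧-elim {B j} (proj₂ (∧-elim {A i} p)))))
    B≤ : ∀ C t → C ≤ R * t + λ₀ * card A → 2 * (λ₀ * card A) ≤ C → 2 * R * (λ₀ * card B) ≤ C → λ₀ * card B ≤ t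
    B≤ C t h₁ h₂ h₃ = *-cancelˡ-≤ R {{>-nonZero 0<R}} (linear 1 0 (2 ⊗ h₁ ⊕ h₂ ⊕ h₃) (algebra R (λ₀ * card B) (λ₀ * card A) C t))
      where
      algebra : ∀ R b a C t → 2 * (R * b) + (2 * (R * t + a) + C + C) + 0 ≡ 2 * (R * t) + (2 * C + 2 * a + 2 * R * b)
      algebra = solve-∀

-- Passing to an almost regular subgraph

-- The factor 8 per step is 4 from `trichotomy` times 2 from `balance`. The descent ends early in
-- two cases: when the degrees, at most RΘ, are within R² of the current density, or when the
-- vertices of degree at least Θ span a quarter of the volume. There are at most E/Θ of these, so Θ
-- serves as their density, up to the factor 4 in the conclusion.
regularise : ∀ {n} {G : Graph n} (R : ℕ) → 0 < R → ∀ c δ → 0 < δ → (S : Subgraph G) → 0 < card (Subgraph.V S) →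
             (∀ i → degree (Subgraph.F S) i ≤ R ^ c) →
             8 ^ c * δ * card (Subgraph.V S) ≤ volume (Subgraph.F S) →
             Σ (Subgraph G) λ S′ → Σ ℕ λ δ′ → 0 < card (Subgraph.V S′) × δ ≤ δ′ ×
               δ′ * card (Subgraph.V S′) ≤ 4 * volume (Subgraph.F S′) ×
               (∀ i → degree (Subgraph.F S′) i ≤ R * R * δ′)
regularise R 0<R zero δ 0<δ S 0<V F≤ dense =
  S , δ , 0<V , ≤-refl , ≤-trans (≤-reflexive (cong (_* card (Subgraph.V S)) (Eq.sym (*-identityˡ δ)))) (≤-trans dense (m≤n*m _ 4)) ,
  λ i → ≤-trans (F≤ i) (*-mono-≤ (*-mono-≤ 0<R 0<R) 0<δ)
regularise {n} {G} R 0<R (suc c) δ 0<δ S 0<V F≤ dense = go (R * (8 ^ suc c * δ) ≤? Θ)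
  where
  open Subgraph S
  open ≤-Reasoning
  Θ = R ^ c
  δ₁ = 8 ^ suc c * δ
  λ₀ = 8 ^ c * δ
  open Split S Θ
  E = volume F

  δ₁≡8λ₀ : ∀ x → δ₁ * x ≡ 8 * (λ₀ * x)
  δ₁≡8λ₀ = assoc 8 (8 ^ c) δ
    where
    assoc : ∀ k t δ x → k * t * δ * x ≡ k * (t * δ * x)
    assoc = solve-∀

  δ≤δ₁ : δ ≤ δ₁
  δ≤δ₁ = m≤n*m δ (8 ^ suc c) {{>-nonZero (m^n>0 8 (suc c))}}

  0<E : 0 < E
  0<E = ≤-trans (*-mono-≤ (≤-trans 0<δ δ≤δ₁) 0<V) dense

  Goal = Σ (Subgraph G) λ S′ → Σ ℕ λ δ′ → 0 < card (Subgraph.V S′) × δ ≤ δ′ ×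
           δ′ * card (Subgraph.V S′) ≤ 4 * volume (Subgraph.F S′) × (∀ i → degree (Subgraph.F S′) i ≤ R * R * δ′)

  go : Dec (R * δ₁ ≤ Θ) → Goal
  go (no small) = S , δ₁ , 0<V , δ≤δ₁ , ≤-trans dense (m≤n*m _ 4) ,
    λ i → ≤-trans (F≤ i) (≤-trans (R ⊗ <⇒≤ (≰⇒> small)) (≤-reflexive (Eq.sym (*-assoc R R δ₁))))
  go (yes Rδ₁≤Θ) = cases trichotomy
    where
    cases : E ≤ 4 * volume (inner F low) ⊎ E ≤ 4 * volume (inner F high) ⊎ E ≤ 4 * cut F low high → Goal
    cases (inj₁ low-dense) =
      regularise R 0<R c δ 0<δ (restrict S low) (inner-inhabited F low (positive-part 0<E low-dense)) low-degree-inner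
        (halve (λ₀ * card low) (volume (inner F low)) (begin
          8 * (λ₀ * card low)         ≤⟨ 8 ⊗ λ₀ ⊗ low≤V ⟩
          8 * (λ₀ * card V)           ≡⟨ Eq.sym (δ₁≡8λ₀ (card V)) ⟩
          δ₁ * card V                 ≤⟨ dense ⟩
          E                           ≤⟨ low-dense ⟩
          4 * volume (inner F low)    ∎))
      where
      halve : ∀ x y → 8 * x ≤ 4 * y → x ≤ y
      halve x y h = linear 3 (4 * x) h (algebra x y)
        where
        algebra : ∀ x y → 4 * x + 4 * y + 4 * x ≡ 4 * y + 8 * x
        algebra = solve-∀
    cases (inj₂ (inj₁ high-dense)) =
      restrict S high , Θ , inner-inhabited F high (positive-part 0<E high-dense) ,
      ≤-trans δ≤δ₁ (≤-trans (m≤n*m δ₁ R {{>-nonZero 0<R}}) Rδ₁≤Θ) , ≤-trans high-few high-dense ,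
      λ i → ≤-trans (degree-inner F high i) (⟦⟧*-≤ {high i} λ _ → ≤-trans (F≤ i) (*-monoˡ-≤ Θ (m≤n*m R R {{>-nonZero 0<R}})))
    cases (inj₂ (inj₂ cut-dense)) =
      let (S′ , S′≤Θ , 0<V′ , dense′) = Balance.balance S low high low-high Θ R λ₀
            (λ i p → <⇒≤ (low-degree i p)) F≤ 0<R
            (quarter (λ₀ * card low) (cut F low high) (begin
              8 * (λ₀ * card low)         ≤⟨ 8 ⊗ λ₀ ⊗ low≤V ⟩
              8 * (λ₀ * card V)           ≡⟨ Eq.sym (δ₁≡8λ₀ (card V)) ⟩
              δ₁ * card V                 ≤⟨ dense ⟩
              E                           ≤⟨ cut-dense ⟩
              4 * cut F low high          ∎))
            (≤-trans (≤-reflexive (*-assoc 2 R _)) (quarter (R * (λ₀ * card high)) (cut F low high) (begin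
              8 * (R * (λ₀ * card high))  ≡⟨ swap 8 R (λ₀ * card high) ⟩
              R * (8 * (λ₀ * card high))  ≡⟨ cong (R *_) (Eq.sym (δ₁≡8λ₀ (card high))) ⟩
              R * (δ₁ * card high)        ≡⟨ Eq.sym (*-assoc R δ₁ (card high)) ⟩
              R * δ₁ * card high          ≤⟨ *-monoˡ-≤ (card high) Rδ₁≤Θ ⟩
              Θ * card high               ≤⟨ high-few ⟩
              E                           ≤⟨ cut-dense ⟩
              4 * cut F low high          ∎)))
            (positive-part 0<E cut-dense)
      in regularise R 0<R c δ 0<δ S′ 0<V′ S′≤Θ dense′
      where
      swap : ∀ a b x → a * (b * x) ≡ b * (a * x)
      swap = solve-∀
      quarter : ∀ x y → 8 * x ≤ 4 * y → 2 * x ≤ y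
      quarter x y h = linear 3 0 h (algebra x y)
        where
        algebra : ∀ x y → 4 * (2 * x) + 4 * y + 0 ≡ 4 * y + 8 * x
        algebra = solve-∀

-- Vertices of very large degree

cut-remove-row : ∀ {n} (F : Relation n) (P Q : Subset n) a →
                 cut F P Q ≤ cut F (remove P a) Q + card (λ j → Q j ∧ F a j)
cut-remove-row F P Q a = begin
  cut F P Q ≤⟨ sum₂-mono pointwise ⟩
  sum (λ i → sum (λ j → ⟦ remove P a i ∧ Q j ∧ F i j ⟧ + ⟦ does (a ≟ i) ⟧ * ⟦ Q j ∧ F a j ⟧)) ≡⟨ sum₂-+ (λ i j → ⟦ remove P a i ∧ Q j ∧ F i j ⟧) (λ i j → ⟦ does (a ≟ i) ⟧ * ⟦ Q j ∧ F a j ⟧) ⟩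
  cut F (remove P a) Q + sum (λ i → sum (λ j → ⟦ does (a ≟ i) ⟧ * ⟦ Q j ∧ F a j ⟧)) ≡⟨ cong (cut F (remove P a) Q +_) (sum-rows a (λ j → ⟦ Q j ∧ F a j ⟧)) ⟩
  cut F (remove P a) Q + card (λ j → Q j ∧ F a j) ∎
  where
  open ≤-Reasoning
  pointwise : ∀ i j → ⟦ P i ∧ Q j ∧ F i j ⟧ ≤ ⟦ remove P a i ∧ Q j ∧ F i j ⟧ + ⟦ does (a ≟ i) ⟧ * ⟦ Q j ∧ F a j ⟧
  pointwise i j with a ≟ i
  ... | yes refl = ≤-trans (⟦⟧-mono {P a ∧ Q j ∧ F a j} (λ p → proj₂ (∧-elim {P a} p)))
                     (≤-trans (≤-reflexive (Eq.sym (*-identityˡ _))) (m≤n+m _ ⟦ (P a ∧ false) ∧ Q j ∧ F a j ⟧))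
  ... | no _     = ≤-trans (⟦⟧-mono {P i ∧ Q j ∧ F i j} (λ p → let (Pi , q) = ∧-elim {P i} p in ∧-intro (∧-intro Pi refl) q)) (m≤m+n _ 0)

cut-remove-column : ∀ {n} (F : Relation n) (P Q : Subset n) b →
                    cut F P Q ≤ cut F P (remove Q b) + card (λ i → P i ∧ F i b)
cut-remove-column F P Q b = begin
  cut F P Q ≤⟨ sum₂-mono pointwise ⟩
  sum (λ i → sum (λ j → ⟦ P i ∧ remove Q b j ∧ F i j ⟧ + ⟦ does (b ≟ j) ⟧ * ⟦ P i ∧ F i b ⟧)) ≡⟨ sum₂-+ (λ i j → ⟦ P i ∧ remove Q b j ∧ F i j ⟧) (λ i j → ⟦ does (b ≟ j) ⟧ * ⟦ P i ∧ F i b ⟧) ⟩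
  cut F P (remove Q b) + sum (λ i → sum (λ j → ⟦ does (b ≟ j) ⟧ * ⟦ P i ∧ F i b ⟧)) ≡⟨ cong (cut F P (remove Q b) +_) (sum-columns b (λ i → ⟦ P i ∧ F i b ⟧)) ⟩
  cut F P (remove Q b) + card (λ i → P i ∧ F i b) ∎
  where
  open ≤-Reasoning
  pointwise : ∀ i j → ⟦ P i ∧ Q j ∧ F i j ⟧ ≤ ⟦ P i ∧ remove Q b j ∧ F i j ⟧ + ⟦ does (b ≟ j) ⟧ * ⟦ P i ∧ F i b ⟧
  pointwise i j with b ≟ j
  ... | yes refl = ≤-trans (⟦⟧-mono {P i ∧ Q b ∧ F i b} (λ p → let (Pi , q) = ∧-elim {P i} p in ∧-intro Pi (proj₂ (∧-elim {Q b} q))))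
                     (≤-trans (≤-reflexive (Eq.sym (*-identityˡ _))) (m≤n+m _ ⟦ P i ∧ (Q b ∧ false) ∧ F i b ⟧))
  ... | no _     = ≤-trans (⟦⟧-mono {P i ∧ Q j ∧ F i j} (λ p → let (Pi , q) = ∧-elim {P i} p ; (Qj , Fij) = ∧-elim {Q j} q in
                     ∧-intro Pi (∧-intro (∧-intro Qj refl) Fij))) (m≤m+n _ 0)

module Peel {n : ℕ} (F : Relation n) (λ₀ Y : ℕ) where

  Excess : Subset n × Subset n → Set
  Excess (P , Q) = λ₀ * card P + Y * card Q < cut F P Q

  -- A vertex with too few edges across contributes less to the cut than to the other side of
  -- `Excess`, so its removal keeps the excess; and a positive excess keeps the cut nonempty.
  peel : ∀ P₀ Q₀ → Excess (P₀ , Q₀) → Σ (Subset n) λ P → Σ (Subset n) λ Q →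
         (∀ i → P i ≡ true → P₀ i ≡ true) × (∀ i → Q i ≡ true → Q₀ i ≡ true) × 0 < cut F P Q ×
         (∀ a → P a ≡ true → λ₀ ≤ card (λ b → Q b ∧ F a b)) × (∀ b → Q b ≡ true → Y ≤ card (λ a → P a ∧ F a b))
  peel P₀ Q₀ excess₀ =
    let ((P , Q , P⊆ , Q⊆ , excess) , stuckᴾ , stuckᵠ) = search measure Stuck improve (P₀ , Q₀ , (λ _ p → p) , (λ _ p → p) , excess₀)
    in P , Q , P⊆ , Q⊆ , ≤-trans (s≤s z≤n) excess , stuckᴾ , stuckᵠ
    where
    State : Set
    State = Σ (Subset n) λ P → Σ (Subset n) λ Q →
            (∀ i → P i ≡ true → P₀ i ≡ true) × (∀ i → Q i ≡ true → Q₀ i ≡ true) × Excess (P , Q)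
    measure : State → ℕ
    measure (P , Q , _) = card P + card Q
    Stuck : State → Set
    Stuck (P , Q , _) = (∀ a → P a ≡ true → λ₀ ≤ card (λ b → Q b ∧ F a b)) × (∀ b → Q b ≡ true → Y ≤ card (λ a → P a ∧ F a b))
    improve : ∀ s → (Σ State λ s′ → measure s′ < measure s) ⊎ Stuck s
    improve (P , Q , P⊆ , Q⊆ , excess)
      with any? (λ a → true? (P a) ×-dec (card (λ b → Q b ∧ F a b) <? λ₀))
         | any? (λ b → true? (Q b) ×-dec (card (λ a → P a ∧ F a b) <? Y))
    ... | yes (a , Pa , few) | _ =
      inj₁ ((remove P a , Q , (λ i p → P⊆ i (remove-elim P a p)) , Q⊆ ,
             linear 0 0 (excess ⊕ cut-remove-row F P Q a ⊕ <⇒≤ few ⊕ ≤-reflexive (cong (λ₀ *_) (card-remove P a Pa)))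
               (algebra (λ₀ * card P) (Y * card Q) (cut F P Q) (cut F (remove P a) Q) (card (λ b → Q b ∧ F a b)) λ₀ (card (remove P a)))) ,
            +-monoˡ-≤ (card Q) (≤-reflexive (card-remove P a Pa)))
      where
      algebra : ∀ p q c c′ r l k → 1 * suc (l * k + q) + (c + (c′ + r) + l + p) + 0 ≡ 1 * c′ + (suc (p + q) + c + r + l * suc k)
      algebra = solve-∀
    ... | no _ | yes (b , Qb , few) =
      inj₁ ((P , remove Q b , P⊆ , (λ i p → Q⊆ i (remove-elim Q b p)) ,
             linear 0 0 (excess ⊕ cut-remove-column F P Q b ⊕ <⇒≤ few ⊕ ≤-reflexive (cong (Y *_) (card-remove Q b Qb)))
               (algebra (λ₀ * card P) (Y * card Q) (cut F P Q) (cut F P (remove Q b)) (card (λ a → P a ∧ F a b)) Y (card (remove Q b)))) ,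
            ≤-trans (≤-reflexive (Eq.sym (+-suc (card P) _))) (+-monoʳ-≤ (card P) (≤-reflexive (card-remove Q b Qb))))
      where
      algebra : ∀ p q c c′ r l k → 1 * suc (p + l * k) + (c + (c′ + r) + l + q) + 0 ≡ 1 * c′ + (suc (p + q) + c + r + l * suc k)
      algebra = solve-∀
    ... | no p | no q = inj₂ ((λ a Pa → ≮⇒≥ λ few → p (a , Pa , few)) , (λ b Qb → ≮⇒≥ λ few → q (b , Qb , few)))

shrink : ∀ {n} (P : Subset n) k → k ≤ card P → Σ (Subset n) λ P′ → (∀ i → P′ i ≡ true → P i ≡ true) × card P′ ≡ k
shrink {n}     P zero    _ = (λ _ → false) , (λ _ ()) , sum-zero {n} (λ _ → refl)
shrink {suc n} P (suc k) k≤ with P zero in P0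
... | true with shrink (P ∘ suc) k (≤-pred k≤)
...   | P′ , P′⊆ , eq = P″ , P″⊆ , cong suc eq
  where
  P″ : Subset (suc n)
  P″ zero    = true
  P″ (suc i) = P′ i
  P″⊆ : ∀ i → P″ i ≡ true → P i ≡ true
  P″⊆ zero    _ = P0
  P″⊆ (suc i) p = P′⊆ i p
shrink {suc n} P (suc k) k≤ | false with shrink (P ∘ suc) (suc k) k≤
...   | P′ , P′⊆ , eq = P″ , P″⊆ , eq
  where
  P″ : Subset (suc n)
  P″ zero    = false
  P″ (suc i) = P′ i
  P″⊆ : ∀ i → P″ i ≡ true → P i ≡ true
  P″⊆ (suc i) p = P′⊆ i p

DenseMinor : ∀ {n} → Graph n → ℕ → Set
DenseMinor {n} G x = Σ (Subgraph G) λ S → Σ (Labelling n) λ β → Model G β × 0 < card (label β) ×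
                     x * card (label β) ≤ volume (quotient (Subgraph.F S) β)

-- Each vertex of Q collects neighbours in P that make it adjacent to new vertices of Q,
-- until it has x neighbours. If some b ∈ Q cannot be served, then its unused neighbours in P
-- only see the fewer than x vertices already adjacent to b, which is a small dense subgraph.
module Hubs {n : ℕ} {G : Graph n} (S : Subgraph G) (P Q : Subset n) (disjoint : ∀ i → P i ≡ true → Q i ≢ true)
            (λ₀ x : ℕ) (P-degree : ∀ a → P a ≡ true → λ₀ ≤ card (λ b → Q b ∧ Subgraph.F S a b))
            (Q-degree : ∀ b → Q b ≡ true → x * x + 2 * x ≤ card (λ a → P a ∧ Subgraph.F S a b)) where
  open Subgraph S
  open ≤-Reasoning

  load : Labelling n → Fin n → ℕ
  load α b = card (λ a → P a ∧ is (α a) b)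

  free : Labelling n → Subset n
  free α u = go (α u)
    where
    go : Maybe (Fin n) → Bool
    go (just _) = false
    go nothing  = true

  free-elim : ∀ α {u} → free α u ≡ true → α u ≡ nothing
  free-elim α {u} p with α u
  ... | nothing = refl

  free-intro : ∀ α {u} → α u ≡ nothing → free α u ≡ true
  free-intro α p rewrite p = refl

  -- The branch sets are stars around the hubs. `load≤degree` holds because every collected vertex
  -- gave its hub a new neighbour; as a hub collects only while its degree is below `x`, this yields
  -- `load≤x`.
  record State : Set where
    field
      α     : Labelling n
      star  : ∀ u y → α u ≡ just y → Q y ≡ true × (u ≡ y ⊎ (P u ≡ true × F u y ≡ true))
      hubs  : ∀ b → Q b ≡ true → α b ≡ just b
      load≤degree : ∀ b → load α b ≤ degree (quotient F α) b
      load≤x : ∀ b → load α b ≤ x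
  open State

  Useful : State → Fin n → Fin n → Fin n → Set
  Useful s a b b₂ = P a ≡ true × α s a ≡ nothing × Q b ≡ true × F a b ≡ true × degree (quotient F (α s)) b < x ×
                    Q b₂ ≡ true × F a b₂ ≡ true × b₂ ≢ b × quotient F (α s) b b₂ ≢ true

  assign : ∀ s {a b b₂} → Useful s a b b₂ → Σ State λ s′ → card (free (α s′)) < card (free (α s))
  assign s {a} {b} {b₂} (Pa , αa , Qb , Fab , small , Qb₂ , Fab₂ , b₂≢b , new) = record
    { α = α′
    ; star = λ u y p → case α′-elim p of λ where
        (inj₁ (refl , refl)) → Qb , inj₂ (Pa , Fab)
        (inj₂ q)             → star s u y q
    ; hubs = λ b′ Qb′ → keeps (hubs s b′ Qb′)
    ; load≤degree = λ b′ → ≤-trans (load-grows b′) (enough b′)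
    ; load≤x = λ b′ → ≤-trans (load-grows b′) (bounded b′)
    } , fewer-free
    where
    α′ : Labelling n
    α′ u = if does (a ≟ u) then just b else α s u
    q  = quotient F (α s)
    q′ = quotient F α′

    α′-new : α′ a ≡ just b
    α′-new rewrite dec-true (a ≟ a) refl = refl

    keeps : ∀ {u y} → α s u ≡ just y → α′ u ≡ just y
    keeps {u} p with a ≟ u
    ... | yes refl = case trans (Eq.sym αa) p of λ ()
    ... | no _     = p

    α′-elim : ∀ {u y} → α′ u ≡ just y → (u ≡ a × y ≡ b) ⊎ α s u ≡ just y
    α′-elim {u} p with a ≟ u
    ... | yes refl = inj₁ (refl , Eq.sym (just-injective p))
    ... | no _     = inj₂ p

    fewer-free : card (free α′) < card (free (α s))
    fewer-free = ≤-trans (s≤s (card-mono {P = free α′} {remove (free (α s)) a} subset)) (≤-reflexive (card-remove (free (α s)) a (free-intro (α s) αa)))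
      where
      subset : ∀ u → free α′ u ≡ true → remove (free (α s)) a u ≡ true
      subset u p with a ≟ u | free-elim α′ p
      ... | no _ | r = ∧-intro (free-intro (α s) r) refl

    q⊆q′ : ∀ c d → q c d ≡ true → q′ c d ≡ true
    q⊆q′ c d p with quotient-elim F (α s) p
    ... | c≢d , u , v , αu , αv , Fuv = quotient-intro F α′ c≢d (keeps αu) (keeps αv) Fuv

    q′-new : q′ b b₂ ≡ true
    q′-new = quotient-intro F α′ (b₂≢b ∘ Eq.sym) α′-new (keeps (hubs s b₂ Qb₂)) Fab₂

    degree-grows : suc (degree q b) ≤ degree q′ b
    degree-grows = begin
      suc (degree q b)                                      ≡⟨ +-comm 1 _ ⟩
      degree q b + 1                                        ≡⟨ cong (degree q b +_) (Eq.sym (sum-δ b₂ (λ _ → 1))) ⟩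
      degree q b + sum (λ z → ⟦ does (b₂ ≟ z) ⟧ * 1)        ≡⟨ Eq.sym (∑-distrib-+ (λ z → ⟦ q b z ⟧) (λ z → ⟦ does (b₂ ≟ z) ⟧ * 1)) ⟩
      sum (λ z → ⟦ q b z ⟧ + ⟦ does (b₂ ≟ z) ⟧ * 1)         ≤⟨ sum-mono pointwise ⟩
      degree q′ b                                           ∎
      where
      pointwise : ∀ z → ⟦ q b z ⟧ + ⟦ does (b₂ ≟ z) ⟧ * 1 ≤ ⟦ q′ b z ⟧
      pointwise z with b₂ ≟ z
      ... | yes refl rewrite ≢true⇒false new | q′-new = ≤-refl
      ... | no _     = ≤-trans (≤-reflexive (+-identityʳ _)) (⟦⟧-mono (q⊆q′ b z))

    load-grows : ∀ b′ → load α′ b′ ≤ load (α s) b′ + ⟦ does (b ≟ b′) ⟧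
    load-grows b′ = begin
      load α′ b′ ≤⟨ sum-mono pointwise ⟩
      sum (λ u → ⟦ P u ∧ is (α s u) b′ ⟧ + ⟦ does (a ≟ u) ⟧ * ⟦ does (b ≟ b′) ⟧) ≡⟨ ∑-distrib-+ (λ u → ⟦ P u ∧ is (α s u) b′ ⟧) (λ u → ⟦ does (a ≟ u) ⟧ * ⟦ does (b ≟ b′) ⟧) ⟩
      load (α s) b′ + sum (λ u → ⟦ does (a ≟ u) ⟧ * ⟦ does (b ≟ b′) ⟧) ≡⟨ cong (load (α s) b′ +_) (sum-δ a (λ _ → ⟦ does (b ≟ b′) ⟧)) ⟩
      load (α s) b′ + ⟦ does (b ≟ b′) ⟧ ∎
      where
      pointwise : ∀ u → ⟦ P u ∧ is (α′ u) b′ ⟧ ≤ ⟦ P u ∧ is (α s u) b′ ⟧ + ⟦ does (a ≟ u) ⟧ * ⟦ does (b ≟ b′) ⟧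
      pointwise u with a ≟ u
      ... | yes refl = ≤-trans (⟦⟧-mono {P a ∧ does (b ≟ b′)} (λ p → proj₂ (∧-elim {P a} p))) (≤-trans (≤-reflexive (Eq.sym (*-identityˡ _))) (m≤n+m _ ⟦ P a ∧ is (α s a) b′ ⟧))
      ... | no _     = m≤m+n _ 0

    enough : ∀ b′ → load (α s) b′ + ⟦ does (b ≟ b′) ⟧ ≤ degree q′ b′
    enough b′ with b ≟ b′
    ... | yes refl = ≤-trans (≤-reflexive (+-comm _ 1)) (≤-trans (s≤s (load≤degree s b)) degree-grows)
    ... | no _     = ≤-trans (≤-reflexive (+-identityʳ _)) (≤-trans (load≤degree s b′) (card-mono {P = q b′} {q′ b′} (q⊆q′ b′)))

    bounded : ∀ b′ → load (α s) b′ + ⟦ does (b ≟ b′) ⟧ ≤ x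
    bounded b′ with b ≟ b′
    ... | yes refl = ≤-trans (≤-reflexive (+-comm _ 1)) (≤-trans (s≤s (load≤degree s b)) small)
    ... | no _     = ≤-trans (≤-reflexive (+-identityʳ _)) (load≤x s b′)

  initial : State
  initial = record
    { α = identity-on Q
    ; star = λ u y p → let (u≡y , Qu) = identity-elim Q p in subst (λ w → Q w ≡ true) u≡y Qu , inj₁ u≡y
    ; hubs = λ b → identity-intro Q
    ; load≤degree = λ b → ≤-trans (≤-reflexive (no-load b)) z≤n
    ; load≤x = λ b → ≤-trans (≤-reflexive (no-load b)) z≤n
    }
    where
    no-load : ∀ b → load (identity-on Q) b ≡ 0
    no-load b = sum-zero {f = λ a → ⟦ P a ∧ is (identity-on Q a) b ⟧} λ a → cong ⟦_⟧ (≢true⇒false λ p →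
      let (Pa , r) = ∧-elim {P a} p in disjoint a Pa (proj₂ (identity-elim Q (is-elim (identity-on Q a) r))))

  Stuck : State → Set
  Stuck s = ∀ a b b₂ → ¬ Useful s a b b₂

  nothing? : (m : Maybe (Fin n)) → Dec (m ≡ nothing)
  nothing? nothing  = yes refl
  nothing? (just _) = no λ ()

  improve : ∀ s → (Σ State λ s′ → card (free (α s′)) < card (free (α s))) ⊎ Stuck s
  improve s with any? (λ a → any? (λ b → any? (λ b₂ →
      true? (P a) ×-dec nothing? (α s a) ×-dec true? (Q b) ×-dec true? (F a b) ×-dec (degree (quotient F (α s)) b <? x) ×-dec
      true? (Q b₂) ×-dec true? (F a b₂) ×-dec ¬? (b₂ ≟ b) ×-dec ¬? (true? (quotient F (α s) b b₂)))))
  ... | yes (a , b , b₂ , useful) = inj₁ (assign s useful)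
  ... | no none = inj₂ λ a b b₂ useful → none (a , b , b₂ , useful)

  module Full (s : State) where
    q = quotient F (α s)

    model : Model G (α s)
    model y u v p r with star s u y p | star s v y r
    ... | Qy , su | _ , sv = from su (to sv)
      where
      In : Fin n → Set
      In w = α s w ≡ just y
      to : v ≡ y ⊎ (P v ≡ true × F v y ≡ true) → WalkIn G In y v
      to (inj₁ refl)      = here r
      to (inj₂ (_ , Fvy)) = step (hubs s y Qy) (F⊆G y v (F-sym v y Fvy)) (here r)
      from : u ≡ y ⊎ (P u ≡ true × F u y ≡ true) → WalkIn G In y v → WalkIn G In u v
      from (inj₁ refl)      w = w
      from (inj₂ (_ , Fuy)) w = step p (F⊆G u y Fuy) w

    full : (∀ b → Q b ≡ true → x ≤ degree q b) → ∀ b → Q b ≡ true → DenseMinor G x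
    full all-full b Qb = S , α s , model , card-positive (label (α s)) b (label-intro (α s) (hubs s b Qb)) , (begin
      x * card (label (α s))               ≤⟨ x ⊗ card-mono {P = label (α s)} {Q} (λ y l → let (u , p) = label-elim (α s) l in proj₁ (star s u y p)) ⟩
      x * card Q                           ≤⟨ sum-≤-*card Q (degree q) x all-full ⟩
      sum (λ b → ⟦ Q b ⟧ * degree q b)     ≤⟨ sum-mono (λ b → ⟦⟧*-≤ {Q b} (λ _ → ≤-refl)) ⟩
      volume q                             ∎)

  module Unserved (s : State) (stuck : Stuck s) (b : Fin n) (Qb : Q b ≡ true) (small : degree (quotient F (α s)) b < x) where
    q = quotient F (α s)

    U Z : Subset n
    U a = P a ∧ F a b ∧ free (α s) a
    Z = insert (q b) b

    Z-covers : ∀ a → U a ≡ true → ∀ b₂ → Q b₂ ≡ true → F a b₂ ≡ true → Z b₂ ≡ true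
    Z-covers a Ua b₂ Qb₂ Fab₂ with b₂ ≟ b | true? (q b b₂)
    ... | yes refl | _      = insert-new (q b) b
    ... | no _     | yes qb = ∨-introˡ qb
    ... | no b₂≢b  | no ¬qb =
      let (Pa , r) = ∧-elim {P a} Ua
          (Fab , fr) = ∧-elim {F a b} r
      in ⊥-elim (stuck a b b₂ (Pa , free-elim (α s) fr , Qb , Fab , small , Qb₂ , Fab₂ , b₂≢b , ¬qb))

    -- A neighbour of `b` that is in use was collected either by `b`, at most `x` times, or by
    -- another hub, which is thereby adjacent to `b`; there are fewer than `x` such hubs with at
    -- most `x` collected vertices each. This explains `x * x + 2 * x`.
    U-many : x ≤ card U
    U-many = linear 0 0 (Q-degree b Qb ⊕ neighbours ⊕ load≤x s b ⊕ x ⊗ <⇒≤ small)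
               (algebra x (card (λ a → P a ∧ F a b)) (card U) (load (α s) b) (degree q b))
      where
      algebra : ∀ x N U l d → 1 * x + (N + (U + (l + x * d)) + x + x * x) + 0 ≡ 1 * U + (x * x + 2 * x + N + l + x * d)
      algebra = solve-∀
      neighbours : card (λ a → P a ∧ F a b) ≤ card U + (load (α s) b + x * degree q b)
      neighbours = begin
        card (λ a → P a ∧ F a b) ≤⟨ sum-mono pointwise ⟩
        sum (λ a → ⟦ U a ⟧ + (⟦ P a ∧ is (α s a) b ⟧ + sum (λ y → ⟦ q b y ⟧ * ⟦ P a ∧ is (α s a) y ⟧))) ≡⟨ ∑-distrib-+ (λ a → ⟦ U a ⟧) (λ a → ⟦ P a ∧ is (α s a) b ⟧ + sum (λ y → ⟦ q b y ⟧ * ⟦ P a ∧ is (α s a) y ⟧)) ⟩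
        card U + sum (λ a → ⟦ P a ∧ is (α s a) b ⟧ + sum (λ y → ⟦ q b y ⟧ * ⟦ P a ∧ is (α s a) y ⟧)) ≡⟨ cong (card U +_) (∑-distrib-+ (λ a → ⟦ P a ∧ is (α s a) b ⟧) (λ a → sum (λ y → ⟦ q b y ⟧ * ⟦ P a ∧ is (α s a) y ⟧))) ⟩
        card U + (load (α s) b + sum (λ a → sum (λ y → ⟦ q b y ⟧ * ⟦ P a ∧ is (α s a) y ⟧))) ≡⟨ cong (λ w → card U + (load (α s) b + w)) (trans (∑-comm (λ a y → ⟦ q b y ⟧ * ⟦ P a ∧ is (α s a) y ⟧)) (sum-cong-≗ (λ y → Eq.sym (*-distribˡ-sum ⟦ q b y ⟧ (λ a → ⟦ P a ∧ is (α s a) y ⟧))))) ⟩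
        card U + (load (α s) b + sum (λ y → ⟦ q b y ⟧ * load (α s) y)) ≤⟨ +-monoʳ-≤ (card U) (+-monoʳ-≤ (load (α s) b) (sum-bound (λ y _ → load≤x s y))) ⟩
        card U + (load (α s) b + x * degree q b) ∎
        where
        pointwise : ∀ a → ⟦ P a ∧ F a b ⟧ ≤ ⟦ U a ⟧ + (⟦ P a ∧ is (α s a) b ⟧ + sum (λ y → ⟦ q b y ⟧ * ⟦ P a ∧ is (α s a) y ⟧))
        pointwise a = ⟦⟧-≤ λ p → by (∧-elim {P a} p) (α s a) refl
          where
          by : P a ≡ true × F a b ≡ true → ∀ m → α s a ≡ m →
               1 ≤ ⟦ U a ⟧ + (⟦ P a ∧ is (α s a) b ⟧ + sum (λ y → ⟦ q b y ⟧ * ⟦ P a ∧ is (α s a) y ⟧))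
          by (Pa , Fab) nothing  αa = ≤-trans (≤-reflexive (Eq.sym (⟦⟧-true (∧-intro Pa (∧-intro Fab (free-intro (α s) αa)))))) (m≤m+n _ _)
          by (Pa , Fab) (just y) αa with b ≟ y
          ... | yes refl = ≤-trans (≤-trans (≤-reflexive (Eq.sym (⟦⟧-true (∧-intro Pa (is-intro αa))))) (m≤m+n _ _)) (m≤n+m _ ⟦ U a ⟧)
          ... | no b≢y = ≤-trans (≤-trans (≤-trans
                  (≤-reflexive (Eq.sym (cong₂ _*_ (⟦⟧-true (quotient-intro F (α s) b≢y (hubs s b Qb) αa (F-sym a b Fab))) (⟦⟧-true (∧-intro Pa (is-intro αa))))))
                  (term≤sum (λ y → ⟦ q b y ⟧ * ⟦ P a ∧ is (α s a) y ⟧) y)) (m≤n+m _ ⟦ P a ∧ is (α s a) b ⟧)) (m≤n+m _ ⟦ U a ⟧)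

    unserved : Σ (Subgraph G) λ S′ → (∀ i → degree (Subgraph.F S′) i ≤ 2 * x) × 0 < card (Subgraph.V S′) ×
                 λ₀ * card (Subgraph.V S′) ≤ volume (Subgraph.F S′)
    -- Exactly `x` free vertices match the at most `x` elements of `Z`: there are at most `2 * x`
    -- vertices in all, and at least `λ₀ * x` edges from the free ones into `Z`.
    unserved = spot (shrink U x U-many)
     where
     spot : (Σ (Subset n) λ U′ → (∀ a → U′ a ≡ true → U a ≡ true) × card U′ ≡ x) →
            Σ (Subgraph G) λ S′ → (∀ i → degree (Subgraph.F S′) i ≤ 2 * x) × 0 < card (Subgraph.V S′) ×
              λ₀ * card (Subgraph.V S′) ≤ volume (Subgraph.F S′)
     spot (U′ , U′⊆U , U′≡x) = restrict S X , (λ i → ≤-trans (degree≤ i) X≤2x) ,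
               card-positive X b (∨-introʳ {U′ b} (insert-new (q b) b)) , X-dense
      where
      X : Subset n
      X i = U′ i ∨ Z i
      X≤2x : card X ≤ 2 * x
      X≤2x = begin
        card X           ≤⟨ card-∨ U′ Z ⟩
        card U′ + card Z ≤⟨ ≤-reflexive U′≡x ⊕ ≤-trans (card-insert (q b) b) small ⟩
        x + x            ≡⟨ cong (x +_) (Eq.sym (+-identityʳ x)) ⟩
        2 * x            ∎
      degree≤ : ∀ i → degree (inner F X) i ≤ card X
      degree≤ i = card-mono {P = inner F X i} {X} (λ j p → proj₁ (proj₂ (inner-elim F X {i} {j} p)))
      c : Fin n → Fin n → ℕ
      c i j = ⟦ U′ i ∧ Q j ∧ F i j ⟧
      C = cut F U′ Q
      C-large : λ₀ * x ≤ C
      C-large = begin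
        λ₀ * x                                         ≡⟨ cong (λ₀ *_) (Eq.sym U′≡x) ⟩
        λ₀ * card U′                                   ≤⟨ sum-≤-*card U′ (λ a → card (λ j → Q j ∧ F a j)) λ₀ (λ a p → P-degree a (proj₁ (∧-elim (U′⊆U a p)))) ⟩
        sum (λ a → ⟦ U′ a ⟧ * card (λ j → Q j ∧ F a j)) ≡⟨ sum-cong-≗ (λ a → Eq.sym (sum-⟦∧⟧ (U′ a) (λ j → Q j ∧ F a j))) ⟩
        C                                              ∎
      edge : ∀ i j → U′ i ∧ Q j ∧ F i j ≡ true → U′ i ≡ true × Q j ≡ true × F i j ≡ true × X i ≡ true × X j ≡ true
      edge i j p with ∧-elim {U′ i} p
      ... | U′i , r with ∧-elim {Q j} r
      ... | Qj , Fij = U′i , Qj , Fij , ∨-introˡ U′i , ∨-introʳ {U′ j} (Z-covers i (U′⊆U i U′i) j Qj Fij)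
      pointwise : ∀ i j → c i j + c j i ≤ ⟦ inner F X i j ⟧
      pointwise i j with true? (U′ i ∧ Q j ∧ F i j) | true? (U′ j ∧ Q i ∧ F j i)
      ... | yes p | yes r = ⊥-elim (disjoint i (proj₁ (∧-elim (U′⊆U i (proj₁ (edge i j p))))) (proj₁ (proj₂ (edge j i r))))
      ... | yes p | no ¬r rewrite p | ≢true⇒false ¬r = let (_ , _ , Fij , Xi , Xj) = edge i j p in
            ≤-reflexive (Eq.sym (⟦⟧-true (∧-intro Xi (∧-intro Xj Fij))))
      ... | no ¬p | yes r rewrite r | ≢true⇒false ¬p = let (_ , _ , Fji , Xj , Xi) = edge j i r in
            ≤-reflexive (Eq.sym (⟦⟧-true (∧-intro Xi (∧-intro Xj (F-sym j i Fji)))))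
      ... | no ¬p | no ¬r rewrite ≢true⇒false ¬p | ≢true⇒false ¬r = z≤n
      X-dense : λ₀ * card X ≤ volume (inner F X)
      X-dense = begin
        λ₀ * card X                                  ≤⟨ λ₀ ⊗ X≤2x ⟩
        λ₀ * (2 * x)                                 ≡⟨ double λ₀ x ⟩
        λ₀ * x + λ₀ * x                              ≤⟨ C-large ⊕ C-large ⟩
        C + C                                        ≡⟨ cong (C +_) (∑-comm c) ⟩
        C + sum (λ i → sum (λ j → c j i))            ≡⟨ Eq.sym (sum₂-+ c (λ i j → c j i)) ⟩
        sum (λ i → sum (λ j → c i j + c j i))        ≤⟨ sum₂-mono pointwise ⟩
        volume (inner F X)                           ∎
        where
        double : ∀ l x → l * (2 * x) ≡ l * x + l * x
        double = solve-∀

  hub-alternative : ∀ b → Q b ≡ true → DenseMinor G x ⊎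
    (Σ (Subgraph G) λ S′ → (∀ i → degree (Subgraph.F S′) i ≤ 2 * x) × 0 < card (Subgraph.V S′) ×
      λ₀ * card (Subgraph.V S′) ≤ volume (Subgraph.F S′))
  hub-alternative b₀ Qb₀ = decide (search (λ s → card (free (α s))) Stuck improve initial)
    where
    decide : Σ State Stuck → _
    decide (s , stuck) with any? (λ b → true? (Q b) ×-dec (degree (quotient F (α s)) b <? x))
    ... | yes (b , Qb , small) = inj₂ (Unserved.unserved s stuck b Qb small)
    ... | no none = inj₁ (Full.full s (λ b Qb → ≮⇒≥ λ small → none (b , Qb , small)) b₀ Qb₀)

-- After the factor 4 of `trichotomy`, the constant 16 leaves each term of `Excess` at most a
-- quarter of the cut. Edges among high vertices alone are the easy case: these vertices are so few
-- that the subgraph they span is dense enough by itself.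
bound-degrees : ∀ {n} {G : Graph n} (S : Subgraph G) λ₀ x → 0 < λ₀ → 0 < card (Subgraph.V S) →
                16 * (λ₀ * card (Subgraph.V S)) ≤ volume (Subgraph.F S) →
                DenseMinor G x ⊎
                (Σ (Subgraph G) λ S′ → (∀ i → degree (Subgraph.F S′) i ≤ 16 * (x * x + 2 * x)) × 0 < card (Subgraph.V S′) ×
                  λ₀ * card (Subgraph.V S′) ≤ volume (Subgraph.F S′))
bound-degrees {n} {G} S λ₀ x 0<λ₀ 0<V dense = cases trichotomy
  where
  open Subgraph S
  open ≤-Reasoning
  Y = x * x + 2 * x
  open Split S (16 * Y)
  E = volume F

  Goal : Set
  Goal = DenseMinor G x ⊎
         (Σ (Subgraph G) λ S′ → (∀ i → degree (Subgraph.F S′) i ≤ 16 * Y) × 0 < card (Subgraph.V S′) ×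
           λ₀ * card (Subgraph.V S′) ≤ volume (Subgraph.F S′))

  0<E : 0 < E
  0<E = ≤-trans (≤-trans (*-mono-≤ 0<λ₀ 0<V) (m≤n*m _ 16)) dense

  x≤Y : x ≤ Y
  x≤Y = ≤-trans (m≤m+n x (x + 0)) (m≤n+m (2 * x) (x * x))

  quarter : ∀ k y z → 16 * y ≤ z → z ≤ 4 * k → 4 * y ≤ k
  quarter k y z h₁ h₂ = linear 3 0 (h₁ ⊕ h₂) (algebra k y z)
    where
    algebra : ∀ k y z → 4 * (4 * y) + (z + 4 * k) + 0 ≡ 4 * k + (16 * y + z)
    algebra = solve-∀

  V-few : ∀ {k} → E ≤ 4 * k → 4 * (λ₀ * card V) ≤ k
  V-few {k} = quarter k (λ₀ * card V) E dense

  high-few′ : ∀ {k} → E ≤ 4 * k → 4 * (Y * card high) ≤ k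
  high-few′ {k} = quarter k (Y * card high) E (≤-trans (≤-reflexive (Eq.sym (*-assoc 16 Y (card high)))) high-few)

  cases : E ≤ 4 * volume (inner F low) ⊎ E ≤ 4 * volume (inner F high) ⊎ E ≤ 4 * cut F low high → Goal
  cases (inj₁ low-dense) = inj₂ (restrict S low , low-degree-inner , inner-inhabited F low (positive-part 0<E low-dense) ,
    ≤-trans (λ₀ ⊗ low≤V) (≤-trans (m≤n*m _ 4) (V-few low-dense)))
  cases (inj₂ (inj₁ high-dense)) = inj₁ (S′ , identity-on high , proj₁ (identity-branchSets S′) ,
    label-inhabited (inner F high) (identity-on high) (≤-trans (positive-part 0<E high-dense) (identity-volume S′)) , (begin
      x * card (label (identity-on high)) ≤⟨ *-mono-≤ x≤Y (identity-labels high) ⟩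
      Y * card high                       ≤⟨ m≤n*m _ 4 ⟩
      4 * (Y * card high)                 ≤⟨ high-few′ high-dense ⟩
      volume (inner F high)               ≤⟨ identity-volume S′ ⟩
      volume (quotient (inner F high) (identity-on high)) ∎))
    where S′ = restrict S high
  cases (inj₂ (inj₂ cut-dense)) = peeled (Peel.peel F λ₀ Y low high excess)
    where
    excess : λ₀ * card low + Y * card high < cut F low high
    excess = half-sum (λ₀ * card low) (Y * card high) (cut F low high)
               (≤-trans (4 ⊗ λ₀ ⊗ low≤V) (V-few cut-dense)) (high-few′ cut-dense) (positive-part 0<E cut-dense)
      where
      half-sum : ∀ p r k → 4 * p ≤ k → 4 * r ≤ k → 0 < k → p + r < k
      half-sum p r k h₁ h₂ 0<k = *-cancelˡ-< 4 _ _ (begin-strict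
        4 * (p + r)      ≡⟨ *-distribˡ-+ 4 p r ⟩
        4 * p + 4 * r    ≤⟨ h₁ ⊕ h₂ ⟩
        k + k            <⟨ m<m+n (k + k) (≤-trans 0<k (m≤m+n k (k + 0))) ⟩
        k + k + 2 * k    ≡⟨ four k ⟩
        4 * k            ∎)
        where
        four : ∀ k → k + k + 2 * k ≡ 4 * k
        four = solve-∀
    peeled : (Σ (Subset n) λ P → Σ (Subset n) λ Q →
         (∀ i → P i ≡ true → low i ≡ true) × (∀ i → Q i ≡ true → high i ≡ true) × 0 < cut F P Q ×
         (∀ a → P a ≡ true → λ₀ ≤ card (λ b → Q b ∧ F a b)) × (∀ b → Q b ≡ true → Y ≤ card (λ a → P a ∧ F a b))) → Goal
    peeled (P , Q , P⊆ , Q⊆ , 0<cut , P-degree , Q-degree) with sum-positive (λ i → sum (λ j → ⟦ P i ∧ Q j ∧ F i j ⟧)) 0<cut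
    ... | i , 0<row with card-inhabited (λ j → P i ∧ Q j ∧ F i j) 0<row
    ... | j , p with Hubs.hub-alternative S P Q (λ i Pi Qi → low-high i (P⊆ i Pi) (Q⊆ i Qi)) λ₀ x P-degree Q-degree j (proj₁ (∧-elim {Q j} (proj₂ (∧-elim {P i} p))))
    ...   | inj₁ minor = inj₁ minor
    ...   | inj₂ (S′ , S′≤ , 0<V′ , dense′) = inj₂ (S′ , (λ i → ≤-trans (S′≤ i) (≤-trans (m≤n+m (2 * x) (x * x)) (m≤n*m Y 16))) , 0<V′ , dense′)

-- Edge counts as volumes

count-++ : ∀ {A : Set} (p : A → Bool) xs ys → count p (xs ++ ys) ≡ count p xs + count p ys
count-++ p []       ys = refl
count-++ p (x ∷ xs) ys with p x
... | true  = cong suc (count-++ p xs ys)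
... | false = count-++ p xs ys

count-map : ∀ {A B : Set} (p : B → Bool) (f : A → B) xs → count p (map f xs) ≡ count (p ∘ f) xs
count-map p f []       = refl
count-map p f (x ∷ xs) with p (f x)
... | true  = cong suc (count-map p f xs)
... | false = count-map p f xs

count-tabulate : ∀ {A : Set} {n} (p : A → Bool) (f : Fin n → A) → count p (tabulate f) ≡ sum (λ i → ⟦ p (f i) ⟧)
count-tabulate {n = zero}  p f = refl
count-tabulate {n = suc n} p f with p (f zero)
... | true  = cong suc (count-tabulate p (f ∘ suc))
... | false = count-tabulate p (f ∘ suc)

count-concatMap : ∀ {A B : Set} {n} (p : B → Bool) (g : A → List B) (f : Fin n → A) →
                  count p (concatMap g (tabulate f)) ≡ sum (λ i → count p (g (f i)))
count-concatMap {n = zero}  p g f = refl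
count-concatMap {n = suc n} p g f =
  trans (count-++ p (g (f zero)) _) (cong (count p (g (f zero)) +_) (count-concatMap p g (f ∘ suc)))

count-pairs : ∀ n (p : Fin n × Fin n → Bool) → count p (pairs n) ≡ sum (λ i → sum (λ j → ⟦ p (i , j) ⟧))
count-pairs n p = trans (count-concatMap p (λ i → map (λ j → (i , j)) (allFin n)) (λ i → i))
  (sum-cong-≗ (λ i → trans (count-map p (λ j → (i , j)) (allFin n)) (count-tabulate (λ j → p (i , j)) (λ j → j))))

edges-volume : ∀ {n} (G : Graph n) → 2 * edges G ≡ volume (adj G)
edges-volume {n} G = begin
  2 * edges G                                          ≡⟨ cong (2 *_) (count-pairs n _) ⟩
  2 * sum (λ i → sum (λ j → c i j))                    ≡⟨ cong (C +_) (+-identityʳ C) ⟩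
  C + C                                                ≡⟨ cong (C +_) (∑-comm c) ⟩
  C + sum (λ i → sum (λ j → c j i))                    ≡⟨ Eq.sym (sum₂-+ c (λ i j → c j i)) ⟩
  sum (λ i → sum (λ j → c i j + c j i))                ≡⟨ sum-cong-≗ (λ i → sum-cong-≗ (pointwise i)) ⟩
  volume (adj G)                                       ∎
  where
  open Eq.≡-Reasoning
  c : Fin n → Fin n → ℕ
  c i j = ⟦ (toℕ i <ᵇ toℕ j) ∧ adj G i j ⟧
  C = sum (λ i → sum (λ j → c i j))
  <ᵇ-true : ∀ {a b} → a < b → (a <ᵇ b) ≡ true
  <ᵇ-true {a} {b} = dec-true (a <? b)
  <ᵇ-false : ∀ {a b} → ¬ a < b → (a <ᵇ b) ≡ false
  <ᵇ-false {a} {b} = dec-false (a <? b)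
  pointwise : ∀ i j → c i j + c j i ≡ ⟦ adj G i j ⟧
  pointwise i j with <-cmp (toℕ i) (toℕ j)
  ... | tri< lt _ ¬gt rewrite <ᵇ-true lt | <ᵇ-false ¬gt = +-identityʳ _
  ... | tri> ¬lt _ gt rewrite <ᵇ-true gt | <ᵇ-false ¬lt = cong ⟦_⟧ (Graph.sym G j i)
  ... | tri≈ ¬lt eq ¬gt rewrite <ᵇ-false ¬lt | <ᵇ-false ¬gt with toℕ-injective eq
  ...   | refl = cong ⟦_⟧ (Eq.sym (irrefl G i))

-- Relabelling a subset by an initial segment

record Enumeration {n : ℕ} (P : Subset n) (m : ℕ) : Set where
  field
    element    : Fin m → Fin n
    member     : ∀ i → P (element i) ≡ true
    injective  : ∀ {i j} → element i ≡ element j → i ≡ j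
    surjective : ∀ x → P x ≡ true → ∃ λ i → element i ≡ x
    sum-over   : ∀ f → sum (f ∘ element) ≡ sum (λ x → ⟦ P x ⟧ * f x)
    size-is    : m ≡ card P

enumerate : ∀ {n} (P : Subset n) → Σ ℕ (Enumeration P)
enumerate {zero}  P = 0 , record
  { element = λ () ; member = λ () ; injective = λ {} ; surjective = λ () ; sum-over = λ _ → refl ; size-is = refl }
enumerate {suc n} P with enumerate (P ∘ suc) | P zero in P0
... | m , E | true = suc m , record
  { element    = element′
  ; member     = λ { zero → P0 ; (suc i) → member i }
  ; injective  = λ { {zero} {zero} _ → refl ; {suc i} {suc j} eq → cong suc (injective (suc-injective eq)) }
  ; surjective = λ { zero _ → zero , refl ; (suc x) Px → let (i , eq) = surjective x Px in suc i , cong suc eq }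
  ; sum-over   = λ f → cong₂ _+_ (Eq.sym (trans (cong (λ b → ⟦ b ⟧ * f zero) P0) (*-identityˡ (f zero)))) (sum-over (f ∘ suc))
  ; size-is    = cong₂ _+_ (Eq.sym (⟦⟧-true P0)) size-is
  }
  where
  open Enumeration E
  element′ : Fin (suc m) → Fin (suc n)
  element′ zero    = zero
  element′ (suc i) = suc (element i)
... | m , E | false = m , record
  { element    = suc ∘ element
  ; member     = member
  ; injective  = injective ∘ suc-injective
  ; surjective = λ { zero P0′ → case trans (Eq.sym P0) P0′ of (λ ()) ; (suc x) Px → let (i , eq) = surjective x Px in i , cong suc eq }
  ; sum-over   = λ f → trans (sum-over (f ∘ suc)) (cong (λ b → ⟦ b ⟧ * f zero + sum (λ x → ⟦ P (suc x) ⟧ * f (suc x))) (Eq.sym P0))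
  ; size-is    = trans size-is (cong (λ b → ⟦ b ⟧ + card (P ∘ suc)) (Eq.sym P0))
  }
  where open Enumeration E

module Induced {n : ℕ} (R : Relation n) (R-sym : Symmetric R) (R-irrefl : ∀ x → R x x ≢ true)
               {P : Subset n} {m : ℕ} (E : Enumeration P m) where
  open Enumeration E

  graph : Graph m
  graph = record
    { adj    = λ i j → R (element i) (element j)
    ; sym    = λ i j → ≡-by-⇔ (R-sym (element i) (element j)) (R-sym (element j) (element i))
    ; irrefl = λ i → ≢true⇒false (R-irrefl (element i))
    }

  volume-graph : volume (adj graph) ≡ volume (inner R P)
  volume-graph = begin
    sum (λ i → sum (λ j → ⟦ R (element i) (element j) ⟧))        ≡⟨ sum-cong-≗ (λ i → sum-over (λ y → ⟦ R (element i) y ⟧)) ⟩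
    sum (λ i → sum (λ y → ⟦ P y ⟧ * ⟦ R (element i) y ⟧))        ≡⟨ sum-over (λ x → sum (λ y → ⟦ P y ⟧ * ⟦ R x y ⟧)) ⟩
    sum (λ x → ⟦ P x ⟧ * sum (λ y → ⟦ P y ⟧ * ⟦ R x y ⟧))        ≡⟨ sum-cong-≗ (λ x → cong (⟦ P x ⟧ *_) (sum-cong-≗ (λ y → Eq.sym (⟦⟧-∧ (P y) (R x y))))) ⟩
    sum (λ x → ⟦ P x ⟧ * sum (λ y → ⟦ P y ∧ R x y ⟧))            ≡⟨ sum-cong-≗ (λ x → Eq.sym (sum-⟦∧⟧ (P x) (λ y → P y ∧ R x y))) ⟩
    volume (inner R P)                                           ∎
    where open Eq.≡-Reasoning

minor-of-labelling : ∀ {n} (G : Graph n) x → DenseMinor G x →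
                     Σ ℕ λ m → Σ (Graph m) λ J → 0 < m × MinorOf J G × x * m ≤ 2 * edges J
minor-of-labelling {n} G x (S , β , model , 0<labels , dense) with enumerate (label β)
... | m , E = m , J , ≤-trans 0<labels (≤-reflexive (Eq.sym size-is)) , (β′ , nonempty , connected , realised) , (begin
    x * m                       ≡⟨ cong (x *_) size-is ⟩
    x * card (label β)          ≤⟨ dense ⟩
    volume q                    ≤⟨ sum₂-mono (λ a b → ⟦⟧-mono (λ p → ∧-intro (quotient-labelˡ F β p) (∧-intro (quotient-labelˡ F β (quotient-sym F β F-sym a b p)) p))) ⟩
    volume (inner q (label β))  ≡⟨ Eq.sym (Induced.volume-graph q q-sym q-irrefl E) ⟩
    volume (adj J)              ≡⟨ Eq.sym (edges-volume J) ⟩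
    2 * edges J                 ∎)
  where
  open Subgraph S
  open Enumeration E
  open ≤-Reasoning
  q = quotient F β
  q-sym : Symmetric q
  q-sym = quotient-sym F β F-sym
  q-irrefl : ∀ a → q a a ≢ true
  q-irrefl a p = proj₁ (quotient-elim F β p) refl
  J = Induced.graph q q-sym q-irrefl E

  index : Maybe (Fin n) → Maybe (Fin m)
  index nothing  = nothing
  index (just y) with any? (λ i → element i ≟ y)
  ... | yes (i , _) = just i
  ... | no _        = nothing

  β′ : Fin n → Maybe (Fin m)
  β′ u = index (β u)

  β′-intro : ∀ {u i} → β u ≡ just (element i) → β′ u ≡ just i
  β′-intro {u} {i} βu rewrite βu with any? (λ j → element j ≟ element i)
  ... | yes (j , eq) = cong just (injective eq)
  ... | no none      = ⊥-elim (none (i , refl))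

  β′-elim : ∀ {u i} → β′ u ≡ just i → β u ≡ just (element i)
  β′-elim {u} p with β u
  ... | just y with any? (λ i → element i ≟ y) | p
  ...   | yes (j , refl) | refl = refl

  nonempty : ∀ i → ∃ λ u → β′ u ≡ just i
  nonempty i = let (u , βu) = label-elim β (member i) in u , β′-intro βu

  connected : ∀ i u v → β′ u ≡ just i → β′ v ≡ just i → WalkIn G (λ w → β′ w ≡ just i) u v
  connected i u v p r = walk-map (λ w → β′-intro) (model (element i) u v (β′-elim p) (β′-elim r))

  realised : ∀ i j → adj J i j ≡ true → ∃ λ u → ∃ λ v → β′ u ≡ just i × β′ v ≡ just j × adj G u v ≡ true
  realised i j p = let (_ , u , v , βu , βv , Fuv) = quotient-elim F β p in u , v , β′-intro βu , β′-intro βv , F⊆G u v Fuv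

-- Sparsity of H-free graphs

^-distribʳ-* : ∀ q a b → (a * b) ^ q ≡ a ^ q * b ^ q
^-distribʳ-* zero    a b = refl
^-distribʳ-* (suc q) a b = trans (cong (a * b *_) (^-distribʳ-* q a b)) ([m*n]*[o*p]≡[m*o]*[n*p] a b (a ^ q) (b ^ q))

^-cancelʳ-≤ : ∀ {a b} v → 0 < v → a ^ v ≤ b ^ v → a ≤ b
^-cancelʳ-≤ v 0<v h = ≮⇒≥ λ b<a → <⇒≱ (^-monoˡ-< v {{>-nonZero 0<v}} b<a) h

gamma-bound : ∀ {k} (H : Graph k) p q → GammaBelow H p q → Σ ℕ λ N → ∀ m → N ≤ m → ExPowAtMost H m p q
-- Starting at `suc N` makes `m` positive, so that raising the exponent from `u * q` to `p * v` is
-- monotone.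
gamma-bound H p q (u , v , 0<v , uq<pv , N , bound) = suc N , λ m N<m G free →
  ^-cancelʳ-≤ v 0<v (begin
    (edges G ^ q) ^ v ≡⟨ ^-*-assoc (edges G) q v ⟩
    edges G ^ (q * v) ≡⟨ cong (edges G ^_) (*-comm q v) ⟩
    edges G ^ (v * q) ≡⟨ Eq.sym (^-*-assoc (edges G) v q) ⟩
    (edges G ^ v) ^ q ≤⟨ ^-monoˡ-≤ q (bound m (<⇒≤ N<m) G free) ⟩
    (m ^ u) ^ q       ≡⟨ ^-*-assoc m u q ⟩
    m ^ (u * q)       ≤⟨ ^-monoʳ-≤ m {{>-nonZero (≤-trans (s≤s z≤n) N<m)}} (<⇒≤ uq<pv) ⟩
    m ^ (p * v)       ≡⟨ Eq.sym (^-*-assoc m p v) ⟩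
    (m ^ p) ^ v       ∎)
  where open ≤-Reasoning

free-sparse : ∀ {k n} (H : Graph k) (G : Graph n) p q N → (∀ m → N ≤ m → ExPowAtMost H m p q) → Free H G →
              ∀ X → N ≤ card X → volume (inner (adj G) X) ^ q ≤ 2 ^ q * card X ^ p
free-sparse H G p q N bound free X N≤X with enumerate X
... | m , E = begin
    volume (inner (adj G) X) ^ q ≡⟨ cong (_^ q) (trans (Eq.sym (Induced.volume-graph (adj G) G-sym G-irrefl E)) (Eq.sym (edges-volume G′))) ⟩
    (2 * edges G′) ^ q           ≡⟨ ^-distribʳ-* q 2 (edges G′) ⟩
    2 ^ q * edges G′ ^ q         ≤⟨ 2 ^ q ⊗ bound m (≤-trans N≤X (≤-reflexive (Eq.sym size-is))) G′ free′ ⟩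
    2 ^ q * m ^ p                ≡⟨ cong (λ w → 2 ^ q * w ^ p) size-is ⟩
    2 ^ q * card X ^ p           ∎
  where
  open Enumeration E
  open ≤-Reasoning
  G-sym : Symmetric (adj G)
  G-sym i j = trans (Graph.sym G j i)
  G-irrefl : ∀ i → adj G i i ≢ true
  G-irrefl i p = case trans (Eq.sym p) (irrefl G i) of λ ()
  G′ = Induced.graph (adj G) G-sym G-irrefl E
  free′ : Free H G′
  free′ (f , f-inj , f-adj) = free (element ∘ f , (λ eq → f-inj (injective eq)) , f-adj)

volume-inner-≤ : ∀ {n} (F : Relation n) X → volume (inner F X) ≤ card X * card X
volume-inner-≤ F X = begin
  sum (λ i → sum (λ j → ⟦ X i ∧ X j ∧ F i j ⟧)) ≡⟨ sum-cong-≗ (λ i → sum-⟦∧⟧ (X i) (λ j → X j ∧ F i j)) ⟩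
  sum (λ i → ⟦ X i ⟧ * card (λ j → X j ∧ F i j)) ≤⟨ sum-bound (λ i _ → card-mono {P = λ j → X j ∧ F i j} {X} (λ j p → proj₁ (∧-elim p))) ⟩
  card X * card X                                ∎
  where open ≤-Reasoning

-- Dense minors of locally sparse graphs

card-full : ∀ n → card {n} (λ _ → true) ≡ n
card-full zero    = refl
card-full (suc n) = cong suc (card-full n)

whole : ∀ {n} (G : Graph n) → Subgraph G
whole G = record
  { V     = λ _ → true
  ; F     = adj G
  ; F⊆G   = λ _ _ p → p
  ; F-sym = λ i j → trans (Graph.sym G j i)
  ; F⊆V   = λ _ _ _ → refl
  }

-- The only form in which `H`-freeness enters the rounds. In round `r` degrees are at most ρδ and
-- branch sets at most ρ^(r+2), so a dense spot has at most δρ^(5+2r) vertices.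
LocallySparse : ∀ {n} → Graph n → (ρ δ₀ N : ℕ) → Set
LocallySparse G ρ δ₀ N = ∀ δ → δ₀ ≤ δ → ∀ r → r < N → ∀ X → card X ≤ δ * ρ ^ (5 + 2 * r) →
                         volume (inner (adj G) X) < ρ ^ r * δ * (ρ ^ r * δ)

-- In ρ = R³, the factor R² covers the irregularity left by `regularise`, and the third R exceeds
-- 2C, where C collects the constants lost over the rounds.
module Core {n : ℕ} (G : Graph n) (0<n : 0 < n) (R K c N x δ₀ C : ℕ)
            (ρ≡ : suc K ≡ R * R * R) (0<δ₀ : 0 < δ₀) (C≤R : 2 * C < R) (C-large : 4 * (32 * 2 ^ N * 2) ≤ C)
            (x-small : 16 * (x * x + 2 * x) ≤ R ^ c)
            (dense : 16 * (8 ^ c * (C * δ₀) * n) ≤ volume (adj G))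
            (sparse : LocallySparse G (suc K) δ₀ N) where
  open ≤-Reasoning
  ρ = suc K

  0<R : 0 < R
  0<R = ≤-trans (s≤s z≤n) C≤R

  0<C : 0 < C
  0<C = ≤-trans (*-mono-≤ (s≤s {0} {3} z≤n) (*-mono-≤ (*-mono-≤ (s≤s {0} {31} z≤n) (m^n>0 2 N)) (s≤s {0} {1} z≤n))) C-large

  0<Cδ₀ : 0 < C * δ₀
  0<Cδ₀ = *-mono-≤ 0<C 0<δ₀

  regular : (S : Subgraph G) (δ′ : ℕ) → 0 < card (Subgraph.V S) → C * δ₀ ≤ δ′ →
            δ′ * card (Subgraph.V S) ≤ 4 * volume (Subgraph.F S) →
            (∀ i → degree (Subgraph.F S) i ≤ R * R * δ′) → DenseMinor G (δ₀ * ρ ^ N)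
  regular S δ′ 0<V δ₀≤ dense′ F≤ = conclude (dense-minor 0<V (≤-trans 0<δ₀ δ₀≤δ))
    where
    open Subgraph S
    instance
      C≢0 : NonZero C
      C≢0 = >-nonZero 0<C
    -- `C` is at least 4 times the coefficient of `δ` in `A`; the 4 is the one in `dense′`. Rounding
    -- down loses at most a factor 2, because the quotient is at least `δ₀`, which is positive.
    δ = δ′ / C
    A = 32 * 2 ^ N * δ * 2
    ν = card V
    Cδ≤δ′ : C * δ ≤ δ′
    Cδ≤δ′ = ≤-trans (≤-reflexive (*-comm C δ)) (m/n*n≤m δ′ C)
    δ₀≤δ : δ₀ ≤ δ
    δ₀≤δ = ≤-trans (≤-reflexive (Eq.sym (m*n/n≡m δ₀ C))) (/-monoˡ-≤ C (≤-trans (≤-reflexive (*-comm δ₀ C)) δ₀≤))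
    δ′≤2Cδ : δ′ ≤ 2 * C * δ
    δ′≤2Cδ = begin
      δ′                  ≡⟨ m≡m%n+[m/n]*n δ′ C ⟩
      δ′ % C + δ * C      ≤⟨ +-monoˡ-≤ (δ * C) (≤-trans (<⇒≤ (m%n<n δ′ C)) (m≤n*m C δ {{>-nonZero (≤-trans 0<δ₀ δ₀≤δ)}})) ⟩
      δ * C + δ * C       ≡⟨ rearrange δ C ⟩
      2 * C * δ           ∎
      where
      rearrange : ∀ δ C → δ * C + δ * C ≡ 2 * C * δ
      rearrange = solve-∀

    Δ-bound : R * R * δ′ ≤ K * δ
    Δ-bound = begin
      R * R * δ′           ≤⟨ (R * R) ⊗ δ′≤2Cδ ⟩
      R * R * (2 * C * δ)  ≡⟨ Eq.sym (*-assoc (R * R) (2 * C) δ) ⟩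
      R * R * (2 * C) * δ  ≤⟨ *-monoˡ-≤ δ (≤-pred small) ⟩
      K * δ                ∎
      where
      small : suc (R * R * (2 * C)) ≤ suc K
      small = begin
        suc (R * R * (2 * C))       ≤⟨ +-monoˡ-≤ (R * R * (2 * C)) (*-mono-≤ 0<R 0<R) ⟩
        R * R + R * R * (2 * C)     ≡⟨ Eq.sym (*-suc (R * R) (2 * C)) ⟩
        R * R * suc (2 * C)         ≤⟨ (R * R) ⊗ C≤R ⟩
        R * R * R                   ≡⟨ Eq.sym ρ≡ ⟩
        suc K                       ∎

    Δ-small : 8 * (R * R * δ′) * 2 ^ N ≤ K * A
    Δ-small = begin
      8 * (R * R * δ′) * 2 ^ N  ≤⟨ *-monoˡ-≤ (2 ^ N) (8 ⊗ Δ-bound) ⟩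
      8 * (K * δ) * 2 ^ N       ≤⟨ *-monoˡ-≤ (2 ^ N) (*-monoˡ-≤ (K * δ) (m≤m+n 8 24)) ⟩
      32 * (K * δ) * 2 ^ N      ≤⟨ m≤m*n _ 2 ⟩
      32 * (K * δ) * 2 ^ N * 2  ≡⟨ rearrange 32 K δ (2 ^ N) 2 ⟩
      K * A                     ∎
      where
      rearrange : ∀ a K δ t b → a * (K * δ) * t * b ≡ K * (a * t * δ * b)
      rearrange = solve-∀

    dense″ : ν * A ≤ volume F
    dense″ = *-cancelˡ-≤ 4 (begin
      4 * (ν * A)                       ≡⟨ rearrange 4 32 2 ν (2 ^ N) δ ⟩
      4 * (32 * 2 ^ N * 2) * δ * ν      ≤⟨ *-monoˡ-≤ ν (*-monoˡ-≤ δ C-large) ⟩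
      C * δ * ν                         ≤⟨ *-monoˡ-≤ ν Cδ≤δ′ ⟩
      δ′ * ν                            ≤⟨ dense′ ⟩
      4 * volume F                      ∎)
      where
      rearrange : ∀ a b c ν t δ → a * (ν * (b * t * δ * c)) ≡ a * (b * t * c) * δ * ν
      rearrange = solve-∀

    sparse′ : ∀ r → r < N → ∀ X → card X ≤ R * R * δ′ * (ρ * ρ ^ suc r * (ρ * ρ ^ suc r)) →
              volume (inner F X) < ρ ^ r * δ * (ρ ^ r * δ)
    sparse′ r r<N X X≤ = ≤-trans (s≤s (sum₂-mono (λ i j → ⟦⟧-mono (λ p →
        let (Xi , Xj , Fij) = inner-elim F X {i} {j} p in ∧-intro Xi (∧-intro Xj (F⊆G i j Fij)))))) (sparse δ δ₀≤δ r r<N X (begin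
      card X                                           ≤⟨ X≤ ⟩
      R * R * δ′ * (ρ * ρ ^ suc r * (ρ * ρ ^ suc r))   ≤⟨ *-monoˡ-≤ _ (≤-trans Δ-bound (*-monoˡ-≤ δ (n≤1+n K))) ⟩
      ρ * δ * (ρ * ρ ^ suc r * (ρ * ρ ^ suc r))        ≡⟨ rearrange ρ δ (ρ ^ r) ⟩
      δ * (ρ * (ρ * (ρ * (ρ * (ρ * (ρ ^ r * ρ ^ r))))))  ≡⟨ cong (λ w → δ * (ρ * (ρ * (ρ * (ρ * (ρ * w)))))) (trans (Eq.sym (^-distribˡ-+-* ρ r r)) (cong (λ w → ρ ^ (r + w)) (Eq.sym (+-identityʳ r)))) ⟩
      δ * ρ ^ (5 + 2 * r)                              ∎))
      where
      rearrange : ∀ ρ δ t → ρ * δ * (ρ * (ρ * t) * (ρ * (ρ * t))) ≡ δ * (ρ * (ρ * (ρ * (ρ * (ρ * (t * t))))))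
      rearrange = solve-∀

    0<K : 0 < K
    0<K = ≤-pred (≤-trans (≤-trans (s≤s (≤-trans 0<C (m≤n*m C 2))) C≤R)
            (≤-trans (m≤n*m R (R * R) {{>-nonZero (*-mono-≤ 0<R 0<R)}}) (≤-reflexive (Eq.sym ρ≡))))

    open Rounds G S (R * R * δ′) F≤ K N δ A 0<K ≤-refl Δ-small sparse′ dense″ using (dense-minor)

    conclude : (Σ (Labelling n) λ β → Model G β × 0 < card (label β) × δ * ρ ^ N * card (label β) ≤ volume (quotient F β)) →
               DenseMinor G (δ₀ * ρ ^ N)
    conclude (β , model , 0<labels , bound) =
      S , β , model , 0<labels , ≤-trans (*-monoˡ-≤ (card (label β)) (*-monoˡ-≤ (ρ ^ N) δ₀≤δ)) bound

  minor : DenseMinor G x ⊎ DenseMinor G (δ₀ * ρ ^ N)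
  minor = cases (bound-degrees (whole G) (8 ^ c * (C * δ₀)) x (*-mono-≤ (m^n>0 8 c) 0<Cδ₀)
                  (≤-trans 0<n (≤-reflexive (Eq.sym (card-full n))))
                  (≤-trans (≤-reflexive (cong (λ w → 16 * (8 ^ c * (C * δ₀) * w)) (card-full n))) dense))
    where
    cases : DenseMinor G x ⊎ (Σ (Subgraph G) λ S → (∀ i → degree (Subgraph.F S) i ≤ 16 * (x * x + 2 * x)) ×
              0 < card (Subgraph.V S) × 8 ^ c * (C * δ₀) * card (Subgraph.V S) ≤ volume (Subgraph.F S)) →
            DenseMinor G x ⊎ DenseMinor G (δ₀ * ρ ^ N)
    cases (inj₁ minor) = inj₁ minor
    cases (inj₂ (S , S≤ , 0<V , dense₁)) =
      let (S′ , δ′ , 0<V′ , δ₀≤ , dense′ , F≤) = regularise R 0<R c (C * δ₀) 0<Cδ₀ S 0<V (λ i → ≤-trans (S≤ i) x-small) dense₁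
      in inj₂ (regular S′ δ′ 0<V′ δ₀≤ dense′ F≤)

-- With p = 2s + w and q = s + w, a dense spot would have more than |X| ^ (p / q) edges.
free-locally-sparse : ∀ {k n} (H : Graph k) (G : Graph n) s w N₀ → (∀ m → N₀ ≤ m → ExPowAtMost H m (2 * s + w) (s + w)) → Free H G →
  ∀ ρ δ₀ N M → N₀ ≤ δ₀ → ρ ^ M ≤ δ₀ → 2 ^ (s + w) < ρ → 2 * (s * N) + 5 * (2 * s + w) + 1 ≤ M * w →
  LocallySparse G ρ δ₀ N
free-locally-sparse H G s w N₀ bound free ρ δ₀ N M N₀≤δ₀ ρ^M≤δ₀ 2^q<ρ exponents δ δ₀≤δ r r<N X X≤ = ≰⇒> contradictory
  where
  open ≤-Reasoning
  p = 2 * s + w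
  q = s + w
  b = ρ ^ r * δ
  base = δ * ρ ^ (5 + 2 * r)
  0<ρ : 0 < ρ
  0<ρ = ≤-trans (s≤s z≤n) 2^q<ρ
  instance
    ρ≢0 : NonZero ρ
    ρ≢0 = >-nonZero 0<ρ
  0<δ : 0 < δ
  0<δ = ≤-trans (≤-trans (m^n>0 ρ M) ρ^M≤δ₀) δ₀≤δ
  0<base : 0 < base ^ p
  0<base = m^n>0 base {{>-nonZero (*-mono-≤ 0<δ (m^n>0 ρ (5 + 2 * r)))}} p

  -- Comparing δ^(2q) with δ^p leaves a surplus δ^w, worth at least ρ^(Mw). It pays for 2r(p - q) =
  -- 2rs, for the overhead 5p, and for one spare ρ that beats 2^q.
  exponents′ : (5 + 2 * r) * p + 1 ≤ 2 * r * q + M * w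
  exponents′ = linear 0 0 (exponents ⊕ 2 ⊗ s ⊗ <⇒≤ r<N) (algebra r s w M N)
    where
    algebra : ∀ r s w M N → 1 * ((5 + 2 * r) * (2 * s + w) + 1) + (M * w + 2 * (s * N)) + 0 ≡
                            1 * (2 * r * (s + w) + M * w) + (2 * (s * N) + 5 * (2 * s + w) + 1 + 2 * (s * r))
    algebra = solve-∀

  large : ρ * base ^ p ≤ (b * b) ^ q
  large = begin
    ρ * (δ * ρ ^ (5 + 2 * r)) ^ p               ≡⟨ cong (ρ *_) (trans (^-distribʳ-* p δ (ρ ^ (5 + 2 * r))) (cong (δ ^ p *_) (^-*-assoc ρ (5 + 2 * r) p))) ⟩
    ρ * (δ ^ p * ρ ^ ((5 + 2 * r) * p))         ≡⟨ rearrange ρ (δ ^ p) (ρ ^ ((5 + 2 * r) * p)) ⟩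
    δ ^ p * (ρ * ρ ^ ((5 + 2 * r) * p))         ≡⟨ cong (λ e → δ ^ p * ρ ^ e) (+-comm 1 ((5 + 2 * r) * p)) ⟩
    δ ^ p * ρ ^ ((5 + 2 * r) * p + 1)           ≤⟨ δ ^ p ⊗ ^-monoʳ-≤ ρ exponents′ ⟩
    δ ^ p * ρ ^ (2 * r * q + M * w)             ≡⟨ cong (δ ^ p *_) (trans (^-distribˡ-+-* ρ (2 * r * q) (M * w)) (cong₂ _*_ (Eq.sym (^-*-assoc ρ (2 * r) q)) (Eq.sym (^-*-assoc ρ M w)))) ⟩
    δ ^ p * ((ρ ^ (2 * r)) ^ q * (ρ ^ M) ^ w)   ≤⟨ δ ^ p ⊗ (ρ ^ (2 * r)) ^ q ⊗ ^-monoˡ-≤ w (≤-trans ρ^M≤δ₀ δ₀≤δ) ⟩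
    δ ^ p * ((ρ ^ (2 * r)) ^ q * δ ^ w)         ≡⟨ rearrange₂ (δ ^ p) ((ρ ^ (2 * r)) ^ q) (δ ^ w) ⟩
    (ρ ^ (2 * r)) ^ q * (δ ^ p * δ ^ w)         ≡⟨ cong₂ _*_ (cong (_^ q) (trans (cong (λ e → ρ ^ (r + e)) (+-identityʳ r)) (^-distribˡ-+-* ρ r r)))
                                                       (trans (Eq.sym (^-distribˡ-+-* δ p w)) (trans (cong (δ ^_) (degrees s w)) (^-distribˡ-+-* δ q q))) ⟩
    (ρ ^ r * ρ ^ r) ^ q * (δ ^ q * δ ^ q)       ≡⟨ cong ((ρ ^ r * ρ ^ r) ^ q *_) (Eq.sym (^-distribʳ-* q δ δ)) ⟩
    (ρ ^ r * ρ ^ r) ^ q * (δ * δ) ^ q           ≡⟨ Eq.sym (^-distribʳ-* q (ρ ^ r * ρ ^ r) (δ * δ)) ⟩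
    (ρ ^ r * ρ ^ r * (δ * δ)) ^ q               ≡⟨ cong (_^ q) ([m*n]*[o*p]≡[m*o]*[n*p] (ρ ^ r) (ρ ^ r) δ δ) ⟩
    (b * b) ^ q                                 ∎
    where
    rearrange : ∀ a b c → a * (b * c) ≡ b * (a * c)
    rearrange = solve-∀
    rearrange₂ : ∀ a b c → a * (b * c) ≡ b * (a * c)
    rearrange₂ = solve-∀
    degrees : ∀ s w → 2 * s + w + w ≡ s + w + (s + w)
    degrees = solve-∀

  contradictory : ¬ b * b ≤ volume (inner (adj G) X)
  contradictory b²≤ = <⇒≱ (begin-strict
    2 ^ q * card X ^ p                   ≤⟨ 2 ^ q ⊗ ^-monoˡ-≤ p X≤ ⟩
    2 ^ q * base ^ p                     <⟨ *-monoˡ-< (base ^ p) {{>-nonZero 0<base}} 2^q<ρ ⟩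
    ρ * base ^ p                         ≤⟨ large ⟩
    (b * b) ^ q                          ≤⟨ ^-monoˡ-≤ q b²≤ ⟩
    volume (inner (adj G) X) ^ q         ∎) (free-sparse H G p q N₀ bound free X N₀≤X)
    where
    -- A set with at least b² adjacent ordered pairs has at least b vertices, so it is large enough
    -- for the bound on `H`-free graphs to apply.
    b≤X : b ≤ card X
    b≤X = ≮⇒≥ λ X<b → <⇒≱ (*-mono-< X<b X<b) (≤-trans b²≤ (volume-inner-≤ (adj G) X))
    N₀≤X : N₀ ≤ card X
    N₀≤X = ≤-trans N₀≤δ₀ (≤-trans δ₀≤δ (≤-trans (m≤n*m δ (ρ ^ r) {{>-nonZero (m^n>0 ρ r)}}) b≤X))

-- Choice of the parameters

m≤m^n : ∀ m n → 0 < n → m ≤ m ^ n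
m≤m^n zero    n       _ = z≤n
m≤m^n (suc m) (suc n) _ = m≤m*n (suc m) (suc m ^ n) {{>-nonZero (m^n>0 (suc m) n)}}

root : ∀ B m d → 0 < m → B ^ m ≤ d → Σ ℕ λ R → B ≤ R × R ^ m ≤ d × d < suc R ^ m
-- Fuel `d` suffices: the power of a candidate is at least the candidate, so none above `d`
-- qualifies.
root B m d 0<m B^m≤d = go d B ≤-refl B^m≤d (m≤n+m d B)
  where
  go : ∀ k R → B ≤ R → R ^ m ≤ d → d ≤ R + k → Σ ℕ λ R → B ≤ R × R ^ m ≤ d × d < suc R ^ m
  go k R B≤R R^m≤d d≤ with suc R ^ m ≤? d
  ... | no above = R , B≤R , R^m≤d , ≰⇒> above
  go zero R B≤R R^m≤d d≤ | yes below = ⊥-elim (<⇒≱ (≤-trans (m≤m^n (suc R) m 0<m) below) (≤-trans d≤ (≤-reflexive (+-identityʳ R))))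
  go (suc k) R B≤R R^m≤d d≤ | yes below = go k (suc R) (m≤n⇒m≤1+n B≤R) below (≤-trans d≤ (≤-reflexive (+-suc R k)))

-- The density of `G` is at most d + 1 and that of the minor at least y/2; the halving is the source
-- of `2 ^ b`.
power-bound : ∀ {e n d eJ m} a b y → e ≤ suc d * n → y * m ≤ 2 * eJ → 2 ^ b * suc d ^ a ≤ y ^ b →
              e ^ a * m ^ b ≤ eJ ^ b * n ^ a
power-bound {e} {n} {d} {eJ} {m} a b y e≤ y≤ large = *-cancelˡ-≤ (2 ^ b) {{>-nonZero (m^n>0 2 b)}} (begin
  2 ^ b * (e ^ a * m ^ b)                 ≤⟨ 2 ^ b ⊗ *-monoˡ-≤ (m ^ b) (^-monoˡ-≤ a e≤) ⟩
  2 ^ b * ((suc d * n) ^ a * m ^ b)       ≡⟨ cong (λ w → 2 ^ b * (w * m ^ b)) (^-distribʳ-* a (suc d) n) ⟩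
  2 ^ b * (suc d ^ a * n ^ a * m ^ b)     ≡⟨ rearrange (2 ^ b) (suc d ^ a) (n ^ a) (m ^ b) ⟩
  2 ^ b * suc d ^ a * m ^ b * n ^ a       ≤⟨ *-monoˡ-≤ (n ^ a) (*-monoˡ-≤ (m ^ b) large) ⟩
  y ^ b * m ^ b * n ^ a                   ≡⟨ cong (_* n ^ a) (Eq.sym (^-distribʳ-* b y m)) ⟩
  (y * m) ^ b * n ^ a                     ≤⟨ *-monoˡ-≤ (n ^ a) (^-monoˡ-≤ b y≤) ⟩
  (2 * eJ) ^ b * n ^ a                    ≡⟨ cong (_* n ^ a) (^-distribʳ-* b 2 eJ) ⟩
  2 ^ b * eJ ^ b * n ^ a                  ≡⟨ *-assoc (2 ^ b) (eJ ^ b) (n ^ a) ⟩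
  2 ^ b * (eJ ^ b * n ^ a)                ∎)
  where
  open ≤-Reasoning
  rearrange : ∀ t d n m → t * (d * n * m) ≡ t * d * m * n
  rearrange = solve-∀

-- With a = b + g, p = 2s + w and q = s + w, the hypothesis 2a(p − q) < bp becomes `room`.
-- All sizes are powers of R ≈ d^(1/(3M+1)), where d is the density of G: a round multiplies the sizes of branch sets
-- by ρ = R³, N rounds reach the target density (`target`), and none of them meets a dense spot (`exponents`).
module Parameters {k : ℕ} (H : Graph k) (g b s w N₀ : ℕ) (0<b : 0 < b)
                  (bound : ∀ m → N₀ ≤ m → ExPowAtMost H m (2 * s + w) (s + w))
                  (room : 2 * (g * s) + 1 ≤ b * w) where
  -- δ₀ = ρ^M is the density to start from, and ρ^N the gain. Taking M = bM₀ and N = gM₀ would give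
  -- (M + N)/M = a/b exactly; `a` further rounds make up for constants and rounding. The `+ 1` in
  -- `room`, multiplied by M₀, must cover the terms that do not scale with M₀, whence the value of
  -- M₀. The extra R in R^m₀ = R * δ₀ pays for the density lost before the rounds, and R^t bounds (d
  -- + 1)^a.
  a M₀ M N m₀ t : ℕ
  a  = b + g
  M₀ = 2 * (s * a) + 5 * (2 * s + w) + 1
  M  = b * M₀
  N  = g * M₀ + a
  m₀ = suc (3 * M)
  t  = suc m₀ * a

  0<M₀ : 0 < M₀
  0<M₀ = m≤n+m 1 (2 * (s * a) + 5 * (2 * s + w))

  exponents : 2 * (s * N) + 5 * (2 * s + w) + 1 ≤ M * w
  exponents = begin
    2 * (s * N) + 5 * (2 * s + w) + 1      ≡⟨ algebra g s a M₀ (5 * (2 * s + w)) ⟩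
    (2 * (g * s)) * M₀ + M₀                ≡⟨ algebra₂ (2 * (g * s)) M₀ ⟩
    (2 * (g * s) + 1) * M₀                 ≤⟨ *-monoˡ-≤ M₀ room ⟩
    b * w * M₀                             ≡⟨ algebra₃ b w M₀ ⟩
    M * w                                  ∎
    where
    open ≤-Reasoning
    algebra : ∀ g s a m f → 2 * (s * (g * m + a)) + f + 1 ≡ (2 * (g * s)) * m + (2 * (s * a) + f + 1)
    algebra = solve-∀
    algebra₂ : ∀ x m → x * m + m ≡ (x + 1) * m
    algebra₂ = solve-∀
    algebra₃ : ∀ b w m → b * w * m ≡ b * m * w
    algebra₃ = solve-∀

  target : b + t ≤ (3 * M + 3 * N) * b
  target = begin
    b + t                                          ≡⟨ algebra b a M ⟩
    3 * (M * a) + (2 * a + b)                      ≤⟨ +-monoʳ-≤ (3 * (M * a)) (2 ⊗ m≤n*m a b ⊕ m≤m*n b a {{>-nonZero (≤-trans 0<b (m≤m+n b g))}}) ⟩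
    3 * (M * a) + (2 * (b * a) + b * a)            ≡⟨ algebra₂ b g M₀ ⟩
    (3 * M + 3 * N) * b                            ∎
    where
    open ≤-Reasoning
    instance
      b≢0 : NonZero b
      b≢0 = >-nonZero 0<b
    algebra : ∀ b a M → b + (2 + 3 * M) * a ≡ 3 * (M * a) + (2 * a + b)
    algebra = solve-∀
    algebra₂ : ∀ b g m → 3 * (b * m * (b + g)) + (2 * (b * (b + g)) + b * (b + g)) ≡ (3 * (b * m) + 3 * (g * m + (b + g))) * b
    algebra₂ = solve-∀

  module Base (c C B : ℕ) (c≡ : c ≡ 1 + 2 * suc t) (C-large : 4 * (32 * 2 ^ N * 2) ≤ C)
              (B₁ : 16 * (8 ^ c * C) ≤ B) (B₂ : 2 ^ m₀ ≤ B) (B₃ : N₀ ≤ B) (B₄ : 2 ^ (s + w) < B)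
              (B₅ : 2 * C < B) (B₆ : 48 ≤ B) where

    module WithRoot {n : ℕ} (G : Graph n) (0<n : 0 < n) (free : Free H G) (d R : ℕ) (B≤R : B ≤ R)
                    (R^m≤d : R ^ m₀ ≤ d) (d< : d < suc R ^ m₀) (d*n≤e : d * n ≤ edges G) (e≤ : edges G ≤ suc d * n) where
      open ≤-Reasoning

      Goal : Set
      Goal = Σ ℕ λ m → Σ (Graph m) λ J → 0 < m × MinorOf J G × edges G ^ a * m ^ b ≤ edges J ^ b * n ^ a

      0<R : 0 < R
      0<R = ≤-trans (≤-trans (s≤s z≤n) B₆) B≤R
      instance
        R≢0 : NonZero R
        R≢0 = >-nonZero 0<R
      0<R³ : 0 < R * R * R
      0<R³ = *-mono-≤ (*-mono-≤ 0<R 0<R) 0<R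
      K = pred (R * R * R)
      ρ≡ : suc K ≡ R * R * R
      ρ≡ = suc-pred (R * R * R) {{>-nonZero 0<R³}}
      R≤ρ : R ≤ suc K
      R≤ρ = ≤-trans (m≤n*m R (R * R) {{>-nonZero (*-mono-≤ 0<R 0<R)}}) (≤-reflexive (Eq.sym ρ≡))
      δ₀ = R ^ (3 * M)
      -- The hubs are asked for density `R ^ t`, hence for exponent a instead of a/b. This ambitious
      -- choice affects only the constant `c`.
      x  = 2 * R ^ t

      ρ^ : ∀ j → suc K ^ j ≡ R ^ (3 * j)
      ρ^ j = trans (cong (_^ j) (trans ρ≡ (cube R))) (^-*-assoc R 3 j)
        where
        cube : ∀ R → R * R * R ≡ R * (R * (R * 1))
        cube = solve-∀

      δ₀-large : R ≤ δ₀
      δ₀-large = ≤-trans (≤-reflexive (Eq.sym (^-identityʳ R))) (^-monoʳ-≤ R (*-mono-≤ (s≤s {0} {2} z≤n) (*-mono-≤ 0<b 0<M₀)))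

      x-small : 16 * (x * x + 2 * x) ≤ R ^ c
      x-small = begin
        16 * (x * x + 2 * x)         ≤⟨ 16 ⊗ +-monoʳ-≤ (x * x) (2 ⊗ m≤m*n x x {{>-nonZero 0<x}}) ⟩
        16 * (x * x + 2 * (x * x))   ≡⟨ algebra (x * x) ⟩
        48 * (x * x)                 ≤⟨ *-mono-≤ (≤-trans B₆ B≤R) (*-mono-≤ x≤ x≤) ⟩
        R * (y * y)                  ≡⟨ cong (R *_) (Eq.sym (trans (cong (λ e → R ^ (suc t + e)) (+-identityʳ (suc t))) (^-distribˡ-+-* R (suc t) (suc t)))) ⟩
        R ^ (1 + 2 * suc t)          ≡⟨ cong (R ^_) (Eq.sym c≡) ⟩
        R ^ c                        ∎
        where
        y = R ^ suc t
        0<x : 0 < x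
        0<x = *-mono-≤ (s≤s {0} {1} z≤n) (m^n>0 R t)
        x≤ : x ≤ y
        x≤ = *-monoˡ-≤ (R ^ t) (≤-trans (≤-trans (m≤m+n 2 46) B₆) B≤R)
        algebra : ∀ z → 16 * (z + 2 * z) ≡ 48 * z
        algebra = solve-∀

      dense : 16 * (8 ^ c * (C * δ₀) * n) ≤ volume (adj G)
      dense = begin
        16 * (8 ^ c * (C * δ₀) * n)    ≡⟨ algebra 16 (8 ^ c) C δ₀ n ⟩
        16 * (8 ^ c * C) * δ₀ * n      ≤⟨ *-monoˡ-≤ n (*-monoˡ-≤ δ₀ (≤-trans B₁ B≤R)) ⟩
        R * δ₀ * n                     ≤⟨ *-monoˡ-≤ n R^m≤d ⟩
        d * n                          ≤⟨ d*n≤e ⟩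
        edges G                        ≤⟨ m≤m+n (edges G) _ ⟩
        2 * edges G                    ≡⟨ edges-volume G ⟩
        volume (adj G)                 ∎
        where
        algebra : ∀ i e C δ n → i * (e * (C * δ) * n) ≡ i * (e * C) * δ * n
        algebra = solve-∀

      d-small : suc d ^ a ≤ R ^ t
      d-small = begin
        suc d ^ a               ≤⟨ ^-monoˡ-≤ a (≤-trans d< (begin
          suc R ^ m₀              ≤⟨ ^-monoˡ-≤ m₀ (≤-trans (+-monoˡ-≤ R 0<R) (≤-reflexive (cong (R +_) (Eq.sym (+-identityʳ R))))) ⟩
          (2 * R) ^ m₀            ≡⟨ ^-distribʳ-* m₀ 2 R ⟩
          2 ^ m₀ * R ^ m₀         ≤⟨ *-monoˡ-≤ (R ^ m₀) (≤-trans B₂ B≤R) ⟩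
          R ^ suc m₀              ∎)) ⟩
        (R ^ suc m₀) ^ a        ≡⟨ ^-*-assoc R (suc m₀) a ⟩
        R ^ t                   ∎

      sparse : LocallySparse G (suc K) δ₀ N
      sparse = free-locally-sparse H G s w N₀ bound free (suc K) δ₀ N M
        (≤-trans B₃ (≤-trans B≤R δ₀-large)) (≤-reflexive (ρ^ M)) (≤-trans B₄ (≤-trans B≤R R≤ρ)) exponents

      from-minor : ∀ y → 2 ^ b * suc d ^ a ≤ y ^ b → DenseMinor G y → Goal
      from-minor y large minor =
        let (m , J , 0<m , J≤G , many) = minor-of-labelling G y minor
        in m , J , 0<m , J≤G , power-bound a b y e≤ many large

      x-large : 2 ^ b * suc d ^ a ≤ x ^ b
      x-large = begin
        2 ^ b * suc d ^ a   ≤⟨ 2 ^ b ⊗ d-small ⟩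
        2 ^ b * R ^ t       ≤⟨ 2 ^ b ⊗ m≤m^n (R ^ t) b 0<b ⟩
        2 ^ b * (R ^ t) ^ b ≡⟨ Eq.sym (^-distribʳ-* b 2 (R ^ t)) ⟩
        x ^ b               ∎

      y-large : 2 ^ b * suc d ^ a ≤ (δ₀ * suc K ^ N) ^ b
      y-large = begin
        2 ^ b * suc d ^ a              ≤⟨ *-mono-≤ (^-monoˡ-≤ b (≤-trans (≤-trans (m≤m+n 2 46) B₆) B≤R)) d-small ⟩
        R ^ b * R ^ t                  ≡⟨ Eq.sym (^-distribˡ-+-* R b t) ⟩
        R ^ (b + t)                    ≤⟨ ^-monoʳ-≤ R target ⟩
        R ^ ((3 * M + 3 * N) * b)      ≡⟨ Eq.sym (^-*-assoc R (3 * M + 3 * N) b) ⟩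
        (R ^ (3 * M + 3 * N)) ^ b      ≡⟨ cong (_^ b) (trans (^-distribˡ-+-* R (3 * M) (3 * N)) (cong (δ₀ *_) (Eq.sym (ρ^ N)))) ⟩
        (δ₀ * suc K ^ N) ^ b           ∎

      conclusion : Goal
      conclusion = cases (Core.minor G 0<n R K c N x δ₀ C ρ≡ (≤-trans 0<R δ₀-large) (≤-trans B₅ B≤R) C-large x-small dense sparse)
        where
        cases : DenseMinor G x ⊎ DenseMinor G (δ₀ * suc K ^ N) → Goal
        cases (inj₁ minor) = from-minor x x-large minor
        cases (inj₂ minor) = from-minor (δ₀ * suc K ^ N) y-large minor

    -- `d` and `R` are the integer parts of the density and of its `m₀`-th root. Density at least
    -- `B ^ m₀` forces `R` to be at least `B`, which dominates all constants.
    dense-minor : ∀ (n : ℕ) (G : Graph n) → 0 < n → Free H G → B ^ m₀ * n ≤ edges G →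
                  Σ ℕ λ m → Σ (Graph m) λ J → 0 < m × MinorOf J G × edges G ^ a * m ^ b ≤ edges J ^ b * n ^ a
    dense-minor n G 0<n free many =
      let (R , B≤R , R^m≤d , d<) = root B m₀ d (s≤s z≤n) B^m≤d
      in WithRoot.conclusion G 0<n free d R B≤R R^m≤d d< (m/n*n≤m (edges G) n) e≤
      where
      instance
        n≢0 : NonZero n
        n≢0 = >-nonZero 0<n
      d = edges G / n
      B^m≤d : B ^ m₀ ≤ d
      B^m≤d = ≤-trans (≤-reflexive (Eq.sym (m*n/n≡m (B ^ m₀) n))) (/-monoˡ-≤ n many)
      e≤ : edges G ≤ suc d * n
      e≤ = ≤-trans (≤-reflexive (m≡m%n+[m/n]*n (edges G) n)) (+-monoˡ-≤ (d * n) (<⇒≤ (m%n<n (edges G) n)))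

  conclusion : Σ ℕ λ D → ∀ (n : ℕ) (G : Graph n) → 0 < n → Free H G → D * n ≤ edges G →
               Σ ℕ λ m → Σ (Graph m) λ J → 0 < m × MinorOf J G × edges G ^ a * m ^ b ≤ edges J ^ b * n ^ a
  conclusion = choose (1 + 2 * suc t) (4 * (32 * 2 ^ N * 2)) refl ≤-refl
    where
    choose : ∀ c C → c ≡ 1 + 2 * suc t → 4 * (32 * 2 ^ N * 2) ≤ C →
             Σ ℕ λ D → ∀ (n : ℕ) (G : Graph n) → 0 < n → Free H G → D * n ≤ edges G →
             Σ ℕ λ m → Σ (Graph m) λ J → 0 < m × MinorOf J G × edges G ^ a * m ^ b ≤ edges J ^ b * n ^ a
    choose c C c≡ C-large = sums (16 * (8 ^ c * C)) (2 ^ m₀) (suc (2 ^ (s + w))) (suc (2 * C)) ≤-refl ≤-refl ≤-refl ≤-refl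
      where
      sums : ∀ u v y z → 16 * (8 ^ c * C) ≤ u → 2 ^ m₀ ≤ v → 2 ^ (s + w) < y → 2 * C < z →
             Σ ℕ λ D → ∀ (n : ℕ) (G : Graph n) → 0 < n → Free H G → D * n ≤ edges G →
             Σ ℕ λ m → Σ (Graph m) λ J → 0 < m × MinorOf J G × edges G ^ a * m ^ b ≤ edges J ^ b * n ^ a
      sums u v y z hu hv hy hz = B ^ m₀ , Base.dense-minor c C B c≡ C-large
        (≤-trans hu (≤-trans (m≤m+n u v) (≤-trans (m≤m+n _ N₀) (≤-trans (m≤m+n _ y) (≤-trans (m≤m+n _ z) (m≤m+n _ 48))))))
        (≤-trans hv (≤-trans (m≤n+m v u) (≤-trans (m≤m+n _ N₀) (≤-trans (m≤m+n _ y) (≤-trans (m≤m+n _ z) (m≤m+n _ 48))))))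
        (≤-trans (m≤n+m N₀ (u + v)) (≤-trans (m≤m+n _ y) (≤-trans (m≤m+n _ z) (m≤m+n _ 48))))
        (≤-trans hy (≤-trans (m≤n+m y (u + v + N₀)) (≤-trans (m≤m+n _ z) (m≤m+n _ 48))))
        (≤-trans hz (≤-trans (m≤n+m z (u + v + N₀ + y)) (m≤m+n _ 48)))
        (m≤n+m 48 (u + v + N₀ + y + z))
        where B = u + v + N₀ + y + z + 48

-- The theorem for rational exponents

trivial-minor : ∀ {n} (G : Graph n) → MinorOf G G
trivial-minor G = just , (λ x → x , refl) , (λ { x .x .x refl refl → here refl }) , (λ x y p → x , y , refl , refl , p)

-- The function t/(2(t - 1)) is continuous and decreasing for t > 1, so a rational a/b lies below
-- γ/(2(γ - 1)) exactly when it lies below p/(2(p - q)) for some rational p/q above γ. The error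
-- term o(1) becomes the threshold `D`, chosen after a/b, beyond which the minor has density at
-- least d(G)^(a/b).
theorem5p3 : ∀ (k : ℕ) (H : Graph k) → Bipartite H → GammaAbove H 1 1 →
    ∀ (a b : ℕ) → 0 < b →
    ∀ (p q : ℕ) → 0 < q → q < p → GammaBelow H p q → 2 * a * (p ∸ q) < b * p →
    Σ ℕ λ D → ∀ (n : ℕ) (G : Graph n) → 0 < n → Free H G → D * n ≤ edges G →
    Σ ℕ λ m → Σ (Graph m) λ J →
    0 < m × MinorOf J G × edges G ^ a * m ^ b ≤ edges J ^ b * n ^ a
theorem5p3 k H _ _ a b 0<b p q 0<q q<p below room with a ≤? b
-- Exponents up to 1 are reached by `G` itself as soon as its density is at least 1.
... | yes a≤b = 1 , λ n G 0<n _ n≤e → n , G , 0<n , trivial-minor G , (begin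
    edges G ^ a * n ^ b                      ≡⟨ cong (λ e → edges G ^ a * n ^ e) (Eq.sym (m+[n∸m]≡n a≤b)) ⟩
    edges G ^ a * n ^ (a + (b ∸ a))          ≡⟨ cong (edges G ^ a *_) (^-distribˡ-+-* n a (b ∸ a)) ⟩
    edges G ^ a * (n ^ a * n ^ (b ∸ a))      ≤⟨ edges G ^ a ⊗ n ^ a ⊗ ^-monoˡ-≤ (b ∸ a) (≤-trans (≤-reflexive (Eq.sym (*-identityˡ n))) n≤e) ⟩
    edges G ^ a * (n ^ a * edges G ^ (b ∸ a)) ≡⟨ rearrange (edges G ^ a) (n ^ a) (edges G ^ (b ∸ a)) ⟩
    edges G ^ a * edges G ^ (b ∸ a) * n ^ a  ≡⟨ cong (_* n ^ a) (Eq.sym (^-distribˡ-+-* (edges G) a (b ∸ a))) ⟩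
    edges G ^ (a + (b ∸ a)) * n ^ a          ≡⟨ cong (λ e → edges G ^ e * n ^ a) (m+[n∸m]≡n a≤b) ⟩
    edges G ^ b * n ^ a                      ∎)
  where
  open ≤-Reasoning
  rearrange : ∀ x y z → x * (y * z) ≡ x * z * y
  rearrange = solve-∀
... | no a≰b = general a p q (a ∸ b) s w (m+[n∸m]≡n b≤a) p≡ q≡ (gamma-bound H p q below) room
  where
  s = p ∸ q
  w = q ∸ s
  b≤a : b ≤ a
  b≤a = <⇒≤ (≰⇒> a≰b)
  q+s≡p : q + s ≡ p
  q+s≡p = m+[n∸m]≡n (<⇒≤ q<p)
  -- Since a is at least b here, `room` forces p/q < 2, so that `w` is really 2q - p.
  s<q : s < q
  s<q = +-cancelˡ-< s s q (*-cancelˡ-< b (s + s) (s + q) (begin-strict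
    b * (s + s)    ≤⟨ *-monoˡ-≤ (s + s) b≤a ⟩
    a * (s + s)    ≡⟨ double a s ⟩
    2 * a * s      <⟨ room ⟩
    b * p          ≡⟨ cong (b *_) (trans (Eq.sym q+s≡p) (+-comm q s)) ⟩
    b * (s + q)    ∎))
    where
    open ≤-Reasoning
    double : ∀ a s → a * (s + s) ≡ 2 * a * s
    double = solve-∀
  q≡ : s + w ≡ q
  q≡ = m+[n∸m]≡n (<⇒≤ s<q)
  p≡ : 2 * s + w ≡ p
  p≡ = trans (reorder s w) (trans (cong (_+ s) q≡) q+s≡p)
    where
    reorder : ∀ s w → 2 * s + w ≡ s + w + s
    reorder = solve-∀

  general : ∀ a p q g s w → b + g ≡ a → 2 * s + w ≡ p → s + w ≡ q → (Σ ℕ λ N → ∀ m → N ≤ m → ExPowAtMost H m p q) →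
            2 * a * s < b * p →
            Σ ℕ λ D → ∀ (n : ℕ) (G : Graph n) → 0 < n → Free H G → D * n ≤ edges G →
            Σ ℕ λ m → Σ (Graph m) λ J → 0 < m × MinorOf J G × edges G ^ a * m ^ b ≤ edges J ^ b * n ^ a
  general _ _ _ g s w refl refl refl (N₀ , bound) room =
    Parameters.conclusion H g b s w N₀ 0<b bound (linear 0 0 room (algebra b g s w))
    where
    algebra : ∀ b g s w → 1 * (2 * (g * s) + 1) + b * (2 * s + w) + 0 ≡ 1 * (b * w) + suc (2 * (b + g) * s)
    algebra = solve-∀
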